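{- Let $n\ge 1$, and let $M\subset 2\Delta\subset\mathbb{R}^n$ be a lattice polytope containing the point $O=\left(\frac{2}{n},\dots,\frac{2}{n}\right)$. Then a generic quadratic form $B\in\mathbb{C}^M$ is nondegenerate; that is, the set of degenerate quadratic forms in $\mathbb{C}^M$ is a proper algebraic subset of the finite-dimensional vector space $\mathbb{C}^M$.
   Context: For $i\in\{1,\dots,n\}$ let $A_i\in\mathbb{R}^n$ be the point whose $i$-th coordinate is $2$ and whose other coordinates are $0$, and let $2\Delta=\operatorname{conv}\{A_1,\dots,A_n\}$. A lattice polytope is the convex hull of a finite set of points of $\mathbb{Z}^n$. For a polynomial $p=\sum_k a_k z_1^{k_1}\cdots z_n^{k_n}\in\mathbb{C}[z_1,\dots,z_n]$, its Newton polytope is $N(p)=\operatorname{conv}\{k\in\mathbb{Z}^n\mid a_k\ne 0\}$. For a polytope $M$, $\mathbb{C}^M$ denotes the space of all polynomials $p\in\mathbb{C}[z_1,\dots,z_n]$ with $N(p)\subset M$; when $M\subset 2\Delta$, all elements of $\mathbb{C}^M$ are quadratic forms. A quadratic form $B=\sum_{i,j}B_{ij}z_iz_j$ with symmetric matrix $(B_{ij})$ is nondegenerate if $\det(B_{ij})\ne 0$, and degenerate otherwise. -}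

module Defs where

open import Level using (0ℓ)
open import Algebra.Bundles using (CommutativeRing; Semiring)
open import Algebra.Structures using (IsCommutativeRing)
open import Algebra.Module.Bundles using (Module)
import Algebra.Definitions.RawMonoid as RawMonoidDefinitions
import Algebra.Definitions.RawSemiring as RawSemiringDefinitions
import Algebra.Module.Construct.TensorUnit as TensorUnit
import Algebra.Module.Morphism.Structures as ModuleMorphism
import Algebra.Properties.Ring as RingProperties
open import Data.Bool.Base using (if_then_else_)
open import Data.Fin.Base using (Fin; zero; suc; toℕ; punchIn)
import Data.Fin.Properties as Fin
open import Data.Integer.Base as ℤ using (ℤ; +_)
open import Data.List.Base as List using (List; []; _∷_; _++_; foldr)
open import Data.List.Membership.Propositional using (_∈_)
open import Data.List.Relation.Unary.All as All using (All; []; _∷_)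
import Data.List.Relation.Unary.All.Properties as All
open import Data.Nat.Base as ℕ using (ℕ; zero; suc; NonZero)
import Data.Nat.Properties as ℕ
open import Data.Product.Base using (Σ; ∃; _×_; _,_; proj₁; proj₂)
open import Data.Rational.Base as ℚ using (ℚ; 0ℚ; 1ℚ; ½; ∣_∣; 1/_)
import Data.Rational.Properties as ℚ
open import Data.Sum.Base as Sum using (_⊎_; inj₁; inj₂; [_,_]′)
open import Data.Vec.Base as Vec using (Vec)
import Data.Vec.Properties as Vec
open import Data.Vec.Functional using (Vector)
open import Function.Bundles using (_⇔_)
open import Relation.Binary.PropositionalEquality
open import Relation.Nullary using (¬_; yes; no; does; contradiction)
open import Relation.Nullary.Decidable using (dec⇒maybe)
import Tactic.RingSolver as RingSolver
import Tactic.RingSolver.Core.AlmostCommutativeRing as ACR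
open import Relation.Unary using (Pred; _⊆_; ∁; Satisfiable)

private
  variable
    n : ℕ

-- The real numbers are Cauchy sequences of rationals, with a modulus of
-- convergence, up to null sequences.

Sequence : Set
Sequence = ℕ → ℚ

Eventually : Pred ℕ 0ℓ → Set
Eventually P = ∃ λ N → ∀ n → N ℕ.≤ n → P n

IsCauchy : Sequence → Set
IsCauchy x = ∀ ε → 0ℚ ℚ.< ε →
  ∃ λ N → ∀ m n → N ℕ.≤ m → N ℕ.≤ n → ∣ x m ℚ.- x n ∣ ℚ.< ε

-- Without η, and with the operations below given by copatterns, terms such as
-- x +ᴿ y stay folded, so that x and y can be inferred from them.
record ℝ : Set where
  no-eta-equality
  field
    seq      : Sequence
    isCauchy : IsCauchy seq

open ℝ public

infix 4 _≈ᴿ_ _≤ᴿ_ _#ᴿ_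

record _≈ᴿ_ (x y : ℝ) : Set where
  constructor mk≈
  field
    close : ∀ ε → 0ℚ ℚ.< ε → Eventually λ n → ∣ seq x n ℚ.- seq y n ∣ ℚ.< ε

record _≤ᴿ_ (x y : ℝ) : Set where
  constructor mk≤
  field
    below : ∀ ε → 0ℚ ℚ.< ε → Eventually λ n → seq x n ℚ.< seq y n ℚ.+ ε

-- Apartness, the constructive form of x ≠ y.
record _#ᴿ_ (x y : ℝ) : Set where
  constructor mk#
  field
    gap   : ℚ
    gap>0 : 0ℚ ℚ.< gap
    apart : Eventually λ n → gap ℚ.≤ ∣ seq x n ℚ.- seq y n ∣

open _≈ᴿ_ public
open _≤ᴿ_ public
open _#ᴿ_ public

module ℚ-Lemmas where

  ℚ-ring : ACR.AlmostCommutativeRing 0ℓ 0ℓ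
  ℚ-ring = ACR.fromCommutativeRing ℚ.+-*-commutativeRing (λ x → dec⇒maybe (0ℚ ℚ.≟ x))

  _∧ᴱ_ : {P Q : Pred ℕ 0ℓ} → Eventually P → Eventually Q →
         Eventually λ n → P n × Q n
  (M , p) ∧ᴱ (N , q) = M ℕ.⊔ N , λ n le →
    p n (ℕ.≤-trans (ℕ.m≤m⊔n M N) le) , q n (ℕ.≤-trans (ℕ.m≤n⊔m M N) le)

  abstract
    half : ∀ ε → 0ℚ ℚ.< ε → ∃ λ δ → 0ℚ ℚ.< δ × δ ℚ.+ δ ≡ ε
    half ε ε>0 = ½ ℚ.* ε
      , subst (ℚ._< ½ ℚ.* ε) (ℚ.*-zeroʳ ½) (ℚ.*-monoʳ-<-pos ½ ε>0)
      , trans (sym (ℚ.*-distribʳ-+ ε ½ ½)) (ℚ.*-identityˡ ε)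

  abs-+ : ∀ a b {δ ε} → δ ℚ.+ δ ≡ ε →
          ∣ a ∣ ℚ.< δ → ∣ b ∣ ℚ.< δ → ∣ a ℚ.+ b ∣ ℚ.< ε
  abs-+ a b e p q = subst (∣ a ℚ.+ b ∣ ℚ.<_) e
    (ℚ.≤-<-trans (ℚ.∣p+q∣≤∣p∣+∣q∣ a b) (ℚ.+-mono-< p q))

  neg-sub : ∀ a b → ℚ.- (a ℚ.- b) ≡ b ℚ.- a
  neg-sub = RingSolver.solve-∀ ℚ-ring

  sub-neg : ∀ a b → b ℚ.- a ≡ ℚ.- a ℚ.- (ℚ.- b)
  sub-neg = RingSolver.solve-∀ ℚ-ring

  sub-add : ∀ a b → (a ℚ.- b) ℚ.+ b ≡ a
  sub-add = RingSolver.solve-∀ ℚ-ring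

  neg-add : ∀ a b → ℚ.- a ℚ.+ (a ℚ.+ b) ≡ b
  neg-add = RingSolver.solve-∀ ℚ-ring

  sub-+ : ∀ a b c d → (a ℚ.+ b) ℚ.- (c ℚ.+ d) ≡ (a ℚ.- c) ℚ.+ (b ℚ.- d)
  sub-+ = RingSolver.solve-∀ ℚ-ring

  sub-* : ∀ a b c d →
    (a ℚ.* b) ℚ.- (c ℚ.* d) ≡ a ℚ.* (b ℚ.- d) ℚ.+ d ℚ.* (a ℚ.- c)
  sub-* = RingSolver.solve-∀ ℚ-ring

  sub-trans : ∀ a b c → a ℚ.- c ≡ (a ℚ.- b) ℚ.+ (b ℚ.- c)
  sub-trans = RingSolver.solve-∀ ℚ-ring

  ∣sub∣-sym : ∀ a b → ∣ a ℚ.- b ∣ ≡ ∣ b ℚ.- a ∣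
  ∣sub∣-sym a b = trans (sym (ℚ.∣-p∣≡∣p∣ (a ℚ.- b))) (cong ∣_∣ (neg-sub a b))

  ∣p∣-nonNeg : ∀ p → ℚ.NonNegative ∣ p ∣
  ∣p∣-nonNeg p = ℚ.nonNegative (ℚ.0≤∣p∣ p)

  abstract
    shrink : ∀ K → 0ℚ ℚ.< K → ∀ ε → 0ℚ ℚ.< ε → ∃ λ δ → 0ℚ ℚ.< δ × K ℚ.* δ ≡ ε
    shrink K K>0 ε ε>0 = K⁻¹ ℚ.* ε
      , subst (ℚ._< K⁻¹ ℚ.* ε) (ℚ.*-zeroʳ K⁻¹) (ℚ.*-monoʳ-<-pos K⁻¹ ε>0)
      , trans (sym (ℚ.*-assoc K K⁻¹ ε))
          (trans (cong (ℚ._* ε) (ℚ.*-inverseʳ K)) (ℚ.*-identityˡ ε))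
      where
      instance
        K-positive : ℚ.Positive K
        K-positive = ℚ.positive K>0
        K-nonZero : ℚ.NonZero K
        K-nonZero = ℚ.pos⇒nonZero K
      K⁻¹ : ℚ
      K⁻¹ = 1/ K
      instance
        K⁻¹-positive : ℚ.Positive K⁻¹
        K⁻¹-positive = ℚ.1/pos⇒pos K

  abs-* : ∀ a b {K δ ε} → 0ℚ ℚ.< K → K ℚ.* δ ≡ ε →
          ∣ a ∣ ℚ.≤ K → ∣ b ∣ ℚ.< δ → ∣ a ℚ.* b ∣ ℚ.< ε
  abs-* a b {K} K>0 eq p q = subst₂ ℚ._<_ (sym (ℚ.∣p*q∣≡∣p∣*∣q∣ a b)) eq
    (ℚ.≤-<-trans (ℚ.*-monoʳ-≤-nonNeg ∣ b ∣ {{∣p∣-nonNeg b}} p)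
                 (ℚ.*-monoʳ-<-pos K {{ℚ.positive K>0}} q))

  abs-sub-+ : ∀ {a b c d δ ε} → δ ℚ.+ δ ≡ ε →
    ∣ a ℚ.- c ∣ ℚ.< δ → ∣ b ℚ.- d ∣ ℚ.< δ → ∣ (a ℚ.+ b) ℚ.- (c ℚ.+ d) ∣ ℚ.< ε
  abs-sub-+ {a} {b} {c} {d} {ε = ε} e p q =
    subst (λ t → ∣ t ∣ ℚ.< ε) (sym (sub-+ a b c d)) (abs-+ (a ℚ.- c) (b ℚ.- d) e p q)

  abs-sub-* : ∀ {a b c d K L δ η ζ ε} → ζ ℚ.+ ζ ≡ ε → 0ℚ ℚ.< K → 0ℚ ℚ.< L →
    K ℚ.* δ ≡ ζ → L ℚ.* η ≡ ζ → ∣ a ∣ ℚ.≤ K → ∣ d ∣ ℚ.≤ L →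
    ∣ b ℚ.- d ∣ ℚ.< δ → ∣ a ℚ.- c ∣ ℚ.< η → ∣ (a ℚ.* b) ℚ.- (c ℚ.* d) ∣ ℚ.< ε
  abs-sub-* {a} {b} {c} {d} {ε = ε} e K>0 L>0 eδ eη p q r s =
    subst (λ t → ∣ t ∣ ℚ.< ε) (sym (sub-* a b c d))
      (abs-+ (a ℚ.* (b ℚ.- d)) (d ℚ.* (a ℚ.- c)) e
        (abs-* a (b ℚ.- d) K>0 eδ p r) (abs-* d (a ℚ.- c) L>0 eη q s))

  abstract
    bounded : ∀ x → IsCauchy x →
              ∃ λ K → 0ℚ ℚ.< K × Eventually λ n → ∣ x n ∣ ℚ.≤ K
    bounded x cx =
      let N , c = cx 1ℚ (ℚ.positive⁻¹ 1ℚ)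
      in 1ℚ ℚ.+ ∣ x N ∣
       , ℚ.+-mono-<-≤ (ℚ.positive⁻¹ 1ℚ) (ℚ.0≤∣p∣ (x N))
       , N , λ n le → ℚ.≤-trans
           (subst (λ t → ∣ t ∣ ℚ.≤ ∣ x n ℚ.- x N ∣ ℚ.+ ∣ x N ∣)
             (sub-add (x n) (x N))
             (ℚ.∣p+q∣≤∣p∣+∣q∣ (x n ℚ.- x N) (x N)))
           (ℚ.+-monoˡ-≤ ∣ x N ∣ (ℚ.<⇒≤ (c n N le ℕ.≤-refl)))

  abstract
    +-isCauchy : ∀ x y → IsCauchy x → IsCauchy y →
                 IsCauchy λ n → x n ℚ.+ y n
    +-isCauchy x y cx cy ε ε>0 =
      let δ , δ>0 , e = half ε ε>0
          M , p = cx δ δ>0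
          N , q = cy δ δ>0
          M≤ = ℕ.m≤m⊔n M N
          N≤ = ℕ.m≤n⊔m M N
      in M ℕ.⊔ N , λ m n lm ln → abs-sub-+ {x m} {y m} {x n} {y n} e
           (p m n (ℕ.≤-trans M≤ lm) (ℕ.≤-trans M≤ ln))
           (q m n (ℕ.≤-trans N≤ lm) (ℕ.≤-trans N≤ ln))

    neg-isCauchy : ∀ x → IsCauchy x → IsCauchy λ n → ℚ.- x n
    neg-isCauchy x cx ε ε>0 with cx ε ε>0
    ... | N , p = N , λ m n lm ln → subst (ℚ._< ε)
      (trans (∣sub∣-sym (x m) (x n)) (cong ∣_∣ (sub-neg (x m) (x n))))
      (p m n lm ln)

    *-isCauchy : ∀ x y → IsCauchy x → IsCauchy y →
                 IsCauchy λ n → x n ℚ.* y n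
    *-isCauchy x y cx cy ε ε>0 =
      let ζ , ζ>0 , eζ = half ε ε>0
          K , K>0 , A , bx = bounded x cx
          L , L>0 , B , by = bounded y cy
          δ , δ>0 , eδ = shrink K K>0 ζ ζ>0
          η , η>0 , eη = shrink L L>0 ζ ζ>0
          M , p = cy δ δ>0
          N , q = cx η η>0
          C = (A ℕ.⊔ B) ℕ.⊔ (M ℕ.⊔ N)
          A≤ = ℕ.≤-trans (ℕ.m≤m⊔n A B) (ℕ.m≤m⊔n (A ℕ.⊔ B) (M ℕ.⊔ N))
          B≤ = ℕ.≤-trans (ℕ.m≤n⊔m A B) (ℕ.m≤m⊔n (A ℕ.⊔ B) (M ℕ.⊔ N))
          M≤ = ℕ.≤-trans (ℕ.m≤m⊔n M N) (ℕ.m≤n⊔m (A ℕ.⊔ B) (M ℕ.⊔ N))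
          N≤ = ℕ.≤-trans (ℕ.m≤n⊔m M N) (ℕ.m≤n⊔m (A ℕ.⊔ B) (M ℕ.⊔ N))
      in C , λ m n lm ln → abs-sub-* {x m} {y m} {x n} {y n} eζ K>0 L>0 eδ eη
           (bx m (ℕ.≤-trans A≤ lm)) (by n (ℕ.≤-trans B≤ ln))
           (p m n (ℕ.≤-trans M≤ lm) (ℕ.≤-trans M≤ ln))
           (q m n (ℕ.≤-trans N≤ lm) (ℕ.≤-trans N≤ ln))

    const-isCauchy : ∀ q → IsCauchy λ _ → q
    const-isCauchy q ε ε>0 = 0 , λ _ _ _ _ →
      subst (ℚ._< ε) (sym (cong ∣_∣ (ℚ.+-inverseʳ q))) ε>0

open ℚ-Lemmas

infixl 6 _+ᴿ_
infixl 7 _*ᴿ_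
infix  8 -ᴿ_

fromℚ : ℚ → ℝ
seq      (fromℚ q) _ = q
isCauchy (fromℚ q)   = const-isCauchy q

_+ᴿ_ : ℝ → ℝ → ℝ
seq      (x +ᴿ y) n = seq x n ℚ.+ seq y n
isCauchy (x +ᴿ y)   = +-isCauchy (seq x) (seq y) (isCauchy x) (isCauchy y)

-ᴿ_ : ℝ → ℝ
seq      (-ᴿ x) n = ℚ.- seq x n
isCauchy (-ᴿ x)   = neg-isCauchy (seq x) (isCauchy x)

_*ᴿ_ : ℝ → ℝ → ℝ
seq      (x *ᴿ y) n = seq x n ℚ.* seq y n
isCauchy (x *ᴿ y)   = *-isCauchy (seq x) (seq y) (isCauchy x) (isCauchy y)

0ᴿ 1ᴿ : ℝ
0ᴿ = fromℚ 0ℚ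
1ᴿ = fromℚ 1ℚ

module ℝ-Lemmas where

  <⇒≱ : ∀ {p q} → p ℚ.< q → ¬ q ℚ.≤ p
  <⇒≱ p<q q≤p = ℚ.<-irrefl refl (ℚ.<-≤-trans p<q q≤p)

  sub-0 : ∀ a → a ℚ.- 0ℚ ≡ a
  sub-0 = ℚ.+-identityʳ

  -- a sequence far from zero at one late index stays away from zero
  stays-apart : ∀ (x : ℝ) P (δ : ℚ) {γ} → 0ℚ ℚ.< δ → δ ℚ.+ δ ≡ γ →
    (∀ m n → P ℕ.≤ m → P ℕ.≤ n → ∣ seq x m ℚ.- seq x n ∣ ℚ.< δ) →
    γ ℚ.≤ ∣ seq x P ∣ → x #ᴿ 0ᴿ
  stays-apart x P δ {γ} δ>0 e c far = mk# δ δ>0 (P , λ n le → ℚ.≮⇒≥ λ near →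
    <⇒≱ (subst (λ t → ∣ t ∣ ℚ.< γ) (sub-add (seq x P) (seq x n))
          (abs-+ (seq x P ℚ.- seq x n) (seq x n) e (c P n ℕ.≤-refl le)
            (subst (λ t → ∣ t ∣ ℚ.< δ) (sub-0 (seq x n)) near)))
        far)

  negligible : ∀ a {δ} → a ℚ.≤ 0ℚ → 0ℚ ℚ.< a ℚ.+ δ → ∣ a ∣ ℚ.< δ
  negligible a {δ} a≤0 p = subst₂ ℚ._<_
    (trans (ℚ.+-identityʳ (ℚ.- a))
      (trans (sym (ℚ.0≤p⇒∣p∣≡p (ℚ.neg-antimono-≤ a≤0))) (ℚ.∣-p∣≡∣p∣ a)))
    (neg-add a δ)
    (ℚ.+-monoʳ-< (ℚ.- a) p)

  small⇒ : ∀ c {ε} → ∣ c ∣ ℚ.< ε → 0ℚ ℚ.< c ℚ.+ ε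
  small⇒ c {ε} p = ℚ.≤-<-trans
    (subst (ℚ._≤ c ℚ.+ ∣ c ∣) (ℚ.+-inverseʳ c)
      (ℚ.+-monoʳ-≤ c (subst (ℚ.- c ℚ.≤_) (ℚ.∣-p∣≡∣p∣ c) (p≤∣p∣ (ℚ.- c)))))
    (ℚ.+-monoʳ-< c p)
    where
    p≤∣p∣ : ∀ p → p ℚ.≤ ∣ p ∣
    p≤∣p∣ p with ℚ.≤-total 0ℚ p
    ... | inj₁ p≥0 = ℚ.≤-reflexive (sym (ℚ.0≤p⇒∣p∣≡p p≥0))
    ... | inj₂ p≤0 = ℚ.≤-trans p≤0 (ℚ.0≤∣p∣ p)

  product> : ∀ a b {K L δ η ε} → 0ℚ ℚ.< ε → 0ℚ ℚ.< K → 0ℚ ℚ.< L →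
    K ℚ.* δ ≡ ε → L ℚ.* η ≡ ε → 0ℚ ℚ.< a ℚ.+ η → 0ℚ ℚ.< b ℚ.+ δ →
    ∣ a ∣ ℚ.≤ K → ∣ b ∣ ℚ.≤ L → 0ℚ ℚ.< a ℚ.* b ℚ.+ ε
  product> a b {ε = ε} ε>0 K>0 L>0 eδ eη pa pb qa qb
    with ℚ.≤-total 0ℚ a | ℚ.≤-total 0ℚ b
  ... | inj₁ a≥0 | inj₁ b≥0 = ℚ.+-mono-≤-< {0ℚ} {a ℚ.* b} {0ℚ} {ε}
    (subst (ℚ._≤ a ℚ.* b) (ℚ.*-zeroʳ a)
      (ℚ.*-monoˡ-≤-nonNeg a {{ℚ.nonNegative a≥0}} b≥0))
    ε>0
  ... | _        | inj₂ b≤0 = small⇒ (a ℚ.* b)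
    (abs-* a b K>0 eδ qa (negligible b b≤0 pb))
  ... | inj₂ a≤0 | _        = small⇒ (a ℚ.* b)
    (subst (λ t → ∣ t ∣ ℚ.< ε) (ℚ.*-comm b a)
      (abs-* b a L>0 eη qb (negligible a a≤0 pa)))

  one-large : ∀ a b {γ ε} → γ ℚ.+ γ ≡ ε → ε ℚ.≤ ∣ (a ℚ.+ b) ℚ.- 0ℚ ∣ →
              γ ℚ.≤ ∣ a ∣ ⊎ γ ℚ.≤ ∣ b ∣
  one-large a b {γ} {ε} e far with γ ℚ.≤? ∣ a ∣
  ... | yes a≥γ = inj₁ a≥γ
  ... | no  a≱γ = inj₂ (ℚ.≮⇒≥ λ b<γ → <⇒≱
    (subst (λ t → ∣ t ∣ ℚ.< ε) (sym (sub-0 (a ℚ.+ b)))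
      (abs-+ a b e (ℚ.≰⇒> a≱γ) b<γ))
    far)

  abstract
    ≗⇒≈ᴿ : ∀ {x y} → (∀ n → seq x n ≡ seq y n) → x ≈ᴿ y
    ≗⇒≈ᴿ {x} {y} e = mk≈ λ ε ε>0 → 0 , λ n _ → subst (ℚ._< ε)
      (sym (cong ∣_∣ (trans (cong (ℚ._- seq y n) (e n)) (ℚ.+-inverseʳ (seq y n)))))
      ε>0

    ≈ᴿ-sym : ∀ {x y} → x ≈ᴿ y → y ≈ᴿ x
    ≈ᴿ-sym {x} {y} e = mk≈ λ ε ε>0 →
      let N , p = close e ε ε>0
      in N , λ n le → subst (ℚ._< ε) (∣sub∣-sym (seq x n) (seq y n)) (p n le)

    ≈ᴿ-trans : ∀ {x y z} → x ≈ᴿ y → y ≈ᴿ z → x ≈ᴿ z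
    ≈ᴿ-trans {x} {y} {z} d e = mk≈ λ ε ε>0 →
      let δ , δ>0 , eδ = half ε ε>0
          N , p = close d δ δ>0 ∧ᴱ close e δ δ>0
      in N , λ n le →
        subst (λ t → ∣ t ∣ ℚ.< ε) (sym (sub-trans (seq x n) (seq y n) (seq z n)))
          (abs-+ (seq x n ℚ.- seq y n) (seq y n ℚ.- seq z n) eδ
            (proj₁ (p n le)) (proj₂ (p n le)))

    +ᴿ-cong : ∀ {x y u v} → x ≈ᴿ y → u ≈ᴿ v → x +ᴿ u ≈ᴿ y +ᴿ v
    +ᴿ-cong {x} {y} {u} {v} d e = mk≈ λ ε ε>0 →
      let δ , δ>0 , eδ = half ε ε>0
          N , p = close d δ δ>0 ∧ᴱ close e δ δ>0
      in N , λ n le → abs-sub-+ {seq x n} {seq u n} {seq y n} {seq v n} eδ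
           (proj₁ (p n le)) (proj₂ (p n le))

    -ᴿ-cong : ∀ {x y} → x ≈ᴿ y → -ᴿ x ≈ᴿ -ᴿ y
    -ᴿ-cong {x} {y} e = mk≈ λ ε ε>0 →
      let N , p = close e ε ε>0
      in N , λ n le → subst (ℚ._< ε)
           (trans (∣sub∣-sym (seq x n) (seq y n)) (cong ∣_∣ (sub-neg (seq x n) (seq y n))))
           (p n le)

    *ᴿ-cong : ∀ {x y u v} → x ≈ᴿ y → u ≈ᴿ v → x *ᴿ u ≈ᴿ y *ᴿ v
    *ᴿ-cong {x} {y} {u} {v} d e = mk≈ λ ε ε>0 →
      let ζ , ζ>0 , eζ = half ε ε>0
          K , K>0 , bx = bounded (seq x) (isCauchy x)
          L , L>0 , bv = bounded (seq v) (isCauchy v)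
          δ , δ>0 , eδ = shrink K K>0 ζ ζ>0
          η , η>0 , eη = shrink L L>0 ζ ζ>0
          N , p = (close e δ δ>0 ∧ᴱ close d η η>0) ∧ᴱ (bx ∧ᴱ bv)
      in N , λ n le → abs-sub-* {seq x n} {seq u n} {seq y n} {seq v n}
           eζ K>0 L>0 eδ eη
           (proj₁ (proj₂ (p n le))) (proj₂ (proj₂ (p n le)))
           (proj₁ (proj₁ (p n le))) (proj₂ (proj₁ (p n le)))

open ℝ-Lemmas

abstract
  ℝ-isCommutativeRing : IsCommutativeRing _≈ᴿ_ _+ᴿ_ _*ᴿ_ -ᴿ_ 0ᴿ 1ᴿ
  ℝ-isCommutativeRing = record
    { isRing = record
      { +-isAbelianGroup = record
        { isGroup = record
          { isMonoid = record
            { isSemigroup = record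
              { isMagma = record
                { isEquivalence = record
                  { refl  = ≗⇒≈ᴿ λ _ → refl
                  ; sym   = ≈ᴿ-sym
                  ; trans = ≈ᴿ-trans
                  }
                ; ∙-cong = +ᴿ-cong
                }
              ; assoc = λ x y z → ≗⇒≈ᴿ
                  λ n → ℚ.+-assoc (seq x n) (seq y n) (seq z n)
              }
            ; identity = (λ x → ≗⇒≈ᴿ λ n → ℚ.+-identityˡ (seq x n))
                       , (λ x → ≗⇒≈ᴿ λ n → ℚ.+-identityʳ (seq x n))
            }
          ; inverse = (λ x → ≗⇒≈ᴿ λ n → ℚ.+-inverseˡ (seq x n))
                    , (λ x → ≗⇒≈ᴿ λ n → ℚ.+-inverseʳ (seq x n))
          ; ⁻¹-cong = -ᴿ-cong
          }
        ; comm = λ x y → ≗⇒≈ᴿ λ n → ℚ.+-comm (seq x n) (seq y n)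
        }
      ; *-cong = *ᴿ-cong
      ; *-assoc = λ x y z → ≗⇒≈ᴿ
          λ n → ℚ.*-assoc (seq x n) (seq y n) (seq z n)
      ; *-identity = (λ x → ≗⇒≈ᴿ λ n → ℚ.*-identityˡ (seq x n))
                   , (λ x → ≗⇒≈ᴿ λ n → ℚ.*-identityʳ (seq x n))
      ; distrib = (λ x y z → ≗⇒≈ᴿ
                    λ n → ℚ.*-distribˡ-+ (seq x n) (seq y n) (seq z n))
                , (λ x y z → ≗⇒≈ᴿ
                    λ n → ℚ.*-distribʳ-+ (seq x n) (seq y n) (seq z n))
      }
    ; *-comm = λ x y → ≗⇒≈ᴿ λ n → ℚ.*-comm (seq x n) (seq y n)
    }

  +ᴿ-#0 : ∀ x y → x +ᴿ y #ᴿ 0ᴿ → x #ᴿ 0ᴿ ⊎ y #ᴿ 0ᴿ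
  +ᴿ-#0 x y (mk# ε ε>0 (N , far)) =
    let γ , γ>0 , eγ = half ε ε>0
        δ , δ>0 , eδ = half γ γ>0
        A , cx = isCauchy x δ δ>0
        B , cy = isCauchy y δ δ>0
        P = N ℕ.⊔ (A ℕ.⊔ B)
        N≤ = ℕ.m≤m⊔n N (A ℕ.⊔ B)
        A≤ = ℕ.≤-trans (ℕ.m≤m⊔n A B) (ℕ.m≤n⊔m N (A ℕ.⊔ B))
        B≤ = ℕ.≤-trans (ℕ.m≤n⊔m A B) (ℕ.m≤n⊔m N (A ℕ.⊔ B))
    in Sum.map
         (stays-apart x P δ δ>0 eδ λ m n lm ln →
           cx m n (ℕ.≤-trans A≤ lm) (ℕ.≤-trans A≤ ln))
         (stays-apart y P δ δ>0 eδ λ m n lm ln →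
           cy m n (ℕ.≤-trans B≤ lm) (ℕ.≤-trans B≤ ln))
         (one-large (seq x P) (seq y P) eγ (far P N≤))

  *ᴿ-#0 : ∀ x y → x *ᴿ y #ᴿ 0ᴿ → y #ᴿ 0ᴿ
  *ᴿ-#0 x y (mk# ε ε>0 far) =
    let K , K>0 , bx = bounded (seq x) (isCauchy x)
        δ , δ>0 , e = shrink K K>0 ε ε>0
        N , p = far ∧ᴱ bx
    in mk# δ δ>0 (N , λ n le → ℚ.≮⇒≥ λ near → <⇒≱
         (subst (λ t → ∣ t ∣ ℚ.< ε) (sym (sub-0 (seq x n ℚ.* seq y n)))
           (abs-* (seq x n) (seq y n) K>0 e (proj₂ (p n le))
             (subst (λ t → ∣ t ∣ ℚ.< δ) (sub-0 (seq y n)) near)))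
         (proj₁ (p n le)))

  -ᴿ-#0 : ∀ x → -ᴿ x #ᴿ 0ᴿ → x #ᴿ 0ᴿ
  -ᴿ-#0 x (mk# ε ε>0 (N , far)) = mk# ε ε>0 (N , λ n le → subst (ε ℚ.≤_)
    (trans (cong ∣_∣ (sub-0 (ℚ.- seq x n)))
      (trans (ℚ.∣-p∣≡∣p∣ (seq x n)) (cong ∣_∣ (sym (sub-0 (seq x n))))))
    (far n le))

  0ᴿ≤1ᴿ : 0ᴿ ≤ᴿ 1ᴿ
  0ᴿ≤1ᴿ = mk≤ λ ε ε>0 → 0 , λ _ _ →
    ℚ.+-mono-< (ℚ.positive⁻¹ 1ℚ) ε>0

  *ᴿ-nonNeg : ∀ {x y} → 0ᴿ ≤ᴿ x → 0ᴿ ≤ᴿ y → 0ᴿ ≤ᴿ x *ᴿ y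
  *ᴿ-nonNeg {x} {y} x≥0 y≥0 = mk≤ λ ε ε>0 →
    let K , K>0 , bx = bounded (seq x) (isCauchy x)
        L , L>0 , by = bounded (seq y) (isCauchy y)
        δ , δ>0 , eδ = shrink K K>0 ε ε>0
        η , η>0 , eη = shrink L L>0 ε ε>0
        N , p = (below x≥0 η η>0 ∧ᴱ below y≥0 δ δ>0) ∧ᴱ (bx ∧ᴱ by)
    in N , λ n le → product> (seq x n) (seq y n) ε>0 K>0 L>0 eδ eη
         (proj₁ (proj₁ (p n le))) (proj₂ (proj₁ (p n le)))
         (proj₁ (proj₂ (p n le))) (proj₂ (proj₂ (p n le)))

  0ᴿ-#0 : ¬ 0ᴿ #ᴿ 0ᴿ
  0ᴿ-#0 (mk# ε ε>0 (N , far)) = <⇒≱ ε>0 (far N ℕ.≤-refl)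

ℝ-commutativeRing : CommutativeRing 0ℓ 0ℓ
ℝ-commutativeRing = record { isCommutativeRing = ℝ-isCommutativeRing }

record ℂ : Set where
  no-eta-equality
  field
    re im : ℝ

open ℂ public

infix 4 _≈ᶜ_ _#ᶜ_

record _≈ᶜ_ (x y : ℂ) : Set where
  constructor mk≈ᶜ
  field
    re≈ : re x ≈ᴿ re y
    im≈ : im x ≈ᴿ im y

open _≈ᶜ_ public

_#ᶜ_ : ℂ → ℂ → Set
x #ᶜ y = re x #ᴿ re y ⊎ im x #ᴿ im y

infixl 6 _+ᶜ_
infixl 7 _*ᶜ_
infix  8 -ᶜ_

_+ᶜ_ : ℂ → ℂ → ℂ
re (x +ᶜ y) = re x +ᴿ re y
im (x +ᶜ y) = im x +ᴿ im y

_*ᶜ_ : ℂ → ℂ → ℂ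
re (x *ᶜ y) = re x *ᴿ re y +ᴿ -ᴿ (im x *ᴿ im y)
im (x *ᶜ y) = re x *ᴿ im y +ᴿ im x *ᴿ re y

-ᶜ_ : ℂ → ℂ
re (-ᶜ x) = -ᴿ re x
im (-ᶜ x) = -ᴿ im x

0ᶜ 1ᶜ : ℂ
re 0ᶜ = 0ᴿ
im 0ᶜ = 0ᴿ
re 1ᶜ = 1ᴿ
im 1ᶜ = 0ᴿ

private
  assoc-re : ∀ a b c d e f →
    (a ℚ.* c ℚ.+ ℚ.- (b ℚ.* d)) ℚ.* e ℚ.+ ℚ.- ((a ℚ.* d ℚ.+ b ℚ.* c) ℚ.* f) ≡
    a ℚ.* (c ℚ.* e ℚ.+ ℚ.- (d ℚ.* f)) ℚ.+ ℚ.- (b ℚ.* (c ℚ.* f ℚ.+ d ℚ.* e))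
  assoc-re = RingSolver.solve-∀ ℚ-ring

  assoc-im : ∀ a b c d e f →
    (a ℚ.* c ℚ.+ ℚ.- (b ℚ.* d)) ℚ.* f ℚ.+ (a ℚ.* d ℚ.+ b ℚ.* c) ℚ.* e ≡
    a ℚ.* (c ℚ.* f ℚ.+ d ℚ.* e) ℚ.+ b ℚ.* (c ℚ.* e ℚ.+ ℚ.- (d ℚ.* f))
  assoc-im = RingSolver.solve-∀ ℚ-ring

  comm-re : ∀ a b c d → a ℚ.* c ℚ.+ ℚ.- (b ℚ.* d) ≡ c ℚ.* a ℚ.+ ℚ.- (d ℚ.* b)
  comm-re = RingSolver.solve-∀ ℚ-ring

  comm-im : ∀ a b c d → a ℚ.* d ℚ.+ b ℚ.* c ≡ c ℚ.* b ℚ.+ d ℚ.* a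
  comm-im = RingSolver.solve-∀ ℚ-ring

  identityˡ-re : ∀ a b → 1ℚ ℚ.* a ℚ.+ ℚ.- (0ℚ ℚ.* b) ≡ a
  identityˡ-re = RingSolver.solve-∀ ℚ-ring

  identityˡ-im : ∀ a b → 1ℚ ℚ.* b ℚ.+ 0ℚ ℚ.* a ≡ b
  identityˡ-im = RingSolver.solve-∀ ℚ-ring

  distribˡ-re : ∀ a b c d e f →
    a ℚ.* (c ℚ.+ e) ℚ.+ ℚ.- (b ℚ.* (d ℚ.+ f)) ≡
    (a ℚ.* c ℚ.+ ℚ.- (b ℚ.* d)) ℚ.+ (a ℚ.* e ℚ.+ ℚ.- (b ℚ.* f))
  distribˡ-re = RingSolver.solve-∀ ℚ-ring

  distribˡ-im : ∀ a b c d e f →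
    a ℚ.* (d ℚ.+ f) ℚ.+ b ℚ.* (c ℚ.+ e) ≡
    (a ℚ.* d ℚ.+ b ℚ.* c) ℚ.+ (a ℚ.* f ℚ.+ b ℚ.* e)
  distribˡ-im = RingSolver.solve-∀ ℚ-ring

  module R = CommutativeRing ℝ-commutativeRing

abstract
  ℂ-isCommutativeRing : IsCommutativeRing _≈ᶜ_ _+ᶜ_ _*ᶜ_ -ᶜ_ 0ᶜ 1ᶜ
  ℂ-isCommutativeRing = record
    { isRing = record
      { +-isAbelianGroup = record
        { isGroup = record
          { isMonoid = record
            { isSemigroup = record
              { isMagma = record
                { isEquivalence = record
                  { refl  = mk≈ᶜ R.refl R.refl
                  ; sym   = λ (mk≈ᶜ p q) → mk≈ᶜ (R.sym p) (R.sym q)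
                  ; trans = ≈ᶜ-trans
                  }
                ; ∙-cong = λ (mk≈ᶜ p q) (mk≈ᶜ r s) → mk≈ᶜ (R.+-cong p r) (R.+-cong q s)
                }
              ; assoc = λ x y z →
                  mk≈ᶜ (R.+-assoc (re x) (re y) (re z)) (R.+-assoc (im x) (im y) (im z))
              }
            ; identity = (λ x → mk≈ᶜ (R.+-identityˡ (re x)) (R.+-identityˡ (im x)))
                       , (λ x → mk≈ᶜ (R.+-identityʳ (re x)) (R.+-identityʳ (im x)))
            }
          ; inverse = (λ x → mk≈ᶜ (R.-‿inverseˡ (re x)) (R.-‿inverseˡ (im x)))
                    , (λ x → mk≈ᶜ (R.-‿inverseʳ (re x)) (R.-‿inverseʳ (im x)))
          ; ⁻¹-cong = λ (mk≈ᶜ p q) → mk≈ᶜ (R.-‿cong p) (R.-‿cong q)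
          }
        ; comm = λ x y → mk≈ᶜ (R.+-comm (re x) (re y)) (R.+-comm (im x) (im y))
        }
      ; *-cong = *ᶜ-cong
      ; *-assoc = λ x y z →
          mk≈ᶜ (≗⇒≈ᴿ λ n → assoc-re
                  (seq (re x) n) (seq (im x) n) (seq (re y) n) (seq (im y) n)
                  (seq (re z) n) (seq (im z) n))
               (≗⇒≈ᴿ λ n → assoc-im
                  (seq (re x) n) (seq (im x) n) (seq (re y) n) (seq (im y) n)
                  (seq (re z) n) (seq (im z) n))
      ; *-identity = 1ᶜ-identityˡ
                   , (λ x → ≈ᶜ-trans (*ᶜ-comm x 1ᶜ) (1ᶜ-identityˡ x))
      ; distrib = distribᶜ
                , (λ x y z → ≈ᶜ-trans (*ᶜ-comm (y +ᶜ z) x) (≈ᶜ-trans (distribᶜ x y z)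
                    (+ᶜ-cong (*ᶜ-comm x y) (*ᶜ-comm x z))))
      }
    ; *-comm = *ᶜ-comm
    }
    where
    ≈ᶜ-trans : ∀ {x y z} → x ≈ᶜ y → y ≈ᶜ z → x ≈ᶜ z
    ≈ᶜ-trans (mk≈ᶜ p q) (mk≈ᶜ r s) = mk≈ᶜ (R.trans p r) (R.trans q s)

    +ᶜ-cong : ∀ {x y u v} → x ≈ᶜ y → u ≈ᶜ v → x +ᶜ u ≈ᶜ y +ᶜ v
    +ᶜ-cong (mk≈ᶜ p q) (mk≈ᶜ r s) = mk≈ᶜ (R.+-cong p r) (R.+-cong q s)

    *ᶜ-cong : ∀ {x y u v} → x ≈ᶜ y → u ≈ᶜ v → x *ᶜ u ≈ᶜ y *ᶜ v
    *ᶜ-cong (mk≈ᶜ p q) (mk≈ᶜ r s) = mk≈ᶜ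
      (R.+-cong (R.*-cong p r) (R.-‿cong (R.*-cong q s)))
      (R.+-cong (R.*-cong p s) (R.*-cong q r))

    *ᶜ-comm : ∀ x y → x *ᶜ y ≈ᶜ y *ᶜ x
    *ᶜ-comm x y =
      mk≈ᶜ (≗⇒≈ᴿ λ n → comm-re
              (seq (re x) n) (seq (im x) n) (seq (re y) n) (seq (im y) n))
           (≗⇒≈ᴿ λ n → comm-im
              (seq (re x) n) (seq (im x) n) (seq (re y) n) (seq (im y) n))

    1ᶜ-identityˡ : ∀ x → 1ᶜ *ᶜ x ≈ᶜ x
    1ᶜ-identityˡ x =
      mk≈ᶜ (≗⇒≈ᴿ λ n → identityˡ-re
              (seq (re x) n) (seq (im x) n))
           (≗⇒≈ᴿ λ n → identityˡ-im
              (seq (re x) n) (seq (im x) n))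

    distribᶜ : ∀ x y z → x *ᶜ (y +ᶜ z) ≈ᶜ x *ᶜ y +ᶜ x *ᶜ z
    distribᶜ x y z =
      mk≈ᶜ (≗⇒≈ᴿ λ n → distribˡ-re
              (seq (re x) n) (seq (im x) n) (seq (re y) n) (seq (im y) n)
              (seq (re z) n) (seq (im z) n))
           (≗⇒≈ᴿ λ n → distribˡ-im
              (seq (re x) n) (seq (im x) n) (seq (re y) n) (seq (im y) n)
              (seq (re z) n) (seq (im z) n))

  +ᶜ-#0 : ∀ x y → x +ᶜ y #ᶜ 0ᶜ → x #ᶜ 0ᶜ ⊎ y #ᶜ 0ᶜ
  +ᶜ-#0 x y (inj₁ p) = Sum.map inj₁ inj₁ (+ᴿ-#0 (re x) (re y) p)
  +ᶜ-#0 x y (inj₂ p) = Sum.map inj₂ inj₂ (+ᴿ-#0 (im x) (im y) p)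

  *ᶜ-#0 : ∀ x y → x *ᶜ y #ᶜ 0ᶜ → y #ᶜ 0ᶜ
  *ᶜ-#0 x y (inj₁ p) =
    [ (λ q → inj₁ (*ᴿ-#0 (re x) (re y) q))
    , (λ q → inj₂ (*ᴿ-#0 (im x) (im y) (-ᴿ-#0 (im x *ᴿ im y) q)))
    ]′ (+ᴿ-#0 (re x *ᴿ re y) (-ᴿ (im x *ᴿ im y)) p)
  *ᶜ-#0 x y (inj₂ p) =
    [ (λ q → inj₂ (*ᴿ-#0 (re x) (im y) q))
    , (λ q → inj₁ (*ᴿ-#0 (im x) (re y) q))
    ]′ (+ᴿ-#0 (re x *ᴿ im y) (im x *ᴿ re y) p)

  -ᶜ-#0 : ∀ x → -ᶜ x #ᶜ 0ᶜ → x #ᶜ 0ᶜ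
  -ᶜ-#0 x = Sum.map (-ᴿ-#0 (re x)) (-ᴿ-#0 (im x))

  0ᶜ-#0 : ¬ 0ᶜ #ᶜ 0ᶜ
  0ᶜ-#0 = [ 0ᴿ-#0 , 0ᴿ-#0 ]′

ℂ-commutativeRing : CommutativeRing 0ℓ 0ℓ
ℂ-commutativeRing = record { isCommutativeRing = ℂ-isCommutativeRing }

ℝ^ : ℕ → Set
ℝ^ n = Vector ℝ n

infix 4 _≋_

_≋_ : ℝ^ n → ℝ^ n → Set
x ≋ y = ∀ i → x i ≈ᴿ y i

Weighted : ℕ → Set
Weighted n = List (ℝ × ℝ^ n)

totalWeight : Weighted n → ℝ
totalWeight = foldr (λ (w , _) s → w +ᴿ s) 0ᴿ

weightedSum : Weighted n → ℝ^ n
weightedSum ts i = foldr (λ (w , p) s → w *ᴿ p i +ᴿ s) 0ᴿ ts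

record ConvexCombination (S : Pred (ℝ^ n) 0ℓ) (x : ℝ^ n) : Set where
  field
    terms   : Weighted n
    allowed : All (λ (w , p) → 0ᴿ ≤ᴿ w × S p) terms
    total   : totalWeight terms ≈ᴿ 1ᴿ
    value   : weightedSum terms ≋ x

conv : Pred (ℝ^ n) 0ℓ → Pred (ℝ^ n) 0ℓ
conv = ConvexCombination

module Weighted-Lemmas where

  scaleTerms : ℝ → Weighted n → Weighted n
  scaleTerms c = List.map λ (w , p) → c *ᴿ w , p

  total-++ : ∀ (us vs : Weighted n) →
             totalWeight (us ++ vs) ≈ᴿ totalWeight us +ᴿ totalWeight vs
  total-++ []             vs = R.sym (R.+-identityˡ _)
  total-++ ((w , _) ∷ us) vs =
    R.trans (R.+-congˡ (total-++ us vs)) (R.sym (R.+-assoc w _ _))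

  sum-++ : ∀ (us vs : Weighted n) i →
           weightedSum (us ++ vs) i ≈ᴿ weightedSum us i +ᴿ weightedSum vs i
  sum-++ []             vs i = R.sym (R.+-identityˡ _)
  sum-++ ((w , p) ∷ us) vs i =
    R.trans (R.+-congˡ (sum-++ us vs i)) (R.sym (R.+-assoc (w *ᴿ p i) _ _))

  total-scale : ∀ c (us : Weighted n) → totalWeight (scaleTerms c us) ≈ᴿ c *ᴿ totalWeight us
  total-scale c []             = R.sym (R.zeroʳ c)
  total-scale c ((w , _) ∷ us) =
    R.trans (R.+-congˡ (total-scale c us)) (R.sym (R.distribˡ c w _))

  sum-scale : ∀ c (us : Weighted n) i →
              weightedSum (scaleTerms c us) i ≈ᴿ c *ᴿ weightedSum us i
  sum-scale c []             i = R.sym (R.zeroʳ c)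
  sum-scale c ((w , p) ∷ us) i =
    R.trans (R.+-cong (R.*-assoc c w (p i)) (sum-scale c us i))
            (R.sym (R.distribˡ c (w *ᴿ p i) _))

  module _ {S : Pred (ℝ^ n) 0ℓ} where
    open ConvexCombination

    Allowed : Weighted n → Set
    Allowed = All λ (w , p) → 0ᴿ ≤ᴿ w × S p

    allowed-scale : ∀ {c us} → 0ᴿ ≤ᴿ c → Allowed us → Allowed (scaleTerms c us)
    allowed-scale c≥0 []               = []
    allowed-scale c≥0 ((w≥0 , s) ∷ as) =
      (*ᴿ-nonNeg c≥0 w≥0 , s) ∷ allowed-scale c≥0 as

    flatten : ∀ ts → All (λ (w , p) → 0ᴿ ≤ᴿ w × conv S p) ts →
      ∃ λ us → Allowed us ×
               totalWeight us ≈ᴿ totalWeight ts × weightedSum us ≋ weightedSum ts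
    flatten []             []               = [] , [] , R.refl , λ _ → R.refl
    flatten ((w , p) ∷ ts) ((w≥0 , c) ∷ as) =
      let us , bs , eqᵗ , eqˢ = flatten ts as
          cs = scaleTerms w (terms c)
      in cs ++ us
       , All.++⁺ (allowed-scale w≥0 (allowed c)) bs
       , R.trans (total-++ cs us) (R.+-cong
           (R.trans (total-scale w (terms c))
             (R.trans (R.*-congˡ (total c)) (R.*-identityʳ w)))
           eqᵗ)
       , λ i → R.trans (sum-++ cs us i) (R.+-cong
           (R.trans (sum-scale w (terms c) i) (R.*-congˡ (value c i)))
           (eqˢ i))

open Weighted-Lemmas

conv-isConvex : ∀ {S : Pred (ℝ^ n) 0ℓ} → conv (conv S) ⊆ conv S
conv-isConvex c =
  let us , as , eqᵗ , eqˢ = flatten (terms c) (allowed c)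
  in record
    { terms   = us
    ; allowed = as
    ; total   = R.trans eqᵗ (total c)
    ; value   = λ i → R.trans (eqˢ i) (value c i)
    }
  where open ConvexCombination

conv-extensive : ∀ {S : Pred (ℝ^ n) 0ℓ} → S ⊆ conv S
conv-extensive {x = x} s = record
  { terms   = (1ᴿ , x) ∷ []
  ; allowed = (0ᴿ≤1ᴿ , s) ∷ []
  ; total   = R.+-identityʳ 1ᴿ
  ; value   = λ i → R.trans (R.+-identityʳ _) (R.*-identityˡ (x i))
  }

conv-resp-≋ : ∀ {S : Pred (ℝ^ n) 0ℓ} {x y} → x ≋ y → conv S x → conv S y
conv-resp-≋ e c = record
  { terms   = terms c
  ; allowed = allowed c
  ; total   = total c
  ; value   = λ i → R.trans (value c i) (e i)
  }
  where open ConvexCombination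

latticePoint : Vec ℤ n → ℝ^ n
latticePoint k i = fromℚ (Vec.lookup k i ℚ./ 1)

record LatticePolytope (n : ℕ) : Set where
  constructor hull
  field
    generators : List (Vec ℤ n)

open LatticePolytope public

points : LatticePolytope n → Pred (ℝ^ n) 0ℓ
points M = conv λ x → ∃ λ k → k ∈ generators M × x ≋ latticePoint k

2Δ : ∀ n → Pred (ℝ^ n) 0ℓ
2Δ n = conv λ x → ∃ λ i → x ≋ A i
  where
  A : Fin n → ℝ^ n
  A i j = if does (i Fin.≟ j) then fromℚ (+ 2 ℚ./ 1) else 0ᴿ

barycentre : ∀ n .{{_ : NonZero n}} → ℝ^ n
barycentre n _ = fromℚ (+ 2 ℚ./ n)

Space : Set₁
Space = Module ℂ-commutativeRing 0ℓ 0ℓ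

module _ (V : Space) where
  open Module V

  ∑ᴹ : Vector Carrierᴹ n → Carrierᴹ
  ∑ᴹ = RawMonoidDefinitions.sum +ᴹ-rawMonoid

  FiniteDimensional : Set
  FiniteDimensional = ∃ λ d → Σ (Vector Carrierᴹ d) λ b →
    (∀ v → Σ (Vector ℂ d) λ c → v ≈ᴹ ∑ᴹ λ i → c i *ₗ b i) ×
    (∀ (c : Vector ℂ d) → ∑ᴹ (λ i → c i *ₗ b i) ≈ᴹ 0ᴹ → ∀ i → c i ≈ᶜ 0ᶜ)

  IsLinear : (Carrierᴹ → ℂ) → Set
  IsLinear = ModuleMorphism.ModuleMorphisms.IsModuleHomomorphism rawModule
    (TensorUnit.rawModule {R = CommutativeRing.rawRing ℂ-commutativeRing})

  -- Polynomial functions in coordinate-free form: the ℂ-algebra of functions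
  -- generated by the linear functionals, which in coordinates is the algebra of
  -- polynomials in the coordinate functions.
  data PolynomialFunction : Set where
    constant : ℂ → PolynomialFunction
    linear   : (f : Carrierᴹ → ℂ) → IsLinear f → PolynomialFunction
    _⊕_ _⊗_  : PolynomialFunction → PolynomialFunction → PolynomialFunction

  evaluate : PolynomialFunction → Carrierᴹ → ℂ
  evaluate (constant c) v = c
  evaluate (linear f _) v = f v
  evaluate (F ⊕ G)      v = evaluate F v +ᶜ evaluate G v
  evaluate (F ⊗ G)      v = evaluate F v *ᶜ evaluate G v

  IsAlgebraicSubset : Pred Carrierᴹ 0ℓ → Set
  IsAlgebraicSubset S = ∃ λ (Fs : List PolynomialFunction) →
    ∀ v → S v ⇔ All (λ F → evaluate F v ≈ᶜ 0ᶜ) Fs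

  -- The exceptional set ∁ P is algebraic, and it is proper: some vector has P.
  -- (Asking for ¬ ∁ P v instead would only give ¬ ¬ P v.)
  HoldsGenerically : Pred Carrierᴹ 0ℓ → Set
  HoldsGenerically P = IsAlgebraicSubset (∁ P) × Satisfiable P

module _ (V : Space) (P : Pred (Module.Carrierᴹ V) 0ℓ) where
  open Module V

  subspace : (∀ {u v} → P u → P v → P (u +ᴹ v)) →
             (∀ c {v} → P v → P (c *ₗ v)) →
             (∀ {v} → P v → P (-ᴹ v)) →
             P 0ᴹ →
             (∀ c {v} → P v → P (v *ᵣ c)) → Space
  subspace +-closed *ₗ-closed -‿closed 0-closed *ᵣ-closed = record
    { Carrierᴹ = Σ Carrierᴹ P
    ; _≈ᴹ_ = λ u v → proj₁ u ≈ᴹ proj₁ v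
    ; _+ᴹ_ = λ (u , p) (v , q) → u +ᴹ v , +-closed p q
    ; _*ₗ_ = λ c (v , p) → c *ₗ v , *ₗ-closed c p
    ; _*ᵣ_ = λ (v , p) c → v *ᵣ c , *ᵣ-closed c p
    ; 0ᴹ   = 0ᴹ , 0-closed
    ; -ᴹ_  = λ (v , p) → -ᴹ v , -‿closed p
    ; isModule = record
      { isBimodule = record
        { isBisemimodule = record
          { +ᴹ-isCommutativeMonoid = record
            { isMonoid = record
              { isSemigroup = record
                { isMagma = record
                  { isEquivalence = record
                    { refl = ≈ᴹ-refl ; sym = ≈ᴹ-sym ; trans = ≈ᴹ-trans }
                  ; ∙-cong = +ᴹ-cong
                  }
                ; assoc = λ u v w → +ᴹ-assoc (proj₁ u) (proj₁ v) (proj₁ w)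
                }
              ; identity = (λ v → +ᴹ-identityˡ (proj₁ v)) , (λ v → +ᴹ-identityʳ (proj₁ v))
              }
            ; comm = λ u v → +ᴹ-comm (proj₁ u) (proj₁ v)
            }
          ; isPreleftSemimodule = record
            { *ₗ-cong = *ₗ-cong
            ; *ₗ-zeroˡ = λ v → *ₗ-zeroˡ (proj₁ v)
            ; *ₗ-distribʳ = λ v c d → *ₗ-distribʳ (proj₁ v) c d
            ; *ₗ-identityˡ = λ v → *ₗ-identityˡ (proj₁ v)
            ; *ₗ-assoc = λ c d v → *ₗ-assoc c d (proj₁ v)
            ; *ₗ-zeroʳ = *ₗ-zeroʳ
            ; *ₗ-distribˡ = λ c u v → *ₗ-distribˡ c (proj₁ u) (proj₁ v)
            }
          ; isPrerightSemimodule = record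
            { *ᵣ-cong = *ᵣ-cong
            ; *ᵣ-zeroʳ = λ v → *ᵣ-zeroʳ (proj₁ v)
            ; *ᵣ-distribˡ = λ v c d → *ᵣ-distribˡ (proj₁ v) c d
            ; *ᵣ-identityʳ = λ v → *ᵣ-identityʳ (proj₁ v)
            ; *ᵣ-assoc = λ v c d → *ᵣ-assoc (proj₁ v) c d
            ; *ᵣ-zeroˡ = *ᵣ-zeroˡ
            ; *ᵣ-distribʳ = λ c u v → *ᵣ-distribʳ c (proj₁ u) (proj₁ v)
            }
          ; *ₗ-*ᵣ-assoc = λ c v d → *ₗ-*ᵣ-assoc c (proj₁ v) d
          }
        ; -ᴹ‿cong = -ᴹ‿cong
        ; -ᴹ‿inverse = (λ v → -ᴹ‿inverseˡ (proj₁ v)) , (λ v → -ᴹ‿inverseʳ (proj₁ v))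
        }
      ; *ₗ-*ᵣ-coincident = λ c v → *ₗ-*ᵣ-coincident c (proj₁ v)
      }
    }

record Polynomial (n : ℕ) : Set where
  no-eta-equality
  field
    coeff  : Vec ℕ n → ℂ
    bound  : ℕ
    finite : ∀ k → bound ℕ.< Vec.sum k → coeff k ≈ᶜ 0ᶜ

open Polynomial public

infix 4 _≈ᴾ_

record _≈ᴾ_ (p q : Polynomial n) : Set where
  constructor mk≈ᴾ
  field
    coeff≈ : ∀ k → coeff p k ≈ᶜ coeff q k

open _≈ᴾ_ public

private
  module C = CommutativeRing ℂ-commutativeRing
  module CP = RingProperties C.ring

infixl 6 _+ᴾ_
infixr 7 _·ᴾ_
infix  8 -ᴾ_

_+ᴾ_ : Polynomial n → Polynomial n → Polynomial n
coeff  (p +ᴾ q) k    = coeff p k +ᶜ coeff q k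
bound  (p +ᴾ q)      = bound p ℕ.⊔ bound q
finite (p +ᴾ q) k lt = C.trans
  (C.+-cong (finite p k (ℕ.≤-<-trans (ℕ.m≤m⊔n (bound p) (bound q)) lt))
            (finite q k (ℕ.≤-<-trans (ℕ.m≤n⊔m (bound p) (bound q)) lt)))
  (C.+-identityˡ 0ᶜ)

_·ᴾ_ : ℂ → Polynomial n → Polynomial n
coeff  (c ·ᴾ p) k    = c *ᶜ coeff p k
bound  (c ·ᴾ p)      = bound p
finite (c ·ᴾ p) k lt = C.trans (C.*-congˡ (finite p k lt)) (C.zeroʳ c)

-ᴾ_ : Polynomial n → Polynomial n
coeff  (-ᴾ p) k    = -ᶜ coeff p k
bound  (-ᴾ p)      = bound p
finite (-ᴾ p) k lt = C.trans (C.-‿cong (finite p k lt)) CP.-0#≈0#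

0ᴾ : Polynomial n
coeff  0ᴾ _   = 0ᶜ
bound  0ᴾ     = 0
finite 0ᴾ _ _ = C.refl

polynomials : ℕ → Space
polynomials n = record
  { Carrierᴹ = Polynomial n
  ; _≈ᴹ_ = _≈ᴾ_
  ; _+ᴹ_ = _+ᴾ_
  ; _*ₗ_ = _·ᴾ_
  ; _*ᵣ_ = λ p c → c ·ᴾ p
  ; 0ᴹ   = 0ᴾ
  ; -ᴹ_  = -ᴾ_
  ; isModule = record
    { isBimodule = record
      { isBisemimodule = record
        { +ᴹ-isCommutativeMonoid = record
          { isMonoid = record
            { isSemigroup = record
              { isMagma = record
                { isEquivalence = record
                  { refl  = mk≈ᴾ λ _ → C.refl
                  ; sym   = λ (mk≈ᴾ e) → mk≈ᴾ λ k → C.sym (e k)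
                  ; trans = λ (mk≈ᴾ d) (mk≈ᴾ e) → mk≈ᴾ λ k → C.trans (d k) (e k)
                  }
                ; ∙-cong = λ (mk≈ᴾ d) (mk≈ᴾ e) → mk≈ᴾ λ k → C.+-cong (d k) (e k)
                }
              ; assoc = λ p q r → mk≈ᴾ λ k → C.+-assoc (coeff p k) (coeff q k) (coeff r k)
              }
            ; identity = (λ p → mk≈ᴾ λ k → C.+-identityˡ (coeff p k))
                       , (λ p → mk≈ᴾ λ k → C.+-identityʳ (coeff p k))
            }
          ; comm = λ p q → mk≈ᴾ λ k → C.+-comm (coeff p k) (coeff q k)
          }
        ; isPreleftSemimodule = record
          { *ₗ-cong = λ c (mk≈ᴾ e) → mk≈ᴾ λ k → C.*-cong c (e k)
          ; *ₗ-zeroˡ = λ p → mk≈ᴾ λ k → C.zeroˡ (coeff p k)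
          ; *ₗ-distribʳ = λ p c d → mk≈ᴾ λ k → C.distribʳ (coeff p k) c d
          ; *ₗ-identityˡ = λ p → mk≈ᴾ λ k → C.*-identityˡ (coeff p k)
          ; *ₗ-assoc = λ c d p → mk≈ᴾ λ k → C.*-assoc c d (coeff p k)
          ; *ₗ-zeroʳ = λ c → mk≈ᴾ λ k → C.zeroʳ c
          ; *ₗ-distribˡ = λ c p q → mk≈ᴾ λ k → C.distribˡ c (coeff p k) (coeff q k)
          }
        ; isPrerightSemimodule = record
          { *ᵣ-cong = λ (mk≈ᴾ e) c → mk≈ᴾ λ k → C.*-cong c (e k)
          ; *ᵣ-zeroʳ = λ p → mk≈ᴾ λ k → C.zeroˡ (coeff p k)
          ; *ᵣ-distribˡ = λ p c d → mk≈ᴾ λ k → C.distribʳ (coeff p k) c d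
          ; *ᵣ-identityʳ = λ p → mk≈ᴾ λ k → C.*-identityˡ (coeff p k)
          ; *ᵣ-assoc = λ p c d → mk≈ᴾ λ k →
              C.trans (C.sym (C.*-assoc d c (coeff p k))) (C.*-congʳ (C.*-comm d c))
          ; *ᵣ-zeroˡ = λ c → mk≈ᴾ λ k → C.zeroʳ c
          ; *ᵣ-distribʳ = λ c p q → mk≈ᴾ λ k → C.distribˡ c (coeff p k) (coeff q k)
          }
        ; *ₗ-*ᵣ-assoc = λ c p d → mk≈ᴾ λ k →
            C.trans (C.sym (C.*-assoc d c (coeff p k)))
              (C.trans (C.*-congʳ (C.*-comm d c)) (C.*-assoc c d (coeff p k)))
        }
      ; -ᴹ‿cong = λ (mk≈ᴾ e) → mk≈ᴾ λ k → C.-‿cong (e k)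
      ; -ᴹ‿inverse = (λ p → mk≈ᴾ λ k → C.-‿inverseˡ (coeff p k))
                   , (λ p → mk≈ᴾ λ k → C.-‿inverseʳ (coeff p k))
      }
    ; *ₗ-*ᵣ-coincident = λ c p → mk≈ᴾ λ k → C.refl
    }
  }

monomial : Vec ℕ n → Polynomial n
coeff  (monomial k) l = if does (Vec.≡-dec ℕ._≟_ k l) then 1ᶜ else 0ᶜ
bound  (monomial k)   = Vec.sum k
finite (monomial k) l lt with Vec.≡-dec ℕ._≟_ k l
... | yes refl = contradiction lt (ℕ.<-irrefl refl)
... | no  _    = C.refl

NewtonPolytope : Polynomial n → Pred (ℝ^ n) 0ℓ
NewtonPolytope p = conv λ x →
  ∃ λ k → coeff p k #ᶜ 0ᶜ × x ≋ latticePoint (Vec.map +_ k)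

private
  module _ (M : LatticePolytope n) where
    open ConvexCombination

    Within : Pred (Polynomial n) 0ℓ
    Within p = NewtonPolytope p ⊆ points M

    exponents⊆ : ∀ p → Within p → ∀ k → coeff p k #ᶜ 0ᶜ →
                 points M (latticePoint (Vec.map +_ k))
    exponents⊆ p p⊆M k k∈p = p⊆M (conv-extensive (k , k∈p , λ _ → R.refl))

    within : ∀ p → (∀ k → coeff p k #ᶜ 0ᶜ → points M (latticePoint (Vec.map +_ k))) →
             Within p
    within p h c = conv-isConvex record
      { terms   = terms c
      ; allowed = All.map
          (λ (w≥0 , k , k∈p , e) → w≥0 , conv-resp-≋ (λ i → R.sym (e i)) (h k k∈p))
          (allowed c)
      ; total   = total c
      ; value   = value c
      }

    within-+ : ∀ {p q} → Within p → Within q → Within (p +ᴾ q)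
    within-+ {p} {q} p⊆M q⊆M = within (p +ᴾ q) λ k k∈ →
      [ exponents⊆ p p⊆M k , exponents⊆ q q⊆M k ]′ (+ᶜ-#0 (coeff p k) (coeff q k) k∈)

    within-· : ∀ c {p} → Within p → Within (c ·ᴾ p)
    within-· c {p} p⊆M = within (c ·ᴾ p) λ k k∈ →
      exponents⊆ p p⊆M k (*ᶜ-#0 c (coeff p k) k∈)

    within-neg : ∀ {p} → Within p → Within (-ᴾ p)
    within-neg {p} p⊆M = within (-ᴾ p) λ k k∈ →
      exponents⊆ p p⊆M k (-ᶜ-#0 (coeff p k) k∈)

    within-0 : Within 0ᴾ
    within-0 = within 0ᴾ λ k k∈ → contradiction k∈ 0ᶜ-#0

ℂ^ : LatticePolytope n → Space
ℂ^ {n} M = subspace (polynomials n) (λ p → NewtonPolytope p ⊆ points M)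
  (λ {p} {q} → within-+ M {p} {q})
  (λ c {p} → within-· M c {p})
  (λ {p} → within-neg M {p})
  (within-0 M)
  (λ c {p} → within-· M c {p})

Matrix : ℕ → Set
Matrix n = Fin n → Fin n → ℂ

∑ᶜ : Vector ℂ n → ℂ
∑ᶜ = RawMonoidDefinitions.sum C.+-rawMonoid

-- Laplace expansion along the first row.
det : Matrix n → ℂ
det {zero}  A = 1ᶜ
det {suc n} A = ∑ᶜ λ j →
  ((-ᶜ 1ᶜ) ^ᶜ toℕ j) *ᶜ A zero j *ᶜ det (λ r c → A (suc r) (punchIn j c))
  where open RawSemiringDefinitions (Semiring.rawSemiring C.semiring)
         renaming (_^_ to _^ᶜ_)

-- The exponent vector of zᵢ zⱼ.
exponent : Fin n → Fin n → Vec ℕ n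
exponent {n} i j = Vec.zipWith ℕ._+_ (e i) (e j)
  where
  e : Fin n → Vec ℕ n
  e i = Vec.replicate n 0 Vec.[ i ]≔ 1

quadraticForm : Matrix n → Polynomial n
quadraticForm {n} A =
  ∑ᴹ (polynomials n) λ i → ∑ᴹ (polynomials n) λ j → A i j ·ᴾ monomial (exponent i j)

-- The matrix of a form is unique, so ∃ and ∀ over B agree; the degenerate forms
-- are the complement of this set.
Nondegenerate : Pred (Polynomial n) 0ℓ
Nondegenerate {n} p = Σ (Matrix n) λ B →
  (∀ i j → B i j ≈ᶜ B j i) × p ≈ᴾ quadraticForm B × det B #ᶜ 0ᶜ

{-# OPTIONS --safe #-}

-- The exponents of the generators of M are the edges (and loops) i–j of a graph
-- on the variables. A set of rows with too few neighbouring columns would give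
-- a linear functional separating the barycentre from M, so by Hall's theorem
-- there is a permutation σ along edges. Following the cycles of σ and perturbing
-- one entry (and its mirror image) at a time, one finds a symmetric matrix with
-- nonzero determinant supported on the graph: whenever the relevant minor is
-- nonzero, the determinant is a nonconstant polynomial of degree at most two in
-- the perturbation. The degenerate forms are the zero set of the determinant of
-- the matrix of coefficients. Everything is constructive, including the basis of
-- monomials of ℂ^M, because membership in M is decidable for exponents of degree
-- two: zᵢ zⱼ lies in M only if it is an edge or the midpoint of two loops.

module Submission where

open import Defs
open import Algebra.Bundles using (CommutativeRing; Semiring)
import Algebra.Definitions.RawSemiring as RawSemiringDefinitions
open import Algebra.Module.Bundles using (Module)
import Algebra.Properties.Ring as RingProperties
import Algebra.Properties.Semiring.Sum as SemiringSum
import Algebra.Solver.Ring.NaturalCoefficients.Default as NaturalCoefficients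
open import Data.Bool.Base using (Bool; true; false; _∧_; _∨_; not; if_then_else_)
open import Data.Bool.Properties using (∧-zeroʳ; ∨-zeroʳ)
open import Data.Fin.Base using (Fin; zero; suc; toℕ; punchIn; punchOut)
import Data.Fin.Properties as Fin
open import Data.Integer.Base as ℤ using (ℤ; +_; -[1+_])
import Data.Integer.Properties as ℤ
open import Data.List.Base as List using (List; []; _∷_; allFin; cartesianProduct; deduplicate; filter; length)
import Data.List.Membership.DecPropositional as DecMembership
open import Data.List.Membership.Propositional using () renaming (_∈_ to _∈ₗ_)
open import Data.List.Membership.Propositional.Properties
  using (∈-allFin; ∈-cartesianProduct⁺; ∈-deduplicate⁺; ∈-deduplicate⁻; ∈-filter⁺; ∈-filter⁻; ∈-lookup; ∈-map⁺; ∈-map⁻)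
open import Data.List.Relation.Unary.All as All using (All; []; _∷_)
open import Data.List.Relation.Unary.Any as Any using (here; there)
open import Data.List.Relation.Unary.Any.Properties using (lookup-index)
import Data.List.Relation.Unary.Unique.DecPropositional.Properties as UniqueDec
open import Data.List.Relation.Unary.Unique.Propositional using (Unique; _∷_)
open import Data.Nat.Base as ℕ using (ℕ; zero; suc; NonZero)
import Data.Nat.Coprimality as Coprimality
import Data.Nat.Properties as ℕ
open import Data.Product.Base using (∃; ∃₂; _×_; _,_; proj₁; proj₂; uncurry)
open import Data.Rational.Base as ℚ using (ℚ; 0ℚ; 1ℚ; ½; ∣_∣; mkℚ)
import Data.Rational.Properties as ℚ
open import Data.Sum.Base as Sum using (_⊎_; inj₁; inj₂; [_,_]′)
open import Data.Vec.Base as Vec using (Vec; []; _∷_)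
import Data.Vec.Properties as Vec
open import Data.Vec.Functional using (removeAt; updateAt) renaming (_∷_ to _∷ᵛ_)
open import Data.Vec.Functional.Properties using (updateAt-id-local; updateAt-minimal; updateAt-updates)
open import Function.Base using (_∘_; const; id)
open import Function.Bundles using (mk⇔)
open import Function.Definitions using (Injective)
open import Level using (0ℓ)
open import Relation.Binary.PropositionalEquality as ≡
  using (_≡_; _≢_; refl; sym; trans; cong; cong₂; subst; subst₂)
import Relation.Binary.Reasoning.Setoid as SetoidReasoning
open import Relation.Nullary using (¬_; Dec; yes; no; does; contradiction)
open import Relation.Nullary.Decidable
  using (_×-dec_; _⊎-dec_; ¬?; dec-true; decidable-stable; toWitness; toWitnessFalse)
open import Relation.Unary using (Pred; _∈_; _⊆_; ∁)
import Tactic.RingSolver as RingSolver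

-- The term of σ in the determinant of a symmetric matrix can cancel against other terms: the
-- adjacency matrix of a 4-cycle is singular. So no witness is written down; the entries are chosen
-- one edge at a time. The mirror entry mostly does no harm. Once a cycle of σ has been cut, the
-- first row index of the remaining minor is not among its column indices, so the mirror entry lies
-- outside and the determinant is affine in the perturbation. Only the first edge of a cycle of
-- length at least two occurs twice in its minor. There both entries have the same cofactor by
-- symmetry, and the linear coefficient is nonzero because 2 is invertible in ℂ.
--
-- The functional that refutes a Hall violator with rows S and columns T is 1_T - 1_S. It is
-- nonnegative at every edge because the graph is undirected, and its value at the barycentre is
-- (2/n)(|T| - |S|) < 0.
--
-- Nonzero always means apart from zero. A suitable perturbation is found without deciding equality:
-- a combination of two values of the determinant is apart from zero, hence so is one of them.

module R = CommutativeRing ℝ-commutativeRing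
module C = CommutativeRing ℂ-commutativeRing
module CP = RingProperties C.ring
module RS = SemiringSum R.semiring
module CS = SemiringSum C.semiring
module ℕS = SemiringSum ℕ.+-*-semiring
module ℚS = SemiringSum (CommutativeRing.semiring ℚ.+-*-commutativeRing)
open ℚ-Lemmas using (ℚ-ring; half; _∧ᴱ_)
open ℝ-Lemmas using (≗⇒≈ᴿ; <⇒≱; small⇒; stays-apart; sub-0)
open NaturalCoefficients C.commutativeSemiring using (solve; _:=_; _:+_; _:*_)

variable
  m n : ℕ

-- Apartness from zero: invariance, tightness, halving

≈0⇒¬#0ᴿ : ∀ {x} → x ≈ᴿ 0ᴿ → ¬ x #ᴿ 0ᴿ
≈0⇒¬#0ᴿ x≈0 (mk# gap gap>0 apart) =
  let N , p = close x≈0 gap gap>0 ∧ᴱ apart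
  in <⇒≱ (proj₁ (p N ℕ.≤-refl)) (proj₂ (p N ℕ.≤-refl))

-- Write x as y + (x - y). By `+ᴿ-#0` one summand is apart from zero, and it cannot be the second,
-- which is null.
#ᴿ0-resp-≈ : ∀ {x y} → x ≈ᴿ y → x #ᴿ 0ᴿ → y #ᴿ 0ᴿ
#ᴿ0-resp-≈ {x} {y} x≈y (mk# gap gap>0 (N , far)) =
  [ (λ p → p) , (λ p → contradiction p (≈0⇒¬#0ᴿ x-y≈0)) ]′
    (+ᴿ-#0 y (x +ᴿ -ᴿ y) (mk# gap gap>0 (N , λ n le →
      subst (λ t → gap ℚ.≤ ∣ t ℚ.- 0ℚ ∣) (split (seq x n) (seq y n)) (far n le))))
  where
  split : ∀ a b → a ≡ b ℚ.+ (a ℚ.+ ℚ.- b)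
  split = RingSolver.solve-∀ ℚ-ring

  x-y≈0 : x +ᴿ -ᴿ y ≈ᴿ 0ᴿ
  x-y≈0 = R.trans (R.+-congʳ x≈y) (R.-‿inverseʳ y)

-- A single late index with |x n| ≥ ε would already give apartness, since the tail varies by less
-- than ε/4. The order of ℚ is decidable, so the absence of such an index is the strict bound.
tightᴿ : ∀ x → ¬ x #ᴿ 0ᴿ → x ≈ᴿ 0ᴿ
tightᴿ x ¬x#0 = mk≈ λ ε ε>0 →
  let δ , δ>0 , eδ = half ε ε>0
      γ , γ>0 , eγ = half δ δ>0
      N , c = isCauchy x γ γ>0
  in N , λ n le → ℚ.≰⇒> λ far → ¬x#0 (stays-apart x n γ γ>0 eγ
       (λ k l n≤k n≤l → c k l (ℕ.≤-trans le n≤k) (ℕ.≤-trans le n≤l))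
       (ℚ.≤-trans (δ≤ε δ>0 eδ) (subst (λ t → ε ℚ.≤ ∣ t ∣) (sub-0 (seq x n)) far)))
  where
  δ≤ε : ∀ {δ ε} → 0ℚ ℚ.< δ → δ ℚ.+ δ ≡ ε → δ ℚ.≤ ε
  δ≤ε {δ} δ>0 refl =
    subst (ℚ._≤ δ ℚ.+ δ) (ℚ.+-identityʳ δ) (ℚ.+-monoʳ-≤ δ (ℚ.<⇒≤ δ>0))

#ᶜ0-resp-≈ : ∀ {x y} → x ≈ᶜ y → x #ᶜ 0ᶜ → y #ᶜ 0ᶜ
#ᶜ0-resp-≈ x≈y = Sum.map (#ᴿ0-resp-≈ (re≈ x≈y)) (#ᴿ0-resp-≈ (im≈ x≈y))

≈0⇒¬#0 : ∀ {x} → x ≈ᶜ 0ᶜ → ¬ x #ᶜ 0ᶜ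
≈0⇒¬#0 x≈0 p = 0ᶜ-#0 (#ᶜ0-resp-≈ x≈0 p)

tightᶜ : ∀ x → ¬ x #ᶜ 0ᶜ → x ≈ᶜ 0ᶜ
tightᶜ x ¬x#0 = mk≈ᶜ (tightᴿ (re x) (¬x#0 ∘ inj₁)) (tightᴿ (im x) (¬x#0 ∘ inj₂))

1#0 : 1ᶜ #ᶜ 0ᶜ
1#0 = inj₁ (mk# 1ℚ (ℚ.positive⁻¹ 1ℚ) (0 , λ _ _ → ℚ.≤-refl))

½ᶜ : ℂ
re ½ᶜ = fromℚ ½
im ½ᶜ = 0ᴿ

private
  double-re : ∀ a b → a ≡ (½ ℚ.* (a ℚ.+ a)) ℚ.+ ℚ.- (0ℚ ℚ.* (b ℚ.+ b))
  double-re a b = trans (sym (ℚ.*-identityˡ a)) (trans (ℚ.*-distribʳ-+ a ½ ½)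
    (trans (sym (ℚ.*-distribˡ-+ ½ a a)) (drop (½ ℚ.* (a ℚ.+ a)) b)))
    where
    drop : ∀ c b → c ≡ c ℚ.+ ℚ.- (0ℚ ℚ.* (b ℚ.+ b))
    drop = RingSolver.solve-∀ ℚ-ring

  double-im : ∀ a b → b ≡ (½ ℚ.* (b ℚ.+ b)) ℚ.+ (0ℚ ℚ.* (a ℚ.+ a))
  double-im a b = trans (sym (ℚ.*-identityˡ b)) (trans (ℚ.*-distribʳ-+ b ½ ½)
    (trans (sym (ℚ.*-distribˡ-+ ½ b b)) (drop (½ ℚ.* (b ℚ.+ b)) a)))
    where
    drop : ∀ c b → c ≡ c ℚ.+ (0ℚ ℚ.* (b ℚ.+ b))
    drop = RingSolver.solve-∀ ℚ-ring

½*double : ∀ x → ½ᶜ *ᶜ (x +ᶜ x) ≈ᶜ x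
½*double x = C.sym (mk≈ᶜ
  (≗⇒≈ᴿ λ n → double-re (seq (re x) n) (seq (im x) n))
  (≗⇒≈ᴿ λ n → double-im (seq (re x) n) (seq (im x) n)))

-- The product ½ · 2x is x, and a product apart from zero has its right factor apart from zero. This
-- is how the invertibility of 2 enters the choice of a perturbation.
double-#0 : ∀ x → x #ᶜ 0ᶜ → x +ᶜ x #ᶜ 0ᶜ
double-#0 x p = *ᶜ-#0 ½ᶜ (x +ᶜ x) (#ᶜ0-resp-≈ (C.sym (½*double x)) p)

-- Determinants: expansions, moving rows, perturbing entries

infixr 8 _^ᶜ_
_^ᶜ_ : ℂ → ℕ → ℂ
_^ᶜ_ = RawSemiringDefinitions._^_ (Semiring.rawSemiring C.semiring)

sgn : Fin n → ℂ
sgn i = (-ᶜ 1ᶜ) ^ᶜ toℕ i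

neg*neg : ∀ x → -ᶜ 1ᶜ *ᶜ (-ᶜ 1ᶜ *ᶜ x) ≈ᶜ x
neg*neg x = C.trans (CP.-1*x≈-x _) (C.trans (C.-‿cong (CP.-1*x≈-x x)) (CP.-‿involutive x))

power*power : ∀ k x → (-ᶜ 1ᶜ) ^ᶜ k *ᶜ ((-ᶜ 1ᶜ) ^ᶜ k *ᶜ x) ≈ᶜ x
power*power zero    x = C.trans (C.*-identityˡ _) (C.*-identityˡ x)
power*power (suc k) x = C.trans (shuffle (-ᶜ 1ᶜ) ((-ᶜ 1ᶜ) ^ᶜ k) x)
  (C.trans (neg*neg _) (power*power k x))
  where
  shuffle : ∀ e s x → e *ᶜ s *ᶜ (e *ᶜ s *ᶜ x) ≈ᶜ e *ᶜ (e *ᶜ (s *ᶜ (s *ᶜ x)))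
  shuffle = solve 3 (λ e s x → e :* s :* (e :* s :* x) := e :* (e :* (s :* (s :* x)))) C.refl

sgn*sgn : ∀ (i : Fin n) x → sgn i *ᶜ (sgn i *ᶜ x) ≈ᶜ x
sgn*sgn i = power*power (toℕ i)

sgn-#0 : ∀ (i : Fin n) x → x #ᶜ 0ᶜ → sgn i *ᶜ x #ᶜ 0ᶜ
sgn-#0 i x p = *ᶜ-#0 (sgn i) (sgn i *ᶜ x) (#ᶜ0-resp-≈ (C.sym (sgn*sgn i x)) p)

det-cong : ∀ {A B : Matrix n} → (∀ i j → A i j ≈ᶜ B i j) → det A ≈ᶜ det B
det-cong {zero}  A≈B = C.refl
det-cong {suc n} A≈B = CS.sum-cong-≋ λ j →
  C.*-cong (C.*-congˡ {sgn j} (A≈B zero j)) (det-cong λ r c → A≈B (suc r) (punchIn j c))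

-- Column zero survives in every minor of the row expansion except the first, so each of these is
-- expanded along it by induction. Exchanging the two sums regroups the double minors by rows.
det-firstColumn : (A : Matrix (suc n)) → det A ≈ᶜ ∑ᶜ λ i →
  sgn i *ᶜ A i zero *ᶜ det (λ r c → A (punchIn i r) (suc c))
det-firstColumn {zero}  A = C.refl
det-firstColumn {suc n} A = C.+-congˡ (begin
  ∑ᶜ (λ j → sgn (suc j) *ᶜ A zero (suc j) *ᶜ det (λ r c → A (suc r) (punchIn (suc j) c)))
    ≈⟨ CS.sum-cong-≋ (λ j → C.*-congˡ {sgn (suc j) *ᶜ A zero (suc j)}
         (det-firstColumn (λ r c → A (suc r) (punchIn (suc j) c)))) ⟩
  ∑ᶜ (λ j → sgn (suc j) *ᶜ A zero (suc j) *ᶜ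
    ∑ᶜ λ i → sgn i *ᶜ A (suc i) zero *ᶜ D i j)
    ≈⟨ CS.sum-cong-≋ (λ j → CS.*-distribˡ-sum (sgn (suc j) *ᶜ A zero (suc j))
         (λ i → sgn i *ᶜ A (suc i) zero *ᶜ D i j)) ⟩
  ∑ᶜ (λ j → ∑ᶜ λ i → sgn (suc j) *ᶜ A zero (suc j) *ᶜ (sgn i *ᶜ A (suc i) zero *ᶜ D i j))
    ≈⟨ CS.∑-comm (λ j i → sgn (suc j) *ᶜ A zero (suc j) *ᶜ (sgn i *ᶜ A (suc i) zero *ᶜ D i j)) ⟩
  ∑ᶜ (λ i → ∑ᶜ λ j → sgn (suc j) *ᶜ A zero (suc j) *ᶜ (sgn i *ᶜ A (suc i) zero *ᶜ D i j))
    ≈⟨ CS.sum-cong-≋ (λ i → CS.sum-cong-≋ λ j →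
         shuffle (-ᶜ 1ᶜ) (sgn j) (A zero (suc j)) (sgn i) (A (suc i) zero) (D i j)) ⟩
  ∑ᶜ (λ i → ∑ᶜ λ j → sgn (suc i) *ᶜ A (suc i) zero *ᶜ (sgn j *ᶜ A zero (suc j) *ᶜ D i j))
    ≈⟨ CS.sum-cong-≋ (λ i → C.sym (CS.*-distribˡ-sum (sgn (suc i) *ᶜ A (suc i) zero)
         (λ j → sgn j *ᶜ A zero (suc j) *ᶜ D i j))) ⟩
  ∑ᶜ (λ i → sgn (suc i) *ᶜ A (suc i) zero *ᶜ det (λ r c → A (punchIn (suc i) r) (suc c))) ∎)
  where
  open SetoidReasoning C.setoid

  D : Fin (suc n) → Fin (suc n) → ℂ
  D i j = det λ r c → A (suc (punchIn i r)) (suc (punchIn j c))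

  shuffle : ∀ e s a t b d → e *ᶜ s *ᶜ a *ᶜ (t *ᶜ b *ᶜ d) ≈ᶜ e *ᶜ t *ᶜ b *ᶜ (s *ᶜ a *ᶜ d)
  shuffle = solve 6 (λ e s a t b d → e :* s :* a :* (t :* b :* d) :=
    e :* t :* b :* (s :* a :* d)) C.refl

det-transpose : (A : Matrix n) → det (λ i j → A j i) ≈ᶜ det A
det-transpose {zero}  A = C.refl
det-transpose {suc n} A = C.trans
  (CS.sum-cong-≋ λ j → C.*-congˡ {sgn j *ᶜ A j zero}
    (det-transpose λ r c → A (punchIn j r) (suc c)))
  (C.sym (det-firstColumn A))

swap₀₁ : Fin (suc (suc n)) → Fin (suc (suc n))
swap₀₁ zero          = suc zero
swap₀₁ (suc zero)    = zero
swap₀₁ (suc (suc i)) = suc (suc i)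

-- Expanded along column zero, the terms of rows 0 and 1 trade places, which costs a sign. Every
-- later minor still contains both rows and changes sign by induction.
det-swap₀₁ : (A : Matrix (suc (suc n))) → det (A ∘ swap₀₁) ≈ᶜ -ᶜ 1ᶜ *ᶜ det A
det-swap₀₁ {n} A = begin
  det (A ∘ swap₀₁)
    ≈⟨ det-firstColumn (A ∘ swap₀₁) ⟩
  1ᶜ *ᶜ A (suc zero) zero *ᶜ det (λ r c → A (swap₀₁ (suc r)) (suc c)) +ᶜ
    (-ᶜ 1ᶜ *ᶜ 1ᶜ *ᶜ A zero zero *ᶜ det (λ r c → A (swap₀₁ (punchIn (suc zero) r)) (suc c)) +ᶜ
     ∑ᶜ λ i → -ᶜ 1ᶜ *ᶜ (-ᶜ 1ᶜ *ᶜ sgn i) *ᶜ A (suc (suc i)) zero *ᶜ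
       det (λ r c → A (swap₀₁ (punchIn (suc (suc i)) r)) (suc c)))
    ≈⟨ C.+-cong (C.*-congˡ {1ᶜ *ᶜ A (suc zero) zero} (det-cong minor₀))
         (C.+-cong (C.*-congˡ { -ᶜ 1ᶜ *ᶜ 1ᶜ *ᶜ A zero zero} (det-cong minor₁))
           (rest A)) ⟩
  1ᶜ *ᶜ a₁ *ᶜ d₁ +ᶜ (-ᶜ 1ᶜ *ᶜ 1ᶜ *ᶜ a₀ *ᶜ d₀ +ᶜ -ᶜ 1ᶜ *ᶜ s)
    ≈⟨ C.+-congʳ { -ᶜ 1ᶜ *ᶜ 1ᶜ *ᶜ a₀ *ᶜ d₀ +ᶜ -ᶜ 1ᶜ *ᶜ s}
         (C.sym (neg*neg (1ᶜ *ᶜ a₁ *ᶜ d₁))) ⟩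
  -ᶜ 1ᶜ *ᶜ (-ᶜ 1ᶜ *ᶜ (1ᶜ *ᶜ a₁ *ᶜ d₁)) +ᶜ (-ᶜ 1ᶜ *ᶜ 1ᶜ *ᶜ a₀ *ᶜ d₀ +ᶜ -ᶜ 1ᶜ *ᶜ s)
    ≈⟨ shuffle (-ᶜ 1ᶜ) 1ᶜ a₀ a₁ d₀ d₁ s ⟩
  -ᶜ 1ᶜ *ᶜ (1ᶜ *ᶜ a₀ *ᶜ d₀ +ᶜ (-ᶜ 1ᶜ *ᶜ 1ᶜ *ᶜ a₁ *ᶜ d₁ +ᶜ s))
    ≈⟨ C.*-congˡ (det-firstColumn A) ⟨
  -ᶜ 1ᶜ *ᶜ det A ∎
  where
  open SetoidReasoning C.setoid

  a₀ a₁ d₀ d₁ s : ℂ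
  a₀ = A zero zero
  a₁ = A (suc zero) zero
  d₀ = det λ r c → A (suc r) (suc c)
  d₁ = det λ r c → A (punchIn (suc zero) r) (suc c)
  s  = ∑ᶜ λ i → sgn (suc (suc i)) *ᶜ A (suc (suc i)) zero *ᶜ
    det (λ r c → A (punchIn (suc (suc i)) r) (suc c))

  minor₀ : ∀ r c → A (swap₀₁ (suc r)) (suc c) ≈ᶜ A (punchIn (suc zero) r) (suc c)
  minor₀ zero    c = C.refl
  minor₀ (suc r) c = C.refl

  minor₁ : ∀ r c → A (swap₀₁ (punchIn (suc zero) r)) (suc c) ≈ᶜ A (suc r) (suc c)
  minor₁ zero    c = C.refl
  minor₁ (suc r) c = C.refl

  shuffle : ∀ e o a b c d s →
    e *ᶜ (e *ᶜ (o *ᶜ b *ᶜ d)) +ᶜ (e *ᶜ o *ᶜ a *ᶜ c +ᶜ e *ᶜ s) ≈ᶜ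
    e *ᶜ (o *ᶜ a *ᶜ c +ᶜ (e *ᶜ o *ᶜ b *ᶜ d +ᶜ s))
  shuffle = solve 7 (λ e o a b c d s → e :* (e :* (o :* b :* d)) :+ (e :* o :* a :* c :+ e :* s) :=
    e :* (o :* a :* c :+ (e :* o :* b :* d :+ s))) C.refl

  rest : ∀ {n} (A : Matrix (suc (suc n))) →
    (∑ᶜ λ i → sgn (suc (suc i)) *ᶜ A (suc (suc i)) zero *ᶜ
      det (λ r c → A (swap₀₁ (punchIn (suc (suc i)) r)) (suc c))) ≈ᶜ
    -ᶜ 1ᶜ *ᶜ ∑ᶜ λ i → sgn (suc (suc i)) *ᶜ A (suc (suc i)) zero *ᶜ
      det (λ r c → A (punchIn (suc (suc i)) r) (suc c))
  rest {zero}  A = C.sym (C.zeroʳ (-ᶜ 1ᶜ))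
  rest {suc n} A = C.trans
    (CS.sum-cong-≋ λ i → C.trans
      (C.*-congˡ {sgn (suc (suc i)) *ᶜ A (suc (suc i)) zero} (C.trans
        (det-cong (commute i)) (det-swap₀₁ λ r c → A (punchIn (suc (suc i)) r) (suc c))))
      (shuffle′ (sgn (suc (suc i)) *ᶜ A (suc (suc i)) zero) (-ᶜ 1ᶜ) _))
    (C.sym (CS.*-distribˡ-sum (-ᶜ 1ᶜ) (λ i → sgn (suc (suc i)) *ᶜ A (suc (suc i)) zero *ᶜ
      det (λ r c → A (punchIn (suc (suc i)) r) (suc c)))))
    where
    commute : ∀ i r c → A (swap₀₁ (punchIn (suc (suc i)) r)) (suc c) ≈ᶜ
                        A (punchIn (suc (suc i)) (swap₀₁ r)) (suc c)
    commute i zero          c = C.refl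
    commute i (suc zero)    c = C.refl
    commute i (suc (suc r)) c = C.refl

    shuffle′ : ∀ x e d → x *ᶜ (e *ᶜ d) ≈ᶜ e *ᶜ (x *ᶜ d)
    shuffle′ = solve 3 (λ x e d → x :* (e :* d) := e :* (x :* d)) C.refl

moveToFront : Fin (suc n) → Fin (suc n) → Fin (suc n)
moveToFront i zero    = i
moveToFront i (suc k) = punchIn i k

-- One transposition per step: `lift` brings the row to position one, which affects only the minors
-- of the expansion along row zero, and `swap₀₁` then brings it to the front.
det-moveToFront : ∀ i (A : Matrix (suc n)) → det (A ∘ moveToFront i) ≈ᶜ sgn i *ᶜ det A
det-moveToFront zero A = C.trans
  (det-cong {A = A ∘ moveToFront zero} {B = A} λ { zero _ → C.refl ; (suc _) _ → C.refl }) (C.sym (C.*-identityˡ _))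
det-moveToFront {suc n} (suc i) A = begin
  det (A ∘ moveToFront (suc i))
    ≈⟨ det-cong {A = A ∘ moveToFront (suc i)} {B = A ∘ lift ∘ swap₀₁}
         (λ { zero _ → C.refl ; (suc zero) _ → C.refl ; (suc (suc _)) _ → C.refl }) ⟩
  det (A ∘ lift ∘ swap₀₁)
    ≈⟨ det-swap₀₁ (A ∘ lift) ⟩
  -ᶜ 1ᶜ *ᶜ det (A ∘ lift)
    ≈⟨ C.*-congˡ (begin
      det (A ∘ lift)
        ≈⟨ CS.sum-cong-≋ (λ j → C.trans
             (C.*-congˡ {sgn j *ᶜ A zero j} (det-moveToFront i (minor j)))
             (shuffle (sgn j *ᶜ A zero j) (sgn i) (det (minor j)))) ⟩
      ∑ᶜ (λ j → sgn i *ᶜ (sgn j *ᶜ A zero j *ᶜ det (minor j)))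
        ≈⟨ CS.*-distribˡ-sum (sgn i) (λ j → sgn j *ᶜ A zero j *ᶜ det (minor j)) ⟨
      sgn i *ᶜ det A ∎) ⟩
  -ᶜ 1ᶜ *ᶜ (sgn i *ᶜ det A)
    ≈⟨ C.*-assoc _ _ _ ⟨
  sgn (suc i) *ᶜ det A ∎
  where
  open SetoidReasoning C.setoid

  lift : Fin (suc (suc n)) → Fin (suc (suc n))
  lift zero    = zero
  lift (suc k) = suc (moveToFront i k)

  minor : Fin (suc (suc n)) → Matrix (suc n)
  minor j r c = A (suc r) (punchIn j c)

  shuffle : ∀ x s d → x *ᶜ (s *ᶜ d) ≈ᶜ s *ᶜ (x *ᶜ d)
  shuffle = solve 3 (λ x s d → x :* (s :* d) := s :* (x :* d)) C.refl

minor₀ : Fin (suc n) → Matrix (suc n) → Matrix n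
minor₀ j A r c = A (suc r) (punchIn j c)

cofactor₀ : Fin (suc n) → Matrix (suc n) → ℂ
cofactor₀ j A = sgn j *ᶜ det (minor₀ j A)

-- The entry (0 , j) occurs in one term of the Laplace expansion only, and the minors do not contain
-- row zero.
det-perturb : ∀ {A A′ : Matrix (suc n)} j t →
  (∀ i k → A′ (suc i) k ≈ᶜ A (suc i) k) →
  (∀ k → k ≢ j → A′ zero k ≈ᶜ A zero k) →
  A′ zero j ≈ᶜ A zero j +ᶜ t →
  det A′ ≈ᶜ det A +ᶜ t *ᶜ cofactor₀ j A
det-perturb {n} {A} {A′} j t below beside at = begin
  det A′
    ≈⟨ CS.sum-remove {i = j} (term A′) ⟩
  term A′ j +ᶜ ∑ᶜ (removeAt (term A′) j)
    ≈⟨ C.+-cong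
         (C.*-cong (C.*-congˡ {sgn j} at) (det-cong λ r c → below r (punchIn j c)))
         (CS.sum-cong-≋ λ k → C.*-cong
           (C.*-congˡ {sgn (punchIn j k)} (beside (punchIn j k) (Fin.punchInᵢ≢i j k)))
           (det-cong λ r c → below r (punchIn (punchIn j k) c))) ⟩
  sgn j *ᶜ (A zero j +ᶜ t) *ᶜ d +ᶜ ∑ᶜ (removeAt (term A) j)
    ≈⟨ shuffle (sgn j) (A zero j) t d _ ⟩
  (term A j +ᶜ ∑ᶜ (removeAt (term A) j)) +ᶜ t *ᶜ (sgn j *ᶜ d)
    ≈⟨ C.+-congʳ (CS.sum-remove {i = j} (term A)) ⟨
  det A +ᶜ t *ᶜ cofactor₀ j A ∎
  where
  open SetoidReasoning C.setoid

  term : Matrix (suc n) → Fin (suc n) → ℂ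
  term A k = sgn k *ᶜ A zero k *ᶜ det (minor₀ k A)

  d : ℂ
  d = det (minor₀ j A)

  shuffle : ∀ s a t d x → s *ᶜ (a +ᶜ t) *ᶜ d +ᶜ x ≈ᶜ (s *ᶜ a *ᶜ d +ᶜ x) +ᶜ t *ᶜ (s *ᶜ d)
  shuffle = solve 5 (λ s a t d x →
    s :* (a :+ t) :* d :+ x := (s :* a :* d :+ x) :+ t :* (s :* d)) C.refl

-- Perturbing both entries at (0 , i) and (i , 0) of a symmetric matrix changes
-- the determinant by a quadratic polynomial whose linear coefficient is twice
-- the cofactor; the quadratic one does not matter.
det-perturbSymmetric : ∀ (A : Matrix (suc (suc n))) (F : ℂ → Matrix (suc (suc n))) i →
  (∀ j k → A j k ≈ᶜ A k j) →
  (∀ t k → k ≢ suc i → F t zero k ≈ᶜ A zero k) →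
  (∀ t → F t zero (suc i) ≈ᶜ A zero (suc i) +ᶜ t) →
  (∀ t j k → ¬ (j ≡ i × k ≡ zero) → F t (suc j) k ≈ᶜ A (suc j) k) →
  (∀ t → F t (suc i) zero ≈ᶜ A (suc i) zero +ᶜ t) →
  ∃ λ e → ∀ t → det (F t) ≈ᶜ
    det A +ᶜ t *ᶜ cofactor₀ (suc i) A +ᶜ t *ᶜ (cofactor₀ (suc i) A +ᶜ t *ᶜ e)
det-perturbSymmetric {n} A F i A-sym beside at below at′ =
  sgn (suc i) *ᶜ (sgn i *ᶜ e) , λ t → begin
  det (F t)
    ≈⟨ det-perturb {A = G t} {A′ = F t} (suc i) t (λ _ _ → C.refl) (beside t) (at t) ⟩
  det (G t) +ᶜ t *ᶜ (sgn (suc i) *ᶜ det (minor₀ (suc i) (G t)))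
    ≈⟨ C.+-cong (det-G t) (C.*-congˡ (C.*-congˡ {sgn (suc i)} (det-minor t))) ⟩
  det A +ᶜ t *ᶜ (sgn (suc i) *ᶜ d) +ᶜ t *ᶜ (sgn (suc i) *ᶜ (d +ᶜ t *ᶜ (sgn i *ᶜ e)))
    ≈⟨ shuffle (det A) t (sgn (suc i)) d (sgn i *ᶜ e) ⟩
  det A +ᶜ t *ᶜ (sgn (suc i) *ᶜ d) +ᶜ
    t *ᶜ (sgn (suc i) *ᶜ d +ᶜ t *ᶜ (sgn (suc i) *ᶜ (sgn i *ᶜ e))) ∎
  where
  open SetoidReasoning C.setoid

  -- An intermediate matrix with the mirror entry perturbed and row zero untouched, so that the two
  -- changes can be made one after the other.
  G : ℂ → Matrix (suc (suc n))
  G t zero    k = A zero k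
  G t (suc j) k = F t (suc j) k

  d e : ℂ
  d = det (minor₀ (suc i) A)
  e = cofactor₀ zero (minor₀ (suc i) A ∘ moveToFront i)

  -- Transposition turns the mirror entry into one of row zero. As A is symmetric, its cofactor is
  -- again that of (0 , i + 1), which doubles the linear coefficient.
  det-G : ∀ t → det (G t) ≈ᶜ det A +ᶜ t *ᶜ (sgn (suc i) *ᶜ d)
  det-G t = C.trans (C.sym (det-transpose (G t)))
    (det-perturb {A = A} {A′ = λ j k → G t k j} (suc i) t column
      (λ { zero    _   → C.refl
         ; (suc k) k≢i → C.trans (below t k zero λ (k≡i , _) → k≢i (cong suc k≡i))
                                 (A-sym (suc k) zero) })
      (C.trans (at′ t) (C.+-congʳ (A-sym (suc i) zero))))
    where
    column : ∀ j k → G t k (suc j) ≈ᶜ A (suc j) k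
    column j zero    = A-sym zero (suc j)
    column j (suc k) = C.trans (below t k (suc j) λ ()) (A-sym (suc k) (suc j))

  -- The minor of the entry (0 , i + 1) still contains the mirror entry, at position (i , 0). Moving
  -- that row to the front makes `det-perturb` applicable; this is the source of the quadratic term.
  det-minor : ∀ t → det (minor₀ (suc i) (G t)) ≈ᶜ d +ᶜ t *ᶜ (sgn i *ᶜ e)
  det-minor t = begin
    det N                                       ≈⟨ sgn*sgn i (det N) ⟨
    sgn i *ᶜ (sgn i *ᶜ det N)                   ≈⟨ C.*-congˡ {sgn i} (begin
      sgn i *ᶜ det N                              ≈⟨ det-moveToFront i N ⟨
      det (N ∘ moveToFront i)
        ≈⟨ det-perturb {A = minor₀ (suc i) A ∘ moveToFront i} {A′ = N ∘ moveToFront i} zero t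
             (λ j k → below t (punchIn i j) (punchIn (suc i) k)
               λ (p , _) → Fin.punchInᵢ≢i i j p)
             (λ k k≢0 → below t i (punchIn (suc i) k)
               λ (_ , p) → k≢0 (Fin.punchIn-injective (suc i) k zero p))
             (at′ t) ⟩
      det (minor₀ (suc i) A ∘ moveToFront i) +ᶜ t *ᶜ e
        ≈⟨ C.+-congʳ (det-moveToFront i (minor₀ (suc i) A)) ⟩
      sgn i *ᶜ d +ᶜ t *ᶜ e                        ∎) ⟩
    sgn i *ᶜ (sgn i *ᶜ d +ᶜ t *ᶜ e)             ≈⟨ shuffle′ (sgn i) d t e ⟩
    sgn i *ᶜ (sgn i *ᶜ d) +ᶜ t *ᶜ (sgn i *ᶜ e)  ≈⟨ C.+-congʳ (sgn*sgn i d) ⟩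
    d +ᶜ t *ᶜ (sgn i *ᶜ e)                      ∎
    where
    N : Matrix (suc n)
    N = minor₀ (suc i) (G t)

    shuffle′ : ∀ s d t e → s *ᶜ (s *ᶜ d +ᶜ t *ᶜ e) ≈ᶜ s *ᶜ (s *ᶜ d) +ᶜ t *ᶜ (s *ᶜ e)
    shuffle′ = solve 4 (λ s d t e →
      s :* (s :* d :+ t :* e) := s :* (s :* d) :+ t :* (s :* e)) C.refl

  shuffle : ∀ a t s d e →
    a +ᶜ t *ᶜ (s *ᶜ d) +ᶜ t *ᶜ (s *ᶜ (d +ᶜ t *ᶜ e)) ≈ᶜ
    a +ᶜ t *ᶜ (s *ᶜ d) +ᶜ t *ᶜ (s *ᶜ d +ᶜ t *ᶜ (s *ᶜ e))
  shuffle = solve 5 (λ a t s d e →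
    a :+ t :* (s :* d) :+ t :* (s :* (d :+ t :* e)) :=
    a :+ t :* (s :* d) :+ t :* (s :* d :+ t :* (s :* e))) C.refl

-- Values apart from zero of affine and quadratic functions

-- Whether a vanishes cannot be decided, but f 1 - f 0 ≈ d, so f 1 or f 0 is apart from zero.
affine-#0 : ∀ (f : ℂ → ℂ) a {d} → (∀ t → f t ≈ᶜ a +ᶜ t *ᶜ d) → d #ᶜ 0ᶜ → ∃ λ t → f t #ᶜ 0ᶜ
affine-#0 f a {d} f≈ d#0 =
  [ (λ p → 1ᶜ , #ᶜ0-resp-≈ (C.sym (f≈ 1ᶜ)) p)
  , (λ p → 0ᶜ , #ᶜ0-resp-≈ (C.sym f0≈) (-ᶜ-#0 a p))
  ]′ (+ᶜ-#0 (a +ᶜ 1ᶜ *ᶜ d) (-ᶜ a) (#ᶜ0-resp-≈ (C.sym difference) d#0))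
  where
  open SetoidReasoning C.setoid

  f0≈ : f 0ᶜ ≈ᶜ a
  f0≈ = C.trans (f≈ 0ᶜ) (C.trans (C.+-congˡ (C.zeroˡ d)) (C.+-identityʳ a))

  difference : (a +ᶜ 1ᶜ *ᶜ d) +ᶜ -ᶜ a ≈ᶜ d
  difference = begin
    (a +ᶜ 1ᶜ *ᶜ d) +ᶜ -ᶜ a  ≈⟨ C.+-congʳ (C.+-comm a (1ᶜ *ᶜ d)) ⟩
    (1ᶜ *ᶜ d +ᶜ a) +ᶜ -ᶜ a  ≈⟨ C.+-assoc _ a (-ᶜ a) ⟩
    1ᶜ *ᶜ d +ᶜ (a +ᶜ -ᶜ a)  ≈⟨ C.+-cong (C.*-identityˡ d) (C.-‿inverseʳ a) ⟩
    d +ᶜ 0ᶜ                 ≈⟨ C.+-identityʳ d ⟩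
    d                       ∎

-- The difference f 1 - f (-1) eliminates both a and e and leaves 4d.
quadratic-#0 : ∀ (f : ℂ → ℂ) a {d} e →
  (∀ t → f t ≈ᶜ a +ᶜ t *ᶜ d +ᶜ t *ᶜ (d +ᶜ t *ᶜ e)) → d #ᶜ 0ᶜ → ∃ λ t → f t #ᶜ 0ᶜ
quadratic-#0 f a {d} e f≈ d#0 =
  [ (λ p → 1ᶜ , p) , (λ p → -1ᶜ , *ᶜ-#0 -1ᶜ (f -1ᶜ) p) ]′
    (+ᶜ-#0 (f 1ᶜ) (-1ᶜ *ᶜ f -1ᶜ)
      (#ᶜ0-resp-≈ (C.sym difference) (double-#0 (d +ᶜ d) (double-#0 d d#0))))
  where
  open SetoidReasoning C.setoid

  -1ᶜ : ℂ
  -1ᶜ = -ᶜ 1ᶜ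

  difference : f 1ᶜ +ᶜ -1ᶜ *ᶜ f -1ᶜ ≈ᶜ (d +ᶜ d) +ᶜ (d +ᶜ d)
  difference = begin
    f 1ᶜ +ᶜ -1ᶜ *ᶜ f -1ᶜ
      ≈⟨ C.+-cong (f≈ 1ᶜ) (C.*-congˡ { -1ᶜ} (f≈ -1ᶜ)) ⟩
    (a +ᶜ 1ᶜ *ᶜ d +ᶜ 1ᶜ *ᶜ (d +ᶜ 1ᶜ *ᶜ e)) +ᶜ
      -1ᶜ *ᶜ (a +ᶜ -1ᶜ *ᶜ d +ᶜ -1ᶜ *ᶜ (d +ᶜ -1ᶜ *ᶜ e))
      ≈⟨ C.+-congʳ (C.+-cong (C.+-congˡ {a} (C.*-identityˡ d))
           (C.trans (C.*-identityˡ _) (C.+-congˡ {d} (C.*-identityˡ e)))) ⟩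
    (a +ᶜ d +ᶜ (d +ᶜ e)) +ᶜ -1ᶜ *ᶜ (a +ᶜ -1ᶜ *ᶜ d +ᶜ -1ᶜ *ᶜ (d +ᶜ -1ᶜ *ᶜ e))
      ≈⟨ shuffle a d e -1ᶜ ⟩
    (d +ᶜ d +ᶜ (a +ᶜ -1ᶜ *ᶜ a) +ᶜ (e +ᶜ -1ᶜ *ᶜ (-1ᶜ *ᶜ (-1ᶜ *ᶜ e)))) +ᶜ
      (-1ᶜ *ᶜ (-1ᶜ *ᶜ d) +ᶜ -1ᶜ *ᶜ (-1ᶜ *ᶜ d))
      ≈⟨ C.+-cong (C.+-cong (C.+-congˡ {d +ᶜ d} (cancel a))
           (C.trans (C.+-congˡ {e} (neg*neg (-1ᶜ *ᶜ e))) (cancel e)))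
           (C.+-cong (neg*neg d) (neg*neg d)) ⟩
    (d +ᶜ d +ᶜ 0ᶜ +ᶜ 0ᶜ) +ᶜ (d +ᶜ d)
      ≈⟨ C.+-congʳ {d +ᶜ d} (C.trans (C.+-identityʳ _) (C.+-identityʳ _)) ⟩
    (d +ᶜ d) +ᶜ (d +ᶜ d) ∎
    where
    cancel : ∀ x → x +ᶜ -1ᶜ *ᶜ x ≈ᶜ 0ᶜ
    cancel x = C.trans (C.+-congˡ {x} (CP.-1*x≈-x x)) (C.-‿inverseʳ x)

    -- Here -1 is an indeterminate u; that its square is 1 is used only afterwards, through
    -- `neg*neg`.
    shuffle : ∀ a d e u →
      (a +ᶜ d +ᶜ (d +ᶜ e)) +ᶜ u *ᶜ (a +ᶜ u *ᶜ d +ᶜ u *ᶜ (d +ᶜ u *ᶜ e)) ≈ᶜ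
      (d +ᶜ d +ᶜ (a +ᶜ u *ᶜ a) +ᶜ (e +ᶜ u *ᶜ (u *ᶜ (u *ᶜ e)))) +ᶜ
        (u *ᶜ (u *ᶜ d) +ᶜ u *ᶜ (u *ᶜ d))
    shuffle = solve 4 (λ a d e u →
      (a :+ d :+ (d :+ e)) :+ u :* (a :+ u :* d :+ u :* (d :+ u :* e)) :=
      (d :+ d :+ (a :+ u :* a) :+ (e :+ u :* (u :* (u :* e)))) :+
        (u :* (u :* d) :+ u :* (u :* d))) C.refl

-- Symmetric matrices supported on a graph

submatrix : (ρ κ : Fin m → Fin n) → Matrix n → Matrix m
submatrix ρ κ B i j = B (ρ i) (κ j)

OnEdge : (r c i j : Fin n) → Set
OnEdge r c i j = (i ≡ r × j ≡ c) ⊎ (i ≡ c × j ≡ r)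

abstract
  onEdge? : (r c i j : Fin n) → Dec (OnEdge r c i j)
  onEdge? r c i j = (i Fin.≟ r ×-dec j Fin.≟ c) ⊎-dec (i Fin.≟ c ×-dec j Fin.≟ r)

-- One test covers both orientations, so for r = c the diagonal entry grows by t and not by 2t.
perturb : Fin n → Fin n → Matrix n → ℂ → Matrix n
perturb r c B t i j = if does (onEdge? r c i j) then B i j +ᶜ t else B i j

perturb-on : ∀ {r c i j : Fin n} B {t} → OnEdge r c i j → perturb r c B t i j ≈ᶜ B i j +ᶜ t
perturb-on {r = r} {c} {i} {j} B e with onEdge? r c i j
... | yes _  = C.refl
... | no  ¬e = contradiction e ¬e

perturb-off : ∀ {r c i j : Fin n} B {t} → ¬ OnEdge r c i j → perturb r c B t i j ≈ᶜ B i j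
perturb-off {r = r} {c} {i} {j} B ¬e with onEdge? r c i j
... | yes e = contradiction e ¬e
... | no  _ = C.refl

module _ {n : ℕ} (E : Fin n → Fin n → Set) (E-sym : ∀ {i j} → E i j → E j i) where

  record Admissible (B : Matrix n) : Set where
    field
      symmetric : ∀ i j → B i j ≈ᶜ B j i
      supported : ∀ i j → B i j #ᶜ 0ᶜ → E i j

  open Admissible public

  perturb-admissible : ∀ {r c B t} → E r c → Admissible B → Admissible (perturb r c B t)
  perturb-admissible {r} {c} {B} {t} rc a = record
    { symmetric = perturb-sym
    ; supported = perturb-supp
    }
    where
    flip : ∀ {i j} → OnEdge r c i j → OnEdge r c j i
    flip (inj₁ (p , q)) = inj₂ (q , p)
    flip (inj₂ (p , q)) = inj₁ (q , p)

    perturb-sym : ∀ i j → perturb r c B t i j ≈ᶜ perturb r c B t j i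
    perturb-sym i j with onEdge? r c i j
    ... | yes e = C.trans (C.+-congʳ (symmetric a i j)) (C.sym (perturb-on B (flip e)))
    ... | no ¬e = C.trans (symmetric a i j) (C.sym (perturb-off B (¬e ∘ flip)))

    perturb-supp : ∀ i j → perturb r c B t i j #ᶜ 0ᶜ → E i j
    perturb-supp i j p with onEdge? r c i j
    ... | yes (inj₁ (refl , refl)) = rc
    ... | yes (inj₂ (refl , refl)) = E-sym rc
    ... | no  _                    = supported a i j p

  -- The witness has full size: symmetry and support concern all of it, although ρ and κ may select
  -- different indices.
  HasNonsingular : (ρ κ : Fin m → Fin n) → Set
  HasNonsingular ρ κ = ∃ λ B → Admissible B × det (submatrix ρ κ B) #ᶜ 0ᶜ

  adjustEntry : ∀ {ρ κ : Fin (suc m) → Fin n} j → E (ρ zero) (κ j) →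
    (∀ k → κ k ≡ κ j → k ≡ j) →
    (∀ i k → ¬ OnEdge (ρ zero) (κ j) (ρ (suc i)) (κ k)) →
    HasNonsingular (ρ ∘ suc) (κ ∘ punchIn j) → HasNonsingular ρ κ
  adjustEntry {ρ = ρ} {κ} j e κ-inj below (B , adm , d#0) =
    let t , p = affine-#0 (λ t → det (submatrix ρ κ (perturb (ρ zero) (κ j) B t)))
          (det (submatrix ρ κ B))
          (λ t → det-perturb {A = submatrix ρ κ B}
            {A′ = submatrix ρ κ (perturb (ρ zero) (κ j) B t)} j t
            (λ i k → perturb-off B (below i k))
            (λ k k≢j → perturb-off B λ
              { (inj₁ (_ , p)) → k≢j (κ-inj k p)
              ; (inj₂ (p , q)) → k≢j (κ-inj k (trans q p)) })
            (perturb-on B (inj₁ (refl , refl))))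
          (sgn-#0 j (det (minor₀ j (submatrix ρ κ B))) d#0)
    in perturb (ρ zero) (κ j) B t , perturb-admissible e adm , p

  module _ (σ : Fin n → Fin n) (σ-injective : Injective _≡_ _≡_ σ) (σ-edge : ∀ i → E i (σ i)) where

    -- σ maps the rows r ∷ᵛ q to the columns s ∷ᵛ q, and r to q c; deleting row r
    -- and column q c leaves, up to the order of the rows, a configuration of
    -- the same shape with q c in place of r. So one follows the cycle of σ
    -- until it closes at s.
    nonsingular-closed : (q : Fin m → Fin n) → Injective _≡_ _≡_ q →
             (∀ i → ∃ λ j → σ (q i) ≡ q j) → HasNonsingular q q

    nonsingular-open : ∀ r s (q : Fin m → Fin n) → Injective _≡_ _≡_ q → r ≢ s →
      (∀ i → q i ≢ r) → (∀ i → q i ≢ s) →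
      σ r ≡ s ⊎ (∃ λ j → σ r ≡ q j) → (∀ i → σ (q i) ≡ s ⊎ (∃ λ j → σ (q i) ≡ q j)) →
      HasNonsingular (r ∷ᵛ q) (s ∷ᵛ q)

    nonsingular-follow : ∀ r s (q : Fin (suc m) → Fin n) c → Injective _≡_ _≡_ q →
      (∀ i → q i ≢ r) → (∀ i → q i ≢ s) →
      σ r ≡ q c → (∀ i → σ (q i) ≡ s ⊎ (∃ λ j → σ (q i) ≡ q j)) →
      HasNonsingular q ((s ∷ᵛ q) ∘ punchIn (suc c))
    nonsingular-follow {m} r s q c q-inj r∉q s∉q σr≡qc next =
      let B , adm , d#0 = nonsingular-open (q c) s (q ∘ punchIn c)
            (λ p → Fin.punchIn-injective c _ _ (q-inj p))
            (s∉q c)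
            (λ i p → Fin.punchInᵢ≢i c i (q-inj p))
            (s∉q ∘ punchIn c)
            (next′ c)
            (next′ ∘ punchIn c)
      in B , adm , *ᶜ-#0 (sgn c) (det (submatrix q ((s ∷ᵛ q) ∘ punchIn (suc c)) B))
           (#ᶜ0-resp-≈ (C.trans
             (det-cong {A = submatrix (q c ∷ᵛ q ∘ punchIn c) (s ∷ᵛ q ∘ punchIn c) B}
                       {B = submatrix q ((s ∷ᵛ q) ∘ punchIn (suc c)) B ∘ moveToFront c} λ
               { zero    zero    → C.refl
               ; zero    (suc _) → C.refl
               ; (suc _) zero    → C.refl
               ; (suc _) (suc _) → C.refl })
             (det-moveToFront c (submatrix q ((s ∷ᵛ q) ∘ punchIn (suc c)) B))) d#0)
      where
      next′ : ∀ i → σ (q i) ≡ s ⊎ (∃ λ j → σ (q i) ≡ q (punchIn c j))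
      next′ i with next i
      ... | inj₁ p = inj₁ p
      ... | inj₂ (j , p) with c Fin.≟ j
      -- This would give r and `q i` the same image under σ, although r is not among the q.
      ...   | yes refl = contradiction (σ-injective (trans p (sym σr≡qc))) (r∉q i)
      ...   | no c≢j   = inj₂ (punchOut c≢j , trans p (cong q (sym (Fin.punchIn-punchOut c≢j))))

    nonsingular-open {m} r s q q-inj r≢s r∉q s∉q (inj₁ σr≡s) next =
      adjustEntry {ρ = r ∷ᵛ q} {κ = s ∷ᵛ q} zero (subst (E r) σr≡s (σ-edge r))
        (λ { zero _ → refl ; (suc k) p → contradiction p (s∉q k) })
        (λ { i _ (inj₁ (p , _)) → r∉q i p ; i _ (inj₂ (p , _)) → s∉q i p })
        -- The cycle has closed: s is already the image of r, so by injectivity σ maps the remaining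
        -- indices to themselves.
        (nonsingular-closed q q-inj λ i → [ (λ p → contradiction
          (σ-injective (trans p (sym σr≡s))) (r∉q i)) , id ]′ (next i))
    nonsingular-open {suc m} r s q q-inj r≢s r∉q s∉q (inj₂ (c , σr≡qc)) next =
      adjustEntry {ρ = r ∷ᵛ q} {κ = s ∷ᵛ q} (suc c) (subst (E r) σr≡qc (σ-edge r))
        (λ { zero p → contradiction (sym p) (s∉q c) ; (suc k) p → cong suc (q-inj p) })
        (λ { i _       (inj₁ (p , _)) → r∉q i p
           ; i zero    (inj₂ (_ , p)) → r≢s (sym p)
           ; i (suc k) (inj₂ (_ , p)) → r∉q k p })
        (nonsingular-follow r s q c q-inj r∉q s∉q σr≡qc next)

    -- All cycles are used up. The empty minor is 1, so the zero matrix will do; the edges are added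
    -- on the way back through the recursion.
    nonsingular-closed {zero} q q-inj next = (λ _ _ → 0ᶜ)
      , record { symmetric = λ _ _ → C.refl ; supported = λ _ _ p → contradiction p 0ᶜ-#0 }
      , 1#0
    nonsingular-closed {suc m} q q-inj next with next zero
    ... | zero , σr≡r =
      adjustEntry {ρ = q} {κ = q} zero (subst (E (q zero)) σr≡r (σ-edge (q zero)))
        (λ k p → q-inj p)
        (λ { i _ (inj₁ (p , _)) → contradiction (q-inj p) λ ()
           ; i _ (inj₂ (p , _)) → contradiction (q-inj p) λ () })
        (nonsingular-closed (q ∘ suc) (Fin.suc-injective ∘ q-inj) next′)
      where
      next′ : ∀ i → ∃ λ j → σ (q (suc i)) ≡ q (suc j)
      next′ i with next (suc i)
      ... | zero  , p = contradiction (q-inj (σ-injective (trans p (sym σr≡r)))) λ ()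
      ... | suc j , p = j , p
    -- A cycle of length at least two is cut open with r = s = `q zero`. Rows and columns coincide
    -- here, so the mirror entry belongs to the submatrix and the determinant is quadratic in t.
    nonsingular-closed {suc (suc m)} q q-inj next | suc c , σr≡qc =
      let B , adm , d#0 = nonsingular-follow (q zero) (q zero) (q ∘ suc) c (Fin.suc-injective ∘ q-inj)
            (λ i p → contradiction (q-inj p) λ ()) (λ i p → contradiction (q-inj p) λ ())
            σr≡qc next′
          F = λ t → submatrix q q (perturb (q zero) (q (suc c)) B t)
          e , quadratic = det-perturbSymmetric (submatrix q q B) F c
            (λ i j → symmetric adm (q i) (q j))
            (λ t k k≢c → perturb-off B λ
              { (inj₁ (_ , p)) → k≢c (q-inj p)
              ; (inj₂ (p , _)) → contradiction (q-inj p) λ () })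
            (λ t → perturb-on B (inj₁ (refl , refl)))
            (λ t j k jk → perturb-off B λ
              { (inj₁ (p , _)) → contradiction (q-inj p) λ ()
              ; (inj₂ (p , p′)) → jk (Fin.suc-injective (q-inj p) , q-inj p′) })
            (λ t → perturb-on B (inj₂ (refl , refl)))
          t , p = quadratic-#0 (det ∘ F) (det (submatrix q q B)) e quadratic
            (sgn-#0 (suc c) (det (minor₀ (suc c) (submatrix q q B))) (#ᶜ0-resp-≈ (det-cong
              {A = submatrix (q ∘ suc) ((q zero ∷ᵛ q ∘ suc) ∘ punchIn (suc c)) B}
              {B = minor₀ (suc c) (submatrix q q B)}
              λ { i zero → C.refl ; i (suc j) → C.refl }) d#0))
      in perturb (q zero) (q (suc c)) B t
       , perturb-admissible (subst (E (q zero)) σr≡qc (σ-edge (q zero))) adm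
       , p
      where
      next′ : ∀ i → σ (q (suc i)) ≡ q zero ⊎ (∃ λ j → σ (q (suc i)) ≡ q (suc j))
      next′ i with next (suc i)
      ... | zero  , p = inj₁ p
      ... | suc j , p = inj₂ (j , p)

    nonsingular : ∃ λ B → Admissible B × det B #ᶜ 0ᶜ
    nonsingular = nonsingular-closed id id λ i → σ i , refl

-- Transversals

indicator : Bool → ℕ
indicator b = if b then 1 else 0

count : (Fin n → Bool) → ℕ
count S = ℕS.sum (indicator ∘ S)

count-cong : (S S′ : Fin n → Bool) → (∀ i → S i ≡ S′ i) → count S ≡ count S′
count-cong S S′ e = ℕS.sum-cong-≗ λ i → cong indicator (e i)

count-∨-∧ : (S T : Fin n → Bool) →
  count (λ i → S i ∨ T i) ℕ.+ count (λ i → S i ∧ T i) ≡ count S ℕ.+ count T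
count-∨-∧ S T = trans (sym (ℕS.∑-distrib-+ (λ i → indicator (S i ∨ T i)) (λ i → indicator (S i ∧ T i))))
  (trans (ℕS.sum-cong-≗ λ i → pointwise (S i) (T i)) (ℕS.∑-distrib-+ (indicator ∘ S) (indicator ∘ T)))
  where
  pointwise : ∀ a b → indicator (a ∨ b) ℕ.+ indicator (a ∧ b) ≡ indicator a ℕ.+ indicator b
  pointwise true  b     = refl
  pointwise false true  = refl
  pointwise false false = refl

singleton : Fin n → Fin n → Bool
singleton i j = does (i Fin.≟ j)

singleton-true : (i j : Fin n) → singleton i j ≡ true → i ≡ j
singleton-true i j p with i Fin.≟ j
... | yes q = q

singleton-refl : (i : Fin n) → singleton i i ≡ true
singleton-refl i = dec-true (i Fin.≟ i) refl

remove : (Fin n → Bool) → Fin n → Fin n → Bool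
remove S i j = S j ∧ not (singleton i j)

count-∅ : ∀ n → count {n} (λ _ → false) ≡ 0
count-∅ n = ℕS.sum-replicate-zero n

count-singleton : (i : Fin n) → count (singleton i) ≡ 1
count-singleton {suc n} zero    = cong suc (count-∅ n)
count-singleton {suc n} (suc i) = count-singleton i

count-remove : (S : Fin n → Bool) (i : Fin n) → S i ≡ true → suc (count (remove S i)) ≡ count S
count-remove {n} S i Si = begin
  1 ℕ.+ count (remove S i)
    ≡⟨ cong (ℕ._+ count (remove S i)) (count-singleton i) ⟨
  count (singleton i) ℕ.+ count (remove S i)
    ≡⟨ count-∨-∧ (singleton i) (remove S i) ⟨
  count (λ j → singleton i j ∨ remove S i j) ℕ.+ count (λ j → singleton i j ∧ remove S i j)
    ≡⟨ cong₂ ℕ._+_ (count-cong (λ j → singleton i j ∨ remove S i j) S union)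
         (trans (count-cong (λ j → singleton i j ∧ remove S i j) (λ _ → false) disjoint) (count-∅ n)) ⟩
  count S ℕ.+ 0
    ≡⟨ ℕ.+-identityʳ (count S) ⟩
  count S ∎
  where
  open ≡.≡-Reasoning

  union : ∀ j → singleton i j ∨ remove S i j ≡ S j
  union j with i Fin.≟ j
  ... | yes refl = sym Si
  ... | no  _    with S j
  ...   | true  = refl
  ...   | false = refl

  disjoint : ∀ j → singleton i j ∧ remove S i j ≡ false
  disjoint j with i Fin.≟ j
  ... | yes _ = ∧-zeroʳ (S j)
  ... | no  _ = refl

-- The columns need only contain the neighbours of the rows, so unions and intersections of column
-- sets can serve without computing exact neighbourhoods.
record Violator (E : Fin m → Fin n → Set) : Set where
  field
    rows      : Fin m → Bool
    columns   : Fin n → Bool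
    neighbour : ∀ i j → E i j → rows i ≡ true → columns j ≡ true
    deficient : count columns ℕ.< count rows

private
  variable
    E E₁ E₂ : Fin m → Fin n → Set

∨-true : ∀ a b → a ∨ b ≡ true → a ≡ true ⊎ b ≡ true
∨-true true  b p = inj₁ refl
∨-true false b p = inj₂ p

∧-true : ∀ a b → a ∧ b ≡ true → a ≡ true × b ≡ true
∧-true true b p = refl , p

not-true : ∀ a → not a ≡ true → a ≢ true
not-true true  ()
not-true false _ ()

-- Rado's argument: if the two violators contain the row r, then their union
-- covers all edges at r, and their intersection without r has no edges at r; by
-- submodularity one of these two is deficient.
merge : ∀ r → (∀ i j → i ≢ r → E i j → E₁ i j × E₂ i j) → (∀ j → E r j → E₁ r j ⊎ E₂ r j) →
  Violator E₁ → Violator E₂ → Violator E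
merge {E = E} {E₁} {E₂} r away at V₁ V₂ = go (S₁ r) (S₂ r) refl refl
  where
  open Violator V₁ renaming (rows to S₁; columns to T₁; neighbour to N₁; deficient to D₁)
  open Violator V₂ renaming (rows to S₂; columns to T₂; neighbour to N₂; deficient to D₂)

  union intersection : (Fin n → Bool) → (Fin n → Bool) → Fin n → Bool
  union        S T i = S i ∨ T i
  intersection S T i = S i ∧ T i

  without : ∀ {S : Fin _ → Bool} {i} → S r ≡ false → S i ≡ true → i ≢ r
  without p q refl with trans (sym p) q
  ... | ()

  N∪ : ∀ i j → E i j → S₁ r ≡ true → S₂ r ≡ true → union S₁ S₂ i ≡ true → union T₁ T₂ j ≡ true
  N∪ i j e S₁r S₂r Si with i Fin.≟ r
  ... | yes refl with at j e
  ...   | inj₁ e₁ = cong (_∨ T₂ j) (N₁ i j e₁ S₁r)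
  ...   | inj₂ e₂ = trans (cong (T₁ j ∨_) (N₂ i j e₂ S₂r)) (∨-zeroʳ (T₁ j))
  N∪ i j e S₁r S₂r Si | no i≢r with ∨-true (S₁ i) (S₂ i) Si
  ...   | inj₁ S₁i = cong (_∨ T₂ j) (N₁ i j (proj₁ (away i j i≢r e)) S₁i)
  ...   | inj₂ S₂i = trans (cong (T₁ j ∨_) (N₂ i j (proj₂ (away i j i≢r e)) S₂i)) (∨-zeroʳ (T₁ j))

  N∩ : ∀ i j → E i j → remove (intersection S₁ S₂) r i ≡ true → intersection T₁ T₂ j ≡ true
  N∩ i j e Si =
    let S₁₂i , i≠r = ∧-true _ _ Si
        S₁i , S₂i = ∧-true _ _ S₁₂i
        e₁ , e₂ = away i j (λ { refl → not-true _ i≠r (dec-true (r Fin.≟ r) refl) }) e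
    in cong₂ _∧_ (N₁ i j e₁ S₁i) (N₂ i j e₂ S₂i)

  -- The two deficits add up to at least two, and taking r out of the intersection costs one of
  -- them, so a deficit of at least one is left for the union or the intersection.
  one-deficient : ∀ {t∪ t∩ s∪ s∩ t₁ t₂ s₁ s₂} → t∪ ℕ.+ t∩ ≡ t₁ ℕ.+ t₂ →
    s∪ ℕ.+ suc s∩ ≡ s₁ ℕ.+ s₂ → t₁ ℕ.< s₁ → t₂ ℕ.< s₂ → ¬ t∪ ℕ.< s∪ → t∩ ℕ.< s∩
  one-deficient {t∪} {t∩} {s∪} {s∩} {t₁} {t₂} {s₁} {s₂} et es d₁ d₂ t∪≮s∪ =
    ℕ.+-cancelˡ-< s∪ t∩ s∩ (ℕ.s<s⁻¹ (begin-strict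
      suc (s∪ ℕ.+ t∩)     ≤⟨ ℕ.s≤s (ℕ.+-monoˡ-≤ t∩ (ℕ.≮⇒≥ t∪≮s∪)) ⟩
      suc (t∪ ℕ.+ t∩)     ≡⟨ cong suc et ⟩
      suc (t₁ ℕ.+ t₂)     <⟨ ℕ.s<s (ℕ.+-monoʳ-< t₁ d₂) ⟩
      suc t₁ ℕ.+ s₂       ≤⟨ ℕ.+-monoˡ-≤ s₂ d₁ ⟩
      s₁ ℕ.+ s₂           ≡⟨ es ⟨
      s∪ ℕ.+ suc s∩       ≡⟨ ℕ.+-suc s∪ s∩ ⟩
      suc (s∪ ℕ.+ s∩)     ∎))
    where open ℕ.≤-Reasoning

  go : ∀ a b → S₁ r ≡ a → S₂ r ≡ b → Violator E
  go false _ S₁r _ = record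
    { rows = S₁ ; columns = T₁
    ; neighbour = λ i j e Si → N₁ i j (proj₁ (away i j (without {S₁} S₁r Si) e)) Si
    ; deficient = D₁ }
  go true false _ S₂r = record
    { rows = S₂ ; columns = T₂
    ; neighbour = λ i j e Si → N₂ i j (proj₂ (away i j (without {S₂} S₂r Si) e)) Si
    ; deficient = D₂ }
  go true true S₁r S₂r with count (union T₁ T₂) ℕ.<? count (union S₁ S₂)
  ... | yes d = record
    { rows = union S₁ S₂ ; columns = union T₁ T₂
    ; neighbour = λ i j e → N∪ i j e S₁r S₂r
    ; deficient = d }
  ... | no ¬d = record
    { rows = remove (intersection S₁ S₂) r ; columns = intersection T₁ T₂
    ; neighbour = N∩
    ; deficient = one-deficient (count-∨-∧ T₁ T₂)
        (trans (cong (count (union S₁ S₂) ℕ.+_)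
                 (count-remove (intersection S₁ S₂) r (cong₂ _∧_ S₁r S₂r)))
               (count-∨-∧ S₁ S₂))
        D₁ D₂ ¬d }

injective⊎violator : (f : Fin m → Fin n) →
  Injective _≡_ _≡_ f ⊎ Violator (λ i j → j ≡ f i)
injective⊎violator {m} {n} f
  with Fin.any? (λ i → Fin.any? (λ j → f i Fin.≟ f j ×-dec ¬? (i Fin.≟ j)))
... | no ¬collision = inj₁ λ {i} {j} fi≡fj → decidable-stable (i Fin.≟ j) λ i≢j →
  ¬collision (i , j , fi≡fj , i≢j)
... | yes (i , j , fi≡fj , i≢j) = inj₂ record
  { rows      = λ k → singleton i k ∨ singleton j k
  ; columns   = singleton (f i)
  ; neighbour = λ { k _ refl p → [ (λ q → hit (sym (cong f (singleton-true i k q))))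
                                 , (λ q → hit (trans (sym (cong f (singleton-true j k q))) (sym fi≡fj)))
                                 ]′ (∨-true _ _ p) }
  ; deficient = subst₂ ℕ._<_ (sym (count-singleton (f i))) (sym two) ℕ.≤-refl
  }
  where
  hit : ∀ {k} → k ≡ f i → singleton (f i) k ≡ true
  hit {k} p = dec-true (f i Fin.≟ k) (sym p)

  disjoint : ∀ k → singleton i k ∧ singleton j k ≡ false
  disjoint k with i Fin.≟ k | j Fin.≟ k
  ... | yes p | yes q = contradiction (trans p (sym q)) i≢j
  ... | yes _ | no _  = refl
  ... | no _  | _     = refl

  two : count (λ k → singleton i k ∨ singleton j k) ≡ 2
  two = trans (sym (ℕ.+-identityʳ _)) (trans
    (cong (count (λ k → singleton i k ∨ singleton j k) ℕ.+_)
      (sym (trans (count-cong (λ k → singleton i k ∧ singleton j k) (λ _ → false) disjoint) (count-∅ m))))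
    (trans (count-∨-∧ (singleton i) (singleton j))
           (cong₂ ℕ._+_ (count-singleton i) (count-singleton j))))

violator-anti : (∀ i j → E₁ i j → E₂ i j) → Violator E₂ → Violator E₁
violator-anti E₁⊆E₂ V = record
  { rows = rows ; columns = columns
  ; neighbour = λ i j e → neighbour i j (E₁⊆E₂ i j e)
  ; deficient = deficient }
  where open Violator V

Transversal : (Fin m → List (Fin n)) → Set
Transversal L = ∃ λ f → (∀ i → f i ∈ₗ L i) × Injective _≡_ _≡_ f

Hall : (Fin m → List (Fin n)) → Set
Hall L = Transversal L ⊎ Violator λ i j → j ∈ₗ L i

Hall-resp : {L L′ : Fin m → List (Fin n)} → (∀ i → L i ≡ L′ i) → Hall L → Hall L′
Hall-resp e = Sum.map
  (λ (f , f∈L , f-inj) → f , (λ i → subst (f i ∈ₗ_) (e i) (f∈L i)) , f-inj)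
  (violator-anti λ i j → subst (j ∈ₗ_) (sym (e i)))

-- The rows not in rs have already been cut down to one candidate each.
hall-from : (rs : List (Fin m)) (L : Fin m → List (Fin n)) →
  (∀ i → i ∈ₗ rs ⊎ (∃ λ a → L i ≡ a ∷ [])) → Hall L
hall-from {m} {n} [] L single = [ inj₁ ∘ transversal , inj₂ ∘ violator-anti edge ]′
  (injective⊎violator f)
  where
  choice : ∀ i → ∃ λ a → L i ≡ a ∷ []
  choice i with single i
  ... | inj₂ c = c

  f : Fin m → Fin n
  f i = proj₁ (choice i)

  L≡ : ∀ i → L i ≡ f i ∷ []
  L≡ i = proj₂ (choice i)

  transversal : Injective _≡_ _≡_ f → Transversal L
  transversal f-inj = f , (λ i → subst (f i ∈ₗ_) (sym (L≡ i)) (here refl)) , f-inj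

  edge : ∀ i j → j ∈ₗ L i → j ≡ f i
  edge i j j∈L with subst (j ∈ₗ_) (L≡ i) j∈L
  ... | here p = p
hall-from {m} {n} (r ∷ rs) L single =
  Hall-resp (updateAt-id-local r L refl) (go (L r))
  where
  _≔_ : Fin m → List (Fin n) → Fin m → List (Fin n)
  (r ≔ l) = updateAt L r (const l)

  at : ∀ l → (r ≔ l) r ≡ l
  at l = updateAt-updates r L

  away : ∀ {i} l → i ≢ r → (r ≔ l) i ≡ L i
  away {i} l i≢r = updateAt-minimal i r L i≢r

  single′ : ∀ a i → i ∈ₗ rs ⊎ (∃ λ b → (r ≔ (a ∷ [])) i ≡ b ∷ [])
  single′ a i with i Fin.≟ r | single i
  ... | yes refl | _                   = inj₂ (a , at (a ∷ []))
  ... | no i≢r   | inj₁ (here i≡r)     = contradiction i≡r i≢r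
  ... | no i≢r   | inj₁ (there i∈rs)   = inj₁ i∈rs
  ... | no i≢r   | inj₂ (b , e)        = inj₂ (b , trans (away (a ∷ []) i≢r) e)

  grow : ∀ {l l′} → (∀ {j} → j ∈ₗ l → j ∈ₗ l′) → Transversal (r ≔ l) → Transversal (r ≔ l′)
  grow {l} {l′} l⊆l′ (f , f∈ , f-inj) = f , f∈′ , f-inj
    where
    f∈′ : ∀ i → f i ∈ₗ (r ≔ l′) i
    f∈′ i with i Fin.≟ r
    ... | yes refl = subst (f i ∈ₗ_) (sym (at l′)) (l⊆l′ (subst (f i ∈ₗ_) (at l) (f∈ i)))
    ... | no i≢r   = subst (f i ∈ₗ_) (trans (away l i≢r) (sym (away l′ i≢r))) (f∈ i)

  go : ∀ l → Hall (r ≔ l)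
  go [] = inj₂ record
    { rows = singleton r ; columns = λ _ → false
    ; neighbour = isolated
    ; deficient = subst₂ ℕ._<_ (sym (count-∅ n)) (sym (count-singleton r)) ℕ.≤-refl }
    where
    isolated : ∀ i j → j ∈ₗ (r ≔ []) i → singleton r i ≡ true → false ≡ true
    isolated i j j∈ p with r Fin.≟ i
    ... | yes refl = contradiction (subst (j ∈ₗ_) (at []) j∈) λ ()
  -- Try the head alone, then the tail. If both fail, the two violators belong to graphs that share
  -- all candidates of r between them and agree at the other rows, as `merge` requires.
  go (a ∷ l) with hall-from rs (r ≔ (a ∷ [])) (single′ a)
  ... | inj₁ t  = inj₁ (grow (λ { (here p) → here p }) t)
  ... | inj₂ V₁ with go l
  ...   | inj₁ t  = inj₁ (grow there t)
  ...   | inj₂ V₂ = inj₂ (merge r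
    (λ i j i≢r j∈ → let j∈L = subst (j ∈ₗ_) (away (a ∷ l) i≢r) j∈
                    in subst (j ∈ₗ_) (sym (away (a ∷ []) i≢r)) j∈L
                     , subst (j ∈ₗ_) (sym (away l i≢r)) j∈L)
    (λ j j∈ → Sum.map (subst (j ∈ₗ_) (sym (at (a ∷ [])))) (subst (j ∈ₗ_) (sym (at l)))
      (split (subst (j ∈ₗ_) (at (a ∷ l)) j∈)))
    V₁ V₂)
    where
    split : ∀ {j} → j ∈ₗ a ∷ l → j ∈ₗ a ∷ [] ⊎ j ∈ₗ l
    split (here p)  = inj₁ (here p)
    split (there p) = inj₂ p

hall : (L : Fin m → List (Fin n)) → Hall L
hall {m} L = hall-from (allFin m) L λ i → inj₁ (∈-allFin i)

-- Linear functionals on convex hulls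

nonNeg-+ : ∀ {x y} → 0ᴿ ≤ᴿ x → 0ᴿ ≤ᴿ y → 0ᴿ ≤ᴿ x +ᴿ y
nonNeg-+ {x} {y} x≥0 y≥0 = mk≤ λ ε ε>0 →
  let δ , δ>0 , e = half ε ε>0
      N , p = below x≥0 δ δ>0 ∧ᴱ below y≥0 δ δ>0
  in N , λ n le → subst (0ℚ ℚ.<_)
       (trans (regroup (seq x n) (seq y n) δ) (cong (seq x n ℚ.+ seq y n ℚ.+_) e))
       (ℚ.+-mono-< (proj₁ (p n le)) (proj₂ (p n le)))
  where
  regroup : ∀ a b d → (a ℚ.+ d) ℚ.+ (b ℚ.+ d) ≡ a ℚ.+ b ℚ.+ (d ℚ.+ d)
  regroup = RingSolver.solve-∀ ℚ-ring

nonNeg-resp-≈ : ∀ {x y} → x ≈ᴿ y → 0ᴿ ≤ᴿ x → 0ᴿ ≤ᴿ y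
nonNeg-resp-≈ {x} {y} x≈y x≥0 = mk≤ λ ε ε>0 →
  let δ , δ>0 , e = half ε ε>0
      N , p = below x≥0 δ δ>0 ∧ᴱ close (R.sym x≈y) δ δ>0
  in N , λ n le → subst (0ℚ ℚ.<_)
       (trans (regroup (seq x n) (seq y n) δ) (cong (seq y n ℚ.+_) e))
       (ℚ.+-mono-< (proj₁ (p n le)) (small⇒ _ (proj₂ (p n le))))
  where
  regroup : ∀ a b d → (a ℚ.+ d) ℚ.+ ((b ℚ.- a) ℚ.+ d) ≡ b ℚ.+ (d ℚ.+ d)
  regroup = RingSolver.solve-∀ ℚ-ring

fromℚ-nonNeg : ∀ {q} → 0ℚ ℚ.≤ q → 0ᴿ ≤ᴿ fromℚ q
fromℚ-nonNeg q≥0 = mk≤ λ ε ε>0 → 0 , λ _ _ → ℚ.+-mono-≤-< q≥0 ε>0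

fromℚ-nonNeg⁻¹ : ∀ {q} → 0ᴿ ≤ᴿ fromℚ q → 0ℚ ℚ.≤ q
fromℚ-nonNeg⁻¹ {q} q≥0 = ℚ.≮⇒≥ λ q<0 →
  let N , p = below q≥0 (ℚ.- q) (ℚ.neg-antimono-< q<0)
  in ℚ.<-irrefl refl (subst (0ℚ ℚ.<_) (ℚ.+-inverseʳ q) (p N ℕ.≤-refl))

dotᴿ : (Fin n → ℚ) → ℝ^ n → ℝ
dotᴿ c x = RS.sum λ i → fromℚ (c i) *ᴿ x i

dot : (Fin n → ℚ) → (Fin n → ℚ) → ℚ
dot c u = ℚS.sum λ i → c i ℚ.* u i

dotᴿ-rational : (c u : Fin n → ℚ) {x : ℝ^ n} → x ≋ fromℚ ∘ u → dotᴿ c x ≈ᴿ fromℚ (dot c u)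
dotᴿ-rational {zero}  c u x≈u = R.refl
dotᴿ-rational {suc n} c u x≈u = R.trans
  (R.+-cong
    (R.trans (R.*-congˡ (x≈u zero)) (≗⇒≈ᴿ {y = fromℚ (c zero ℚ.* u zero)} λ _ → refl))
    (dotᴿ-rational (c ∘ suc) (u ∘ suc) (x≈u ∘ suc)))
  (≗⇒≈ᴿ λ _ → refl)

dotᴿ-weightedSum : ∀ (c : Fin n → ℚ) w p ts →
  dotᴿ c (weightedSum ((w , p) ∷ ts)) ≈ᴿ w *ᴿ dotᴿ c p +ᴿ dotᴿ c (weightedSum ts)
dotᴿ-weightedSum c w p ts = begin
  RS.sum (λ i → fromℚ (c i) *ᴿ (w *ᴿ p i +ᴿ weightedSum ts i))
    ≈⟨ RS.sum-cong-≋ (λ i → shuffle (fromℚ (c i)) w (p i) (weightedSum ts i)) ⟩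
  RS.sum (λ i → w *ᴿ (fromℚ (c i) *ᴿ p i) +ᴿ fromℚ (c i) *ᴿ weightedSum ts i)
    ≈⟨ RS.∑-distrib-+ (λ i → w *ᴿ (fromℚ (c i) *ᴿ p i)) (λ i → fromℚ (c i) *ᴿ weightedSum ts i) ⟩
  RS.sum (λ i → w *ᴿ (fromℚ (c i) *ᴿ p i)) +ᴿ dotᴿ c (weightedSum ts)
    ≈⟨ R.+-congʳ (R.sym (RS.*-distribˡ-sum w (λ i → fromℚ (c i) *ᴿ p i))) ⟩
  w *ᴿ dotᴿ c p +ᴿ dotᴿ c (weightedSum ts) ∎
  where
  open SetoidReasoning R.setoid

  shuffle : ∀ c w p s → c *ᴿ (w *ᴿ p +ᴿ s) ≈ᴿ w *ᴿ (c *ᴿ p) +ᴿ c *ᴿ s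
  shuffle c w p s = ≗⇒≈ᴿ λ k → identity (seq c k) (seq w k) (seq p k) (seq s k)
    where
    identity : ∀ c w p s → c ℚ.* (w ℚ.* p ℚ.+ s) ≡ w ℚ.* (c ℚ.* p) ℚ.+ c ℚ.* s
    identity = RingSolver.solve-∀ ℚ-ring

-- The constant b is multiplied by the total weight because sublists need not have total 1. In this
-- homogeneous form the functional is additive over the terms.
nonNeg-terms : ∀ {S : Pred (ℝ^ n) 0ℓ} b (c : Fin n → ℚ) →
  (∀ {x} → S x → 0ᴿ ≤ᴿ b +ᴿ dotᴿ c x) →
  ∀ ts → All (λ (w , p) → 0ᴿ ≤ᴿ w × S p) ts →
  0ᴿ ≤ᴿ b *ᴿ totalWeight ts +ᴿ dotᴿ c (weightedSum ts)
nonNeg-terms {n} b c S≥0 [] [] = nonNeg-resp-≈ (R.sym (R.trans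
  (R.+-cong (R.zeroʳ b) (R.trans
    (RS.sum-cong-≋ λ i → R.zeroʳ (fromℚ (c i))) (RS.sum-replicate-zero n)))
  (R.+-identityʳ 0ᴿ))) (fromℚ-nonNeg ℚ.≤-refl)
nonNeg-terms b c S≥0 ((w , p) ∷ ts) ((w≥0 , s) ∷ as) = nonNeg-resp-≈
  (R.trans (shuffle b w (dotᴿ c p) (totalWeight ts) (dotᴿ c (weightedSum ts)))
    (R.+-congˡ (R.sym (dotᴿ-weightedSum c w p ts))))
  (nonNeg-+ (*ᴿ-nonNeg w≥0 (S≥0 s)) (nonNeg-terms b c S≥0 ts as))
  where
  shuffle : ∀ b w d t s → w *ᴿ (b +ᴿ d) +ᴿ (b *ᴿ t +ᴿ s) ≈ᴿ b *ᴿ (w +ᴿ t) +ᴿ (w *ᴿ d +ᴿ s)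
  shuffle b w d t s = ≗⇒≈ᴿ λ k → identity (seq b k) (seq w k) (seq d k) (seq t k) (seq s k)
    where
    identity : ∀ b w d t s →
      w ℚ.* (b ℚ.+ d) ℚ.+ (b ℚ.* t ℚ.+ s) ≡ b ℚ.* (w ℚ.+ t) ℚ.+ (w ℚ.* d ℚ.+ s)
    identity = RingSolver.solve-∀ ℚ-ring

-- The weights are real, but functional and endpoint are rational. The conclusion is therefore an
-- inequality in ℚ, which can be refuted by computation.
conv-nonNeg : ∀ {S : Pred (ℝ^ n) 0ℓ} b (c : Fin n → ℚ) →
  (∀ {x} → S x → ∃ λ u → x ≋ fromℚ ∘ u × 0ℚ ℚ.≤ b ℚ.+ dot c u) →
  ∀ {x} → conv S x → ∀ {u} → x ≋ fromℚ ∘ u → 0ℚ ℚ.≤ b ℚ.+ dot c u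
conv-nonNeg b c S≥0 {x} x∈S {u} x≈u = fromℚ-nonNeg⁻¹ (nonNeg-resp-≈
  (R.trans
    (R.+-cong (R.trans (R.*-congˡ total) (R.*-identityʳ (fromℚ b)))
      (R.trans (RS.sum-cong-≋ λ i → R.*-congˡ (value i)) (dotᴿ-rational c u x≈u)))
    (fromℚ-+ b (dot c u)))
  (nonNeg-terms (fromℚ b) c
    (λ s → let u , x≈u , p = S≥0 s in nonNeg-resp-≈
      (R.sym (R.trans (R.+-congˡ (dotᴿ-rational c u x≈u)) (fromℚ-+ b (dot c u))))
      (fromℚ-nonNeg p))
    terms allowed))
  where
  open ConvexCombination x∈S
  fromℚ-+ : ∀ p q → fromℚ p +ᴿ fromℚ q ≈ᴿ fromℚ (p ℚ.+ q)
  fromℚ-+ p q = ≗⇒≈ᴿ λ _ → refl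

-- Exponents of degree two and the lattice points of the simplex

δ : Fin n → Fin n → ℚ
δ i j = if singleton i j then 1ℚ else 0ℚ

dot-+ : (c u v : Fin n → ℚ) → dot c (λ i → u i ℚ.+ v i) ≡ dot c u ℚ.+ dot c v
dot-+ c u v = trans (ℚS.sum-cong-≗ λ i → ℚ.*-distribˡ-+ (c i) (u i) (v i))
  (ℚS.∑-distrib-+ (λ i → c i ℚ.* u i) (λ i → c i ℚ.* v i))

dot-δ : (c : Fin n → ℚ) (i : Fin n) → dot c (δ i) ≡ c i
dot-δ {suc n} c zero    = trans
  (cong₂ ℚ._+_ (ℚ.*-identityʳ (c zero))
    (trans (ℚS.sum-cong-≗ λ i → ℚ.*-zeroʳ (c (suc i))) (ℚS.sum-replicate-zero n)))
  (ℚ.+-identityʳ (c zero))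
dot-δ {suc n} c (suc i) = trans
  (cong₂ ℚ._+_ (ℚ.*-zeroʳ (c zero)) (dot-δ (c ∘ suc) i))
  (ℚ.+-identityˡ (c (suc i)))

dot-comm : (c u : Fin n → ℚ) → dot c u ≡ dot u c
dot-comm c u = ℚS.sum-cong-≗ λ i → ℚ.*-comm (c i) (u i)

ι : ℕ → ℚ
ι m = + m ℚ./ 1

abstract
  -- The fraction m/1 is normalised by a gcd that does not compute for a variable m; this form
  -- exposes numerator and denominator.
  ι-mkℚ : ∀ m → ι m ≡ mkℚ (+ m) 0 (Coprimality.sym (Coprimality.1-coprimeTo m))
  ι-mkℚ m = ℚ.normalize-coprime (Coprimality.sym (Coprimality.1-coprimeTo m))

  ι-+ : ∀ l m → ι (l ℕ.+ m) ≡ ι l ℚ.+ ι m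
  ι-+ l m = sym (trans (cong₂ ℚ._+_ (ι-mkℚ l) (ι-mkℚ m))
    (cong (ℚ._/ 1) (cong₂ ℤ._+_ (ℤ.*-identityʳ (+ l)) (ℤ.*-identityʳ (+ m)))))

  ι-cancel-≤ : ∀ {l m} → ι l ℚ.≤ ι m → l ℕ.≤ m
  ι-cancel-≤ {l} {m} p = ℤ.drop‿+≤+ (subst₂ ℤ._≤_ (ℤ.*-identityʳ (+ l)) (ℤ.*-identityʳ (+ m))
    (ℚ.drop-*≤* (subst₂ ℚ._≤_ (ι-mkℚ l) (ι-mkℚ m) p)))

  nonNeg-integer : ∀ z → 0ℚ ℚ.≤ z ℚ./ 1 → ∃ λ m → z ≡ + m
  nonNeg-integer (+ m)    _ = m , refl
  nonNeg-integer -[1+ m ] p = contradiction p (<⇒≱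
    (ℚ.neg-antimono-< (ℚ.positive⁻¹ _ {{ℚ.normalize-pos (suc m) 1}})))

-- Definitionally the local vector `e` of `exponent`.
unit : Fin n → Vec ℕ n
unit {n} i = Vec.replicate n 0 Vec.[ i ]≔ 1

lookup-unit : (i j : Fin n) → Vec.lookup (unit i) j ≡ indicator (singleton i j)
lookup-unit {n} i j with i Fin.≟ j
... | yes refl = Vec.lookup∘update i (Vec.replicate n 0) 1
... | no  i≢j  = trans
  (Vec.lookup∘update′ (i≢j ∘ sym) (Vec.replicate n 0) 1) (Vec.lookup-replicate j 0)

lookup-exponent : (i j l : Fin n) → Vec.lookup (exponent i j) l ≡
  indicator (singleton i l) ℕ.+ indicator (singleton j l)
lookup-exponent i j l = trans (Vec.lookup-zipWith ℕ._+_ l (unit i) (unit j))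
  (cong₂ ℕ._+_ (lookup-unit i l) (lookup-unit j l))

sum≡0 : (k : Vec ℕ n) → Vec.sum k ≡ 0 → k ≡ Vec.replicate n 0
sum≡0 []       p = refl
sum≡0 (0 ∷ k)  p = cong (0 ∷_) (sum≡0 k p)

extract : ∀ {s} (k : Vec ℕ n) → Vec.sum k ≡ suc s →
  ∃₂ λ i l → k ≡ Vec.zipWith ℕ._+_ (unit i) l × Vec.sum l ≡ s
extract (zero ∷ k)  p =
  let i , l , k≡ , q = extract k p in suc i , 0 ∷ l , cong (0 ∷_) k≡ , q
extract (suc a ∷ k) p = zero , a ∷ k
  , cong (suc a ∷_) (sym (Vec.zipWith-identityˡ ℕ.+-identityˡ k)) , ℕ.suc-injective p

sum≡2 : (k : Vec ℕ n) → Vec.sum k ≡ 2 → ∃₂ λ i j → k ≡ exponent i j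
sum≡2 k p =
  let i , l , k≡ , q = extract k p
      j , o , l≡ , r = extract l q
  in i , j , trans k≡ (cong (Vec.zipWith ℕ._+_ (unit i)) (trans l≡
       (trans (cong (Vec.zipWith ℕ._+_ (unit j)) (sum≡0 o r))
              (Vec.zipWith-identityʳ ℕ.+-identityʳ (unit j)))))

exponent-comm : (i j : Fin n) → exponent i j ≡ exponent j i
exponent-comm i j = Vec.zipWith-comm ℕ.+-comm (unit i) (unit j)

lattice : Vec ℕ n → Vec ℤ n
lattice = Vec.map +_

lattice-injective : (k l : Vec ℕ n) → lattice k ≡ lattice l → k ≡ l
lattice-injective []      []      _ = refl
lattice-injective (a ∷ k) (b ∷ l) e = cong₂ _∷_
  (ℤ.+-injective (Vec.∷-injectiveˡ e)) (lattice-injective k l (Vec.∷-injectiveʳ e))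

lookup-lattice-exponent : (i j l : Fin n) →
  Vec.lookup (lattice (exponent i j)) l ℚ./ 1 ≡ δ i l ℚ.+ δ j l
lookup-lattice-exponent i j l = begin
  Vec.lookup (lattice (exponent i j)) l ℚ./ 1
    ≡⟨ cong (ℚ._/ 1) (Vec.lookup-map l +_ (exponent i j)) ⟩
  ι (Vec.lookup (exponent i j) l)
    ≡⟨ cong ι (lookup-exponent i j l) ⟩
  ι (indicator (singleton i l) ℕ.+ indicator (singleton j l))
    ≡⟨ ι-+ (indicator (singleton i l)) (indicator (singleton j l)) ⟩
  ι (indicator (singleton i l)) ℚ.+ ι (indicator (singleton j l))
    ≡⟨ cong₂ ℚ._+_ (ι-indicator (singleton i l)) (ι-indicator (singleton j l)) ⟩
  δ i l ℚ.+ δ j l ∎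
  where
  open ≡.≡-Reasoning

  ι-indicator : ∀ b → ι (indicator b) ≡ (if b then 1ℚ else 0ℚ)
  ι-indicator true  = refl
  ι-indicator false = refl

latticePoint-exponent : (i j : Fin n) →
  latticePoint (lattice (exponent i j)) ≋ fromℚ ∘ λ l → δ i l ℚ.+ δ j l
latticePoint-exponent i j l = ≗⇒≈ᴿ λ _ → lookup-lattice-exponent i j l

dot-exponent : (c : Fin n → ℚ) (i j : Fin n) → dot c (λ l → δ i l ℚ.+ δ j l) ≡ c i ℚ.+ c j
dot-exponent c i j = trans (dot-+ c (δ i) (δ j)) (cong₂ ℚ._+_ (dot-δ c i) (dot-δ c j))

2Δ-nonNeg : ∀ b (c : Fin n → ℚ) → (∀ i → 0ℚ ℚ.≤ b ℚ.+ (c i ℚ.+ c i)) →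
  ∀ {x} → 2Δ n x → ∀ {u} → x ≋ fromℚ ∘ u → 0ℚ ℚ.≤ b ℚ.+ dot c u
2Δ-nonNeg {n} b c p = conv-nonNeg b c λ (i , x≋A) →
  (λ l → δ i l ℚ.+ δ i l)
  , (λ l → R.trans (x≋A l) (vertex (does (i Fin.≟ l))))
  , subst (λ t → 0ℚ ℚ.≤ b ℚ.+ t) (sym (dot-exponent c i i)) (p i)
  where
  vertex : ∀ b → (if b then fromℚ (+ 2 ℚ./ 1) else 0ᴿ) ≈ᴿ
    fromℚ ((if b then 1ℚ else 0ℚ) ℚ.+ (if b then 1ℚ else 0ℚ))
  vertex true  = ≗⇒≈ᴿ λ _ → refl
  vertex false = ≗⇒≈ᴿ λ _ → refl

dot-1 : (u : Fin n → ℚ) → dot (λ _ → 1ℚ) u ≡ ℚS.sum u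
dot-1 u = ℚS.sum-cong-≗ λ i → ℚ.*-identityˡ (u i)

sum-ι : (k : Vec ℕ n) → ℚS.sum (λ i → Vec.lookup (lattice k) i ℚ./ 1) ≡ ι (Vec.sum k)
sum-ι []      = refl
sum-ι (a ∷ k) = trans (cong (ι a ℚ.+_) (sum-ι k)) (sym (ι-+ a (Vec.sum k)))

lattice-nonNeg : (k : Vec ℤ n) → (∀ i → 0ℚ ℚ.≤ Vec.lookup k i ℚ./ 1) → ∃ λ l → k ≡ lattice l
lattice-nonNeg []      p = [] , refl
lattice-nonNeg (z ∷ k) p =
  let m , z≡ = nonNeg-integer z (p zero)
      l , k≡ = lattice-nonNeg k (p ∘ suc)
  in m ∷ l , cong₂ _∷_ z≡ k≡

-- The simplex enters through its inequalities: each coordinate is nonnegative, and the coordinate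
-- sum is at least 2 and at most 2. Integrality then leaves a sum of two unit vectors.
lattice-2Δ : (k : Vec ℤ n) → 2Δ n (latticePoint k) → ∃₂ λ i j → k ≡ lattice (exponent i j)
lattice-2Δ {n} k k∈ =
  let l , k≡ = lattice-nonNeg k λ i → subst (0ℚ ℚ.≤_)
        (trans (ℚ.+-identityˡ _) (trans (dot-comm (δ i) coordinate) (dot-δ coordinate i)))
        (2Δ-nonNeg 0ℚ (δ i) (λ j → δδ≥0 (does (i Fin.≟ j))) k∈ λ _ → R.refl)
      sum≡ = trans (cong (λ k → ℚS.sum λ i → Vec.lookup k i ℚ./ 1) k≡) (sum-ι l)
      i , j , l≡ = sum≡2 l (ℕ.≤-antisym
        (ι-cancel-≤ (subst (ℚ._≤ ι 2) sum≡ sum≤2)) (ι-cancel-≤ (subst (ι 2 ℚ.≤_) sum≡ sum≥2)))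
  in i , j , trans k≡ (cong lattice l≡)
  where
  coordinate : Fin n → ℚ
  coordinate i = Vec.lookup k i ℚ./ 1

  δδ≥0 : ∀ b → 0ℚ ℚ.≤ 0ℚ ℚ.+ ((if b then 1ℚ else 0ℚ) ℚ.+ (if b then 1ℚ else 0ℚ))
  δδ≥0 true  = toWitness {a? = _ ℚ.≤? _} _
  δδ≥0 false = ℚ.≤-refl

  sum≥2 : ι 2 ℚ.≤ ℚS.sum coordinate
  sum≥2 = subst₂ ℚ._≤_ (ℚ.+-identityʳ (ι 2))
    (trans (cancel (ι 2) _) (dot-1 coordinate))
    (ℚ.+-monoʳ-≤ (ι 2) (2Δ-nonNeg (ℚ.- ι 2) (λ _ → 1ℚ) (λ _ → ℚ.≤-refl) k∈ λ _ → R.refl))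
    where
    cancel : ∀ a d → a ℚ.+ (ℚ.- a ℚ.+ d) ≡ d
    cancel = RingSolver.solve-∀ ℚ-ring

  sum≤2 : ℚS.sum coordinate ℚ.≤ ι 2
  sum≤2 = subst₂ ℚ._≤_ (ℚ.+-identityʳ _)
    (trans (cong (λ t → ℚS.sum coordinate ℚ.+ (ι 2 ℚ.+ t)) (trans
      (trans (dot-comm _ coordinate) (sym (ℚS.*-distribʳ-sum (ℚ.- 1ℚ) coordinate)))
      (ℚ.*-comm (ℚS.sum coordinate) (ℚ.- 1ℚ)))) (cancel (ℚS.sum coordinate) (ι 2)))
    (ℚ.+-monoʳ-≤ (ℚS.sum coordinate)
      (2Δ-nonNeg (ι 2) (λ _ → ℚ.- 1ℚ) (λ _ → ℚ.≤-refl) k∈ λ _ → R.refl))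
    where
    cancel : ∀ s a → s ℚ.+ (a ℚ.+ ℚ.- 1ℚ ℚ.* s) ≡ a
    cancel = RingSolver.solve-∀ ℚ-ring

-- Quadratic monomials in a lattice polytope

-- The functional -(2xᵢ + xⱼ) at a vertex, given whether the vertex is i or j.
weight : Bool → Bool → ℚ
weight true  _     = ℚ.- ι 2
weight false true  = ℚ.- 1ℚ
weight false false = 0ℚ

weight≥-2 : ∀ a b c d → (a ≡ true → c ≢ true) → (a ≡ true → d ≢ true) → (b ≡ true → c ≢ true) →
  0ℚ ℚ.≤ ι 2 ℚ.+ (weight a b ℚ.+ weight c d)
weight≥-2 true  _     true  _     p _ _ = contradiction refl (p refl)
weight≥-2 true  _     false true  _ p _ = contradiction refl (p refl)
weight≥-2 true  _     false false _ _ _ = toWitness {a? = 0ℚ ℚ.≤? ι 2 ℚ.+ (ℚ.- ι 2 ℚ.+ 0ℚ)} _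
weight≥-2 false true  true  _     _ _ p = contradiction refl (p refl)
weight≥-2 false true  false true  _ _ _ = toWitness {a? = 0ℚ ℚ.≤? ι 2 ℚ.+ (ℚ.- 1ℚ ℚ.+ ℚ.- 1ℚ)} _
weight≥-2 false true  false false _ _ _ = toWitness {a? = 0ℚ ℚ.≤? ι 2 ℚ.+ (ℚ.- 1ℚ ℚ.+ 0ℚ)} _
weight≥-2 false false true  _     _ _ _ = toWitness {a? = 0ℚ ℚ.≤? ι 2 ℚ.+ (0ℚ ℚ.+ ℚ.- ι 2)} _
weight≥-2 false false false true  _ _ _ = toWitness {a? = 0ℚ ℚ.≤? ι 2 ℚ.+ (0ℚ ℚ.+ ℚ.- 1ℚ)} _
weight≥-2 false false false false _ _ _ = toWitness {a? = 0ℚ ℚ.≤? ι 2 ℚ.+ (0ℚ ℚ.+ 0ℚ)} _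

-- The flag c records whether j coincides with i; the sum of the weights is then -4 instead of -3,
-- below -2 either way.
weight<-2 : ∀ b c → ¬ 0ℚ ℚ.≤ ι 2 ℚ.+ (weight true b ℚ.+ weight c true)
weight<-2 _ true  = toWitnessFalse {a? = 0ℚ ℚ.≤? ι 2 ℚ.+ (ℚ.- ι 2 ℚ.+ ℚ.- ι 2)} _
weight<-2 _ false = toWitnessFalse {a? = 0ℚ ℚ.≤? ι 2 ℚ.+ (ℚ.- ι 2 ℚ.+ ℚ.- 1ℚ)} _

-- The separating functional 1_T - 1_S at a vertex; a vertex in both sets contributes zero.
surplus : Bool → Bool → ℚ
surplus row column = ι (indicator column) ℚ.- ι (indicator row)

-- Each row indicator is at most the column indicator at the other end of the edge. This takes both
-- orientations of the edge.
surplus≥0 : ∀ a b c d → (a ≡ true → d ≡ true) → (c ≡ true → b ≡ true) →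
  0ℚ ℚ.≤ 0ℚ ℚ.+ (surplus a b ℚ.+ surplus c d)
surplus≥0 true  _     _     false p _ = contradiction (p refl) λ ()
surplus≥0 _     false true  _     _ q = contradiction (q refl) λ ()
surplus≥0 true  true  true  true  _ _ = ℚ.≤-refl
surplus≥0 true  true  false true  _ _ = toWitness {a? = 0ℚ ℚ.≤? 1ℚ} _
surplus≥0 true  false false true  _ _ = ℚ.≤-refl
surplus≥0 false true  true  true  _ _ = toWitness {a? = 0ℚ ℚ.≤? 1ℚ} _
surplus≥0 false true  true  false _ _ = ℚ.≤-refl
surplus≥0 false true  false true  _ _ = toWitness {a? = 0ℚ ℚ.≤? ι 2} _
surplus≥0 false true  false false _ _ = toWitness {a? = 0ℚ ℚ.≤? 1ℚ} _
surplus≥0 false false false true  _ _ = toWitness {a? = 0ℚ ℚ.≤? 1ℚ} _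
surplus≥0 false false false false _ _ = ℚ.≤-refl

module _ {n : ℕ} (M : LatticePolytope n) where

  Edge : Fin n → Fin n → Set
  Edge i j = lattice (exponent i j) ∈ₗ generators M

  edge? : ∀ i j → Dec (Edge i j)
  edge? i j = DecMembership._∈?_ (Vec.≡-dec ℤ._≟_) (lattice (exponent i j)) (generators M)

  Edge-sym : ∀ {i j} → Edge i j → Edge j i
  Edge-sym {i} {j} = subst (λ k → lattice k ∈ₗ generators M) (exponent-comm i j)

  Member : Vec ℕ n → Set
  Member k = points M (latticePoint (lattice k))

  edge⇒member : ∀ {i j} → Edge i j → Member (exponent i j)
  edge⇒member e = conv-extensive (_ , e , λ _ → R.refl)

  midpoint : ∀ {i j} → Edge i i → Edge j j → Member (exponent i j)
  midpoint {i} {j} ii jj = record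
    { terms   = (fromℚ ½ , p) ∷ (fromℚ ½ , q) ∷ []
    ; allowed = (½≥0 , lattice (exponent i i) , ii , λ _ → R.refl)
              ∷ (½≥0 , lattice (exponent j j) , jj , λ _ → R.refl) ∷ []
    ; total   = ≗⇒≈ᴿ λ _ → refl
    ; value   = λ l → R.trans
        (R.+-cong (R.*-congˡ {fromℚ ½} (latticePoint-exponent i i l))
          (R.+-congʳ (R.*-congˡ {fromℚ ½} (latticePoint-exponent j j l))))
        (R.trans (≗⇒≈ᴿ λ _ → halves (δ i l) (δ j l)) (R.sym (latticePoint-exponent i j l)))
    }
    where
    p q : ℝ^ n
    p = latticePoint (lattice (exponent i i))
    q = latticePoint (lattice (exponent j j))

    ½≥0 : 0ᴿ ≤ᴿ fromℚ ½
    ½≥0 = fromℚ-nonNeg (toWitness {a? = 0ℚ ℚ.≤? ½} _)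

    half-double : ∀ a → ½ ℚ.* (a ℚ.+ a) ≡ a
    half-double a = trans (ℚ.*-distribˡ-+ ½ a a)
      (trans (sym (ℚ.*-distribʳ-+ a ½ ½)) (ℚ.*-identityˡ a))

    halves : ∀ a b → ½ ℚ.* (a ℚ.+ a) ℚ.+ (½ ℚ.* (b ℚ.+ b) ℚ.+ 0ℚ) ≡ a ℚ.+ b
    halves a b = cong₂ ℚ._+_ (half-double a) (trans (ℚ.+-identityʳ _) (half-double b))

  module _ (M⊆2Δ : points M ⊆ 2Δ n) where

    member⇒exponent : ∀ k → Member k → ∃₂ λ i j → k ≡ exponent i j
    member⇒exponent k k∈M =
      let i , j , e = lattice-2Δ (lattice k) (M⊆2Δ k∈M)
      in i , j , lattice-injective k (exponent i j) e

    points-nonNeg : ∀ b (c : Fin n → ℚ) → (∀ i j → Edge i j → 0ℚ ℚ.≤ b ℚ.+ (c i ℚ.+ c j)) →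
      ∀ {x} → points M x → ∀ {u} → x ≋ fromℚ ∘ u → 0ℚ ℚ.≤ b ℚ.+ dot c u
    points-nonNeg b c p = conv-nonNeg b c generator≥0
      where
      generator≥0 : ∀ {x} → (∃ λ k → k ∈ₗ generators M × x ≋ latticePoint k) →
        ∃ λ u → x ≋ fromℚ ∘ u × 0ℚ ℚ.≤ b ℚ.+ dot c u
      generator≥0 {x} (k , k∈ , x≋k) =
        let i , j , k≡ = lattice-2Δ k (M⊆2Δ (conv-extensive (k , k∈ , λ _ → R.refl)))
        in (λ l → δ i l ℚ.+ δ j l)
         , (λ l → R.trans (subst (λ k → x l ≈ᴿ latticePoint k l) k≡ (x≋k l))
                          (latticePoint-exponent i j l))
         , subst (λ t → 0ℚ ℚ.≤ b ℚ.+ t) (sym (dot-exponent c i j))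
             (p i j (subst (_∈ₗ generators M) k≡ k∈))

    exponent-nonNeg : ∀ b (c : Fin n → ℚ) → (∀ i j → Edge i j → 0ℚ ℚ.≤ b ℚ.+ (c i ℚ.+ c j)) →
      ∀ i j → Member (exponent i j) → 0ℚ ℚ.≤ b ℚ.+ (c i ℚ.+ c j)
    exponent-nonNeg b c p i j ij∈M = subst (λ t → 0ℚ ℚ.≤ b ℚ.+ t) (dot-exponent c i j)
      (points-nonNeg b c p ij∈M (latticePoint-exponent i j))

    -- For i ≠ j, the form 2xᵢ + xⱼ is at most 2 at all exponents of degree two except those of zᵢ²
    -- and zᵢ zⱼ, where it is 4 and 3. If neither is a generator, the bound 2 passes to the hull and
    -- excludes zᵢ zⱼ.
    member⇒edge⊎loop : ∀ i j → Member (exponent i j) → Edge i j ⊎ Edge i i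
    member⇒edge⊎loop i j ij∈M with edge? i j | edge? i i
    ... | yes e | _     = inj₁ e
    ... | _     | yes e = inj₂ e
    ... | no ¬ij | no ¬ii = contradiction (exponent-nonNeg (ι 2) c c≥0 i j ij∈M)
      (subst₂ (λ a b → ¬ 0ℚ ℚ.≤ ι 2 ℚ.+ (weight a (singleton j i) ℚ.+ weight (singleton i j) b))
        (sym (singleton-refl i)) (sym (singleton-refl j))
        (weight<-2 (singleton j i) (singleton i j)))
      where
      c : Fin n → ℚ
      c l = weight (singleton i l) (singleton j l)

      c≥0 : ∀ k l → Edge k l → 0ℚ ℚ.≤ ι 2 ℚ.+ (c k ℚ.+ c l)
      c≥0 k l e = weight≥-2 (singleton i k) (singleton j k) (singleton i l) (singleton j l)
        (λ ik il → ¬ii (subst₂ Edge (sym (singleton-true i k ik)) (sym (singleton-true i l il)) e))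
        (λ ik jl → ¬ij (subst₂ Edge (sym (singleton-true i k ik)) (sym (singleton-true j l jl)) e))
        (λ jk il → ¬ij (Edge-sym (subst₂ Edge (sym (singleton-true j k jk)) (sym (singleton-true i l il)) e)))

    -- Without the edge, `member⇒edge⊎loop` for (i , j) and for (j , i) demands both loops, and with
    -- both loops `midpoint` gives membership.
    member? : ∀ i j → Dec (Member (exponent i j))
    member? i j with edge? i j | edge? i i | edge? j j
    ... | yes ij | _      | _      = yes (edge⇒member ij)
    ... | no _   | yes ii | yes jj = yes (midpoint ii jj)
    ... | no ¬ij | no ¬ii | _      = no λ ij∈M →
      [ ¬ij , ¬ii ]′ (member⇒edge⊎loop i j ij∈M)
    ... | no ¬ij | _      | no ¬jj = no λ ij∈M →
      [ ¬ij ∘ Edge-sym , ¬jj ]′ (member⇒edge⊎loop j i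
        (subst Member (exponent-comm i j) ij∈M))

    module _ .{{_ : NonZero n}} (O∈M : points M (barycentre n)) where

      -- The functional `surplus` is nonnegative on M, and at the barycentre it equals 2/n times the
      -- number of columns minus the number of rows. Cancelling 2/n contradicts the deficiency.
      no-violator : ¬ Violator Edge
      no-violator V = ℕ.<⇒≱ deficient (ι-cancel-≤
        (subst₂ ℚ._≤_ (ℚ.+-identityʳ (ι (count rows)))
          (trans (cong (ι (count rows) ℚ.+_) sum-c) (cancel (ι (count rows)) (ι (count columns))))
          (ℚ.+-monoʳ-≤ (ι (count rows)) sum≥0)))
        where
        open Violator V

        c : Fin n → ℚ
        c i = surplus (rows i) (columns i)

        r : ℚ
        r = + 2 ℚ./ n

        cancel : ∀ a b → a ℚ.+ (b ℚ.- a) ≡ b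
        cancel = RingSolver.solve-∀ ℚ-ring

        c≥0 : ∀ i j → Edge i j → 0ℚ ℚ.≤ 0ℚ ℚ.+ (c i ℚ.+ c j)
        c≥0 i j e = surplus≥0 (rows i) (columns i) (rows j) (columns j)
          (neighbour i j e) (neighbour j i (Edge-sym e))

        sum-indicator : ∀ {m} (S : Fin m → Bool) → ℚS.sum (λ i → ι (indicator (S i))) ≡ ι (count S)
        sum-indicator {zero}  S = refl
        sum-indicator {suc m} S = trans (cong (ι (indicator (S zero)) ℚ.+_) (sum-indicator (S ∘ suc)))
          (sym (ι-+ (indicator (S zero)) (count (S ∘ suc))))

        sum-neg : ∀ {m} (f : Fin m → ℚ) → ℚS.sum (λ i → ℚ.- f i) ≡ ℚ.- ℚS.sum f
        sum-neg {zero}  f = refl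
        sum-neg {suc m} f = trans (cong (ℚ.- f zero ℚ.+_) (sum-neg (f ∘ suc)))
          (sym (ℚ.neg-distrib-+ (f zero) (ℚS.sum (f ∘ suc))))

        sum-c : ℚS.sum c ≡ ι (count columns) ℚ.- ι (count rows)
        sum-c = trans
          (ℚS.∑-distrib-+ (λ i → ι (indicator (columns i))) (λ i → ℚ.- ι (indicator (rows i))))
          (cong₂ ℚ._+_ (sum-indicator columns)
            (trans (sum-neg (λ i → ι (indicator (rows i)))) (cong ℚ.-_ (sum-indicator rows))))

        sum≥0 : 0ℚ ℚ.≤ ℚS.sum c
        sum≥0 = ℚ.*-cancelʳ-≤-pos r {{ℚ.normalize-pos 2 n}} (subst₂ ℚ._≤_ (sym (ℚ.*-zeroˡ r))
          (trans (ℚ.+-identityˡ (dot c λ _ → r)) (sym (ℚS.*-distribʳ-sum r c)))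
          (points-nonNeg 0ℚ c c≥0 O∈M {λ _ → r} λ _ → R.refl))

      transversal : ∃ λ (σ : Fin n → Fin n) → (∀ i → Edge i (σ i)) × Injective _≡_ _≡_ σ
      transversal with hall (λ i → filter (edge? i) (allFin n))
      ... | inj₁ (σ , σ∈ , σ-inj) =
        σ , (λ i → proj₂ (∈-filter⁻ (edge? i) {xs = allFin n} (σ∈ i))) , σ-inj
      ... | inj₂ V = contradiction
        (violator-anti (λ i j e → ∈-filter⁺ (edge? i) (∈-allFin j) e) V) no-violator

-- Coefficients of quadratic forms

sum-single : ∀ (f : Fin n → ℂ) i → (∀ j → j ≢ i → f j ≈ᶜ 0ᶜ) → ∑ᶜ f ≈ᶜ f i
sum-single {suc n} f i f≈0 = C.trans (CS.sum-remove {i = i} f) (C.trans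
  (C.+-congˡ (C.trans
    (CS.sum-cong-≋ λ k → f≈0 (punchIn i k) (Fin.punchInᵢ≢i i k))
    (CS.sum-replicate-zero n)))
  (C.+-identityʳ (f i)))

sum-pair : ∀ (f : Fin n → ℂ) {i j} → i ≢ j →
  (∀ k → k ≢ i → k ≢ j → f k ≈ᶜ 0ᶜ) → ∑ᶜ f ≈ᶜ f i +ᶜ f j
sum-pair {suc n} f {i} {j} i≢j f≈0 = C.trans (CS.sum-remove {i = i} f) (C.+-congˡ (C.trans
  (sum-single (removeAt f i) (punchOut i≢j) λ k k≢ →
    f≈0 (punchIn i k) (Fin.punchInᵢ≢i i k) λ p →
      k≢ (Fin.punchIn-injective i k _ (trans p (sym (Fin.punchIn-punchOut i≢j)))))
  (C.reflexive (cong f (Fin.punchIn-punchOut i≢j)))))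

sum-zero : ∀ (f : Fin n → ℂ) → (∀ i → f i ≈ᶜ 0ᶜ) → ∑ᶜ f ≈ᶜ 0ᶜ
sum-zero {n} f f≈0 = C.trans (CS.sum-cong-≋ f≈0) (CS.sum-replicate-zero n)

sum-#0 : ∀ (f : Fin n → ℂ) → ∑ᶜ f #ᶜ 0ᶜ → ∃ λ i → f i #ᶜ 0ᶜ
sum-#0 {zero}  f p = contradiction p 0ᶜ-#0
sum-#0 {suc n} f p = [ (λ q → zero , q)
                     , (λ q → let i , r = sum-#0 (f ∘ suc) q in suc i , r)
                     ]′ (+ᶜ-#0 (f zero) (∑ᶜ (f ∘ suc)) p)

coeff-∑ : ∀ {d} (p : Fin d → Polynomial n) k →
  coeff (∑ᴹ (polynomials n) p) k ≡ ∑ᶜ λ i → coeff (p i) k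
coeff-∑ {d = zero}  p k = refl
coeff-∑ {d = suc d} p k = cong (coeff (p zero) k +ᶜ_) (coeff-∑ (p ∘ suc) k)

coeff-monomial-≡ : (k : Vec ℕ n) → coeff (monomial k) k ≈ᶜ 1ᶜ
coeff-monomial-≡ k with Vec.≡-dec ℕ._≟_ k k
... | yes _  = C.refl
... | no k≢k = contradiction refl k≢k

coeff-monomial-≢ : {k l : Vec ℕ n} → k ≢ l → coeff (monomial k) l ≈ᶜ 0ᶜ
coeff-monomial-≢ {k = k} {l} k≢l with Vec.≡-dec ℕ._≟_ k l
... | yes k≡l = contradiction k≡l k≢l
... | no _    = C.refl

coeff-monomial-#0 : (k l : Vec ℕ n) → coeff (monomial k) l #ᶜ 0ᶜ → k ≡ l
coeff-monomial-#0 k l p with Vec.≡-dec ℕ._≟_ k l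
... | yes k≡l = k≡l
... | no _    = contradiction p 0ᶜ-#0

coeff-term-≡ : ∀ c (k : Vec ℕ n) → c *ᶜ coeff (monomial k) k ≈ᶜ c
coeff-term-≡ c k = C.trans (C.*-congˡ {c} (coeff-monomial-≡ k)) (C.*-identityʳ c)

coeff-term-≢ : ∀ c {k l : Vec ℕ n} → k ≢ l → c *ᶜ coeff (monomial k) l ≈ᶜ 0ᶜ
coeff-term-≢ c k≢l = C.trans (C.*-congˡ {c} (coeff-monomial-≢ k≢l)) (C.zeroʳ c)

exponent-lookup : {a b i j : Fin n} → exponent a b ≡ exponent i j → ∀ l →
  indicator (singleton a l) ℕ.+ indicator (singleton b l) ≡
  indicator (singleton i l) ℕ.+ indicator (singleton j l)
exponent-lookup {a = a} {b} {i} {j} e l = trans (sym (lookup-exponent a b l))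
  (trans (cong (λ k → Vec.lookup k l) e) (lookup-exponent i j l))

indicator≡1 : ∀ b → indicator b ≡ 1 → b ≡ true
indicator≡1 true _ = refl

exponent-cancel : (i : Fin n) {b j : Fin n} → exponent i b ≡ exponent i j → b ≡ j
exponent-cancel i {b} {j} e = sym (singleton-true j b (indicator≡1 _ (trans
  (sym (ℕ.+-cancelˡ-≡ (indicator (singleton i b)) _ _ (exponent-lookup e b)))
  (cong indicator (singleton-refl b)))))

-- Coordinate a is positive on the left, so a is i or j; cancelling that unit vector determines b.
exponent-injective : (a b i j : Fin n) → exponent a b ≡ exponent i j →
  (a ≡ i × b ≡ j) ⊎ (a ≡ j × b ≡ i)
exponent-injective a b i j e = Sum.map
  (λ ia → let i≡a = singleton-true i a ia in
    sym i≡a , exponent-cancel i (subst (λ a → exponent a b ≡ exponent i j) (sym i≡a) e))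
  (λ ja → let j≡a = singleton-true j a ja in
    sym j≡a , exponent-cancel j (trans
      (subst (λ a → exponent a b ≡ exponent i j) (sym j≡a) e) (exponent-comm i j)))
  (occurs (singleton i a) (singleton j a) (trans
    (cong (λ s → indicator s ℕ.+ indicator (singleton b a)) (sym (singleton-refl a)))
    (exponent-lookup e a)))
  where
  occurs : ∀ s t {x} → suc x ≡ indicator s ℕ.+ indicator t → s ≡ true ⊎ t ≡ true
  occurs true  _    _ = inj₁ refl
  occurs false true _ = inj₂ refl

coeff-quadraticForm : (A : Matrix n) (k : Vec ℕ n) →
  coeff (quadraticForm A) k ≈ᶜ ∑ᶜ λ i → ∑ᶜ λ j → A i j *ᶜ coeff (monomial (exponent i j)) k
coeff-quadraticForm {n} A k = C.trans
  (C.reflexive (coeff-∑ (λ i → ∑ᴹ (polynomials n) λ j → A i j ·ᴾ monomial (exponent i j)) k))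
  (CS.sum-cong-≋ λ i → C.reflexive (coeff-∑ (λ j → A i j ·ᴾ monomial (exponent i j)) k))

coeff-quadraticForm-diagonal : (A : Matrix n) (i : Fin n) →
  coeff (quadraticForm A) (exponent i i) ≈ᶜ A i i
coeff-quadraticForm-diagonal A i = C.trans (coeff-quadraticForm A (exponent i i)) (C.trans
  (sum-single (λ a → ∑ᶜ λ b → A a b *ᶜ coeff (monomial (exponent a b)) (exponent i i)) i
    λ a a≢i → sum-zero (λ b → A a b *ᶜ coeff (monomial (exponent a b)) (exponent i i))
      λ b → coeff-term-≢ (A a b) λ e →
        [ a≢i ∘ proj₁ , a≢i ∘ proj₁ ]′ (exponent-injective a b i i e))
  (C.trans
    (sum-single (λ b → A i b *ᶜ coeff (monomial (exponent i b)) (exponent i i)) i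
      λ b b≢i → coeff-term-≢ (A i b) (b≢i ∘ exponent-cancel i))
    (coeff-term-≡ (A i i) (exponent i i))))

coeff-quadraticForm-offDiagonal : (A : Matrix n) {i j : Fin n} → i ≢ j →
  coeff (quadraticForm A) (exponent i j) ≈ᶜ A i j +ᶜ A j i
coeff-quadraticForm-offDiagonal {n} A {i} {j} i≢j =
  C.trans (coeff-quadraticForm A (exponent i j)) (C.trans
  (sum-pair (λ a → ∑ᶜ (term a)) i≢j λ a a≢i a≢j → sum-zero (term a) λ b →
    coeff-term-≢ (A a b) λ e → [ a≢i ∘ proj₁ , a≢j ∘ proj₁ ]′ (exponent-injective a b i j e))
  (C.+-cong
    (C.trans
      (sum-single (term i) j λ b b≢j → coeff-term-≢ (A i b) (b≢j ∘ exponent-cancel i))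
      (coeff-term-≡ (A i j) (exponent i j)))
    (C.trans
      (sum-single (term j) i λ b b≢i → coeff-term-≢ (A j b) λ e →
        b≢i (exponent-cancel j (trans e (exponent-comm i j))))
      (subst (λ k → A j i *ᶜ coeff (monomial (exponent j i)) k ≈ᶜ A j i) (exponent-comm j i)
        (coeff-term-≡ (A j i) (exponent j i))))))
  where
  term : Fin n → Fin n → ℂ
  term a b = A a b *ᶜ coeff (monomial (exponent a b)) (exponent i j)

-- Off the diagonal, zᵢ zⱼ collects two equal entries of the symmetric matrix, hence the half.
scale : Fin n → Fin n → ℂ
scale i j = if does (i Fin.≟ j) then 1ᶜ else ½ᶜ

matrixOf : Polynomial n → Matrix n
matrixOf p i j = scale i j *ᶜ coeff p (exponent i j)

matrixOf-diagonal : (p : Polynomial n) (i : Fin n) → matrixOf p i i ≈ᶜ coeff p (exponent i i)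
matrixOf-diagonal p i with i Fin.≟ i
... | yes _  = C.*-identityˡ _
... | no i≢i = contradiction refl i≢i

matrixOf-offDiagonal : (p : Polynomial n) {i j : Fin n} → i ≢ j →
  matrixOf p i j ≈ᶜ ½ᶜ *ᶜ coeff p (exponent i j)
matrixOf-offDiagonal p {i} {j} i≢j with i Fin.≟ j
... | yes i≡j = contradiction i≡j i≢j
... | no _    = C.refl

matrixOf-symmetric : (p : Polynomial n) (i j : Fin n) → matrixOf p i j ≈ᶜ matrixOf p j i
matrixOf-symmetric p i j with i Fin.≟ j
... | yes refl = C.trans (C.*-identityˡ _) (C.sym (matrixOf-diagonal p i))
... | no i≢j   = C.trans (C.*-congˡ {½ᶜ} (C.reflexive (cong (coeff p) (exponent-comm i j))))
                         (C.sym (matrixOf-offDiagonal p (i≢j ∘ sym)))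

-- `Nondegenerate` offers an arbitrary symmetric matrix; uniqueness ties its determinant to the
-- coefficients of p.
matrixOf-unique : (p : Polynomial n) (B : Matrix n) → (∀ i j → B i j ≈ᶜ B j i) →
  p ≈ᴾ quadraticForm B → ∀ i j → B i j ≈ᶜ matrixOf p i j
matrixOf-unique p B B-sym p≈B i j = C.sym (go (i Fin.≟ j))
  where
  go : Dec (i ≡ j) → matrixOf p i j ≈ᶜ B i j
  go (yes refl) = C.trans (matrixOf-diagonal p i)
    (C.trans (coeff≈ p≈B (exponent i i)) (coeff-quadraticForm-diagonal B i))
  go (no i≢j) = C.trans (matrixOf-offDiagonal p i≢j) (C.trans
    (C.*-congˡ {½ᶜ} (C.trans (coeff≈ p≈B (exponent i j)) (C.trans
      (coeff-quadraticForm-offDiagonal B i≢j) (C.+-congˡ {B i j} (B-sym j i)))))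
    (½*double (B i j)))

quadraticForm-matrixOf : (p : Polynomial n) → (∀ k → coeff p k #ᶜ 0ᶜ → ∃₂ λ i j → k ≡ exponent i j) →
  p ≈ᴾ quadraticForm (matrixOf p)
quadraticForm-matrixOf {n} p homogeneous = mk≈ᴾ λ k →
  go k (Fin.any? λ i → Fin.any? λ j → Vec.≡-dec ℕ._≟_ k (exponent i j))
  where
  atExponent : ∀ i j → Dec (i ≡ j) →
    coeff p (exponent i j) ≈ᶜ coeff (quadraticForm (matrixOf p)) (exponent i j)
  atExponent i j (yes refl) = C.sym (C.trans
    (coeff-quadraticForm-diagonal (matrixOf p) i) (matrixOf-diagonal p i))
  atExponent i j (no i≢j) = C.sym (C.trans
    (coeff-quadraticForm-offDiagonal (matrixOf p) i≢j) (C.trans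
    (C.+-congˡ {matrixOf p i j} (matrixOf-symmetric p j i)) (C.trans
    (C.+-cong (matrixOf-offDiagonal p i≢j) (matrixOf-offDiagonal p i≢j)) (C.trans
    (C.sym (C.distribˡ ½ᶜ c c)) (½*double c)))))
    where
    c : ℂ
    c = coeff p (exponent i j)

  go : ∀ k → Dec (∃₂ λ i j → k ≡ exponent i j) → coeff p k ≈ᶜ coeff (quadraticForm (matrixOf p)) k
  go k (yes (i , j , refl)) = atExponent i j (i Fin.≟ j)
  -- The coefficient is only known not to be apart from zero; tightness makes it zero.
  go k (no ¬exponent) = C.trans (tightᶜ (coeff p k) (¬exponent ∘ homogeneous k)) (C.sym (C.trans
    (coeff-quadraticForm (matrixOf p) k)
    (sum-zero _ λ i → sum-zero _ λ j → coeff-term-≢ (matrixOf p i j) λ e →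
      ¬exponent (i , j , sym e))))

-- The space ℂ^M: discriminant, monomial basis, a nondegenerate form

lookup-injective : {A : Set} {xs : List A} → Unique xs →
  ∀ i j → List.lookup xs i ≡ List.lookup xs j → i ≡ j
lookup-injective (_ ∷ _)     zero    zero    _ = refl
lookup-injective (x∉ ∷ _)    zero    (suc j) e = contradiction e (All.lookup x∉ (∈-lookup j))
lookup-injective (x∉ ∷ _)    (suc i) zero    e = contradiction (sym e) (All.lookup x∉ (∈-lookup i))
lookup-injective (_ ∷ xs!)   (suc i) (suc j) e = cong suc (lookup-injective xs! i j e)

module _ {n : ℕ} (M : LatticePolytope n) where

  open Module (ℂ^ M) using (Carrierᴹ; _≈ᴹ_; _*ₗ_)

  within : ∀ p → (∀ k → coeff p k #ᶜ 0ᶜ → Member M k) → NewtonPolytope p ⊆ points M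
  within p h c = conv-isConvex record
    { terms   = terms
    ; allowed = All.map
        (λ (w≥0 , k , k∈p , e) → w≥0 , conv-resp-≋ (λ i → R.sym (e i)) (h k k∈p)) allowed
    ; total   = total
    ; value   = value
    }
    where open ConvexCombination c

  coeff#0⇒member : (v : Carrierᴹ) → ∀ k → coeff (proj₁ v) k #ᶜ 0ᶜ → Member M k
  coeff#0⇒member v k k∈p = proj₂ v (conv-extensive (k , k∈p , λ _ → R.refl))

  coeffᴹ-∑ : ∀ {d} (v : Fin d → Carrierᴹ) k →
    coeff (proj₁ (∑ᴹ (ℂ^ M) v)) k ≡ ∑ᶜ λ i → coeff (proj₁ (v i)) k
  coeffᴹ-∑ {d = zero}  v k = refl
  coeffᴹ-∑ {d = suc d} v k = cong (coeff (proj₁ (v zero)) k +ᶜ_) (coeffᴹ-∑ (v ∘ suc) k)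

  coeff-isLinear : ∀ k → IsLinear (ℂ^ M) (λ v → coeff (proj₁ v) k)
  coeff-isLinear k = record
    { isBimoduleHomomorphism = record
      { +ᴹ-isGroupHomomorphism = record
        { isMonoidHomomorphism = record
          { isMagmaHomomorphism = record
            { isRelHomomorphism = record { cong = λ e → coeff≈ e k }
            ; homo = λ _ _ → C.refl
            }
          ; ε-homo = C.refl
          }
        ; ⁻¹-homo = λ _ → C.refl
        }
      ; *ₗ-homo = λ _ _ → C.refl
      ; *ᵣ-homo = λ c v → C.*-comm c (coeff (proj₁ v) k)
      }
    }

  -- Follows the Laplace expansion of `det` term by term, with the signs as constants, so that
  -- evaluation commutes with it by induction.
  detᶠ : ∀ {m} → (Fin m → Fin m → PolynomialFunction (ℂ^ M)) → PolynomialFunction (ℂ^ M)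
  sumᶠ : ∀ {m} → (Fin m → PolynomialFunction (ℂ^ M)) → PolynomialFunction (ℂ^ M)

  sumᶠ {zero}  F = constant 0ᶜ
  sumᶠ {suc m} F = F zero ⊕ sumᶠ (F ∘ suc)

  detᶠ {zero}  F = constant 1ᶜ
  detᶠ {suc m} F = sumᶠ λ j → (constant (sgn j) ⊗ F zero j) ⊗ detᶠ (λ r c → F (suc r) (punchIn j c))

  evaluate-sumᶠ : ∀ {m} (F : Fin m → PolynomialFunction (ℂ^ M)) v →
    evaluate (ℂ^ M) (sumᶠ F) v ≡ ∑ᶜ λ i → evaluate (ℂ^ M) (F i) v
  evaluate-sumᶠ {zero}  F v = refl
  evaluate-sumᶠ {suc m} F v = cong (evaluate (ℂ^ M) (F zero) v +ᶜ_) (evaluate-sumᶠ (F ∘ suc) v)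

  evaluate-detᶠ : ∀ {m} (F : Fin m → Fin m → PolynomialFunction (ℂ^ M)) v →
    evaluate (ℂ^ M) (detᶠ F) v ≈ᶜ det (λ i j → evaluate (ℂ^ M) (F i j) v)
  evaluate-detᶠ {zero}  F v = C.refl
  evaluate-detᶠ {suc m} F v = C.trans
    (C.reflexive (evaluate-sumᶠ
      (λ j → (constant (sgn j) ⊗ F zero j) ⊗ detᶠ (λ r c → F (suc r) (punchIn j c))) v))
    (CS.sum-cong-≋ λ j → C.*-congˡ {sgn j *ᶜ evaluate (ℂ^ M) (F zero j) v}
      (evaluate-detᶠ (λ r c → F (suc r) (punchIn j c)) v))

  discriminant : PolynomialFunction (ℂ^ M)
  discriminant = detᶠ λ i j → constant (scale i j) ⊗ linear _ (coeff-isLinear (exponent i j))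

  module _ (M⊆2Δ : points M ⊆ 2Δ n) where

    homogeneous : (v : Carrierᴹ) → ∀ k → coeff (proj₁ v) k #ᶜ 0ᶜ → ∃₂ λ i j → k ≡ exponent i j
    homogeneous v k k∈p = member⇒exponent M M⊆2Δ k (coeff#0⇒member v k k∈p)

    -- Degeneracy only denies that a determinant is apart from zero, so tightness is needed to
    -- obtain the equation. Conversely, the equation refutes every matrix of the form by uniqueness.
    degenerate-isAlgebraic : IsAlgebraicSubset (ℂ^ M) (∁ (Nondegenerate ∘ proj₁))
    degenerate-isAlgebraic = discriminant ∷ [] , λ v → mk⇔
      (λ degenerate → C.trans (evaluate-discriminant v)
        (tightᶜ (det (matrixOf (proj₁ v))) λ d#0 → degenerate
          ( matrixOf (proj₁ v) , matrixOf-symmetric (proj₁ v)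
          , quadraticForm-matrixOf (proj₁ v) (homogeneous v) , d#0)) ∷ [])
      (λ { (d≈0 ∷ []) (B , B-sym , v≈B , d#0) → ≈0⇒¬#0
        (C.trans (det-cong (matrixOf-unique (proj₁ v) B B-sym v≈B))
          (C.trans (C.sym (evaluate-discriminant v)) d≈0)) d#0 })
      where
      evaluate-discriminant : ∀ v → evaluate (ℂ^ M) discriminant v ≈ᶜ det (matrixOf (proj₁ v))
      evaluate-discriminant v = evaluate-detᶠ
        (λ i j → constant (scale i j) ⊗ linear _ (coeff-isLinear (exponent i j))) v

    -- The pairs (i , j) and (j , i) give the same monomial, and a repetition would destroy linear
    -- independence; hence the deduplication.
    exponents : List (Vec ℕ n)
    exponents = deduplicate (Vec.≡-dec ℕ._≟_) (List.map (uncurry exponent)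
      (filter (uncurry (member? M M⊆2Δ)) (cartesianProduct (allFin n) (allFin n))))

    exponents-unique : Unique exponents
    exponents-unique = UniqueDec.deduplicate-! (Vec.≡-dec ℕ._≟_) _

    ∈exponents⇒member : ∀ {k} → k ∈ₗ exponents → Member M k
    ∈exponents⇒member k∈ =
      let (i , j) , ij∈ , k≡ = ∈-map⁻ (uncurry exponent) (∈-deduplicate⁻ (Vec.≡-dec ℕ._≟_) _ k∈)
          _ , ij∈M = ∈-filter⁻ (uncurry (member? M M⊆2Δ)) {xs = cartesianProduct (allFin n) (allFin n)} ij∈
      in subst (Member M) (sym k≡) ij∈M

    member⇒∈exponents : ∀ k → Member M k → k ∈ₗ exponents
    member⇒∈exponents k k∈M =
      let i , j , k≡ = member⇒exponent M M⊆2Δ k k∈M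
      in ∈-deduplicate⁺ (Vec.≡-dec ℕ._≟_) (subst (_∈ₗ _) (sym k≡) (∈-map⁺ (uncurry exponent)
           (∈-filter⁺ (uncurry (member? M M⊆2Δ))
             (∈-cartesianProduct⁺ (∈-allFin i) (∈-allFin j)) (subst (Member M) k≡ k∈M))))

    monomials : Fin (length exponents) → Carrierᴹ
    monomials i = monomial (List.lookup exponents i) , within (monomial (List.lookup exponents i))
      λ k k∈ → subst (Member M) (coeff-monomial-#0 (List.lookup exponents i) k k∈)
        (∈exponents⇒member (∈-lookup i))

    -- Serves both halves of the basis property: it reads the coordinates off a vanishing
    -- combination, and it checks the expansion at the listed exponents.
    coeff-combination : (c : Fin (length exponents) → ℂ) (i : Fin (length exponents)) →
      coeff (proj₁ (∑ᴹ (ℂ^ M) λ j → c j *ₗ monomials j)) (List.lookup exponents i) ≈ᶜ c i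
    coeff-combination c i = C.trans
      (C.reflexive (coeffᴹ-∑ (λ j → c j *ₗ monomials j) (List.lookup exponents i))) (C.trans
      (sum-single (λ j → c j *ᶜ coeff (monomial (List.lookup exponents j)) (List.lookup exponents i)) i
        λ j j≢i → coeff-term-≢ (c j) (j≢i ∘ lookup-injective exponents-unique j i))
      (coeff-term-≡ (c i) (List.lookup exponents i)))

    finiteDimensional : FiniteDimensional (ℂ^ M)
    finiteDimensional = length exponents , monomials
      , (λ v → coordinates v , mk≈ᴾ λ k →
          expansion v k (DecMembership._∈?_ (Vec.≡-dec ℕ._≟_) k exponents))
      , λ c e i → C.trans (C.sym (coeff-combination c i)) (coeff≈ e (List.lookup exponents i))
      where
      coordinates : Carrierᴹ → Fin (length exponents) → ℂ
      coordinates v i = coeff (proj₁ v) (List.lookup exponents i)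

      expansion : ∀ v k → Dec (k ∈ₗ exponents) →
        coeff (proj₁ v) k ≈ᶜ coeff (proj₁ (∑ᴹ (ℂ^ M) λ i → coordinates v i *ₗ monomials i)) k
      expansion v k (yes k∈) = subst
        (λ k → coeff (proj₁ v) k ≈ᶜ coeff (proj₁ (∑ᴹ (ℂ^ M) λ i → coordinates v i *ₗ monomials i)) k)
        (sym (lookup-index k∈)) (C.sym (coeff-combination (coordinates v) (Any.index k∈)))
      expansion v k (no k∉) = C.trans
        (tightᶜ (coeff (proj₁ v) k) (k∉ ∘ member⇒∈exponents k ∘ coeff#0⇒member v k))
        (C.sym (C.trans (C.reflexive (coeffᴹ-∑ (λ i → coordinates v i *ₗ monomials i) k))
          (sum-zero (λ i → coordinates v i *ᶜ coeff (monomial (List.lookup exponents i)) k)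
            λ i → coeff-term-≢ (coordinates v i) λ e →
              k∉ (subst (_∈ₗ exponents) e (∈-lookup i)))))

    nondegenerate-form : .{{_ : NonZero n}} → points M (barycentre n) →
      ∃ λ (v : Carrierᴹ) → Nondegenerate (proj₁ v)
    nondegenerate-form O∈M =
      let σ , σ-edge , σ-inj = transversal M M⊆2Δ O∈M
          B , adm , d#0 = nonsingular (Edge M) (λ {i} {j} → Edge-sym M {i} {j}) σ σ-inj σ-edge
      in (quadraticForm B , within (quadraticForm B) (support B adm))
         , B , Admissible.symmetric adm , mk≈ᴾ (λ _ → C.refl) , d#0
      where
      support : ∀ B → Admissible (Edge M) (λ {i} {j} → Edge-sym M {i} {j}) B →
        ∀ k → coeff (quadraticForm B) k #ᶜ 0ᶜ → Member M k
      support B adm k p =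
        let i , q = sum-#0 (λ i → ∑ᶜ λ j → B i j *ᶜ coeff (monomial (exponent i j)) k)
                      (#ᶜ0-resp-≈ (coeff-quadraticForm B k) p)
            j , r = sum-#0 (λ j → B i j *ᶜ coeff (monomial (exponent i j)) k) q
            x = coeff (monomial (exponent i j)) k
        in subst (Member M) (coeff-monomial-#0 (exponent i j) k (*ᶜ-#0 (B i j) x r))
             (edge⇒member M (Admissible.supported adm i j
               (*ᶜ-#0 x (B i j) (#ᶜ0-resp-≈ (C.*-comm (B i j) x) r))))

theorem2 : (n : ℕ) .{{_ : NonZero n}} (M : LatticePolytope n) →
    points M ⊆ 2Δ n →
    barycentre n ∈ points M →
    FiniteDimensional (ℂ^ M) × HoldsGenerically (ℂ^ M) (Nondegenerate ∘ proj₁)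
theorem2 n M M⊆2Δ O∈M = finiteDimensional M M⊆2Δ
  , degenerate-isAlgebraic M M⊆2Δ , nondegenerate-form M M⊆2Δ O∈M
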